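{- Let $k\ge 2$ and $\ell\ge 2$ be fixed integers. The following decision problem is NP-complete: given a digraph $D$ and a set $S\subseteq V(D)$ with $|S|=k$, decide whether $\lambda_S(D)\ge \ell$.
   Context: Digraphs are finite, without loops or parallel arcs. For a digraph $D$ and a set $S\subseteq V(D)$ with $|S|\ge 2$, $\lambda_S(D)$ denotes the maximum number of pairwise arc-disjoint strong (strongly connected) subgraphs of $D$ each of which contains all vertices of $S$. -}

module Defs where

open import Data.Bool.Base using (Bool; true; false; T)
open import Data.Fin.Base using (Fin)
open import Data.Fin.Subset using (Subset; _∈_; _⊆_; ∣_∣)
open import Data.List.Base as List using (List; []; _∷_; _++_; length)
open import Data.Maybe.Base as Maybe using (Maybe; just; nothing)
open import Data.Nat.Base using (ℕ; suc; _+_; _*_; _≤_)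
open import Data.Product.Base using (Σ-syntax; ∃-syntax; _×_; _,_)
open import Data.Vec.Base as Vec using (Vec; []; _∷_)
open import Function.Bundles using (_⇔_)
open import Relation.Binary.Construct.Closure.ReflexiveTransitive using (Star)
open import Relation.Binary.PropositionalEquality.Core using (_≡_; _≢_)
open import Relation.Nullary.Negation.Core using (¬_)

Word : Set
Word = List Bool

data Symbol (g : ℕ) : Set where
  □   : Symbol g
  bit : Bool → Symbol g
  aux : Fin g → Symbol g

data Move : Set where
  left stay right : Move

-- A two-way infinite tape.  Both lists run outwards from the scanned cell;
-- every cell beyond the end of a list is blank.
record Tape (g : ℕ) : Set where
  constructor tape
  field
    before  : List (Symbol g)
    scanned : Symbol g
    after   : List (Symbol g)

open Tape public

module _ {g : ℕ} where

  fromCells : List (Symbol g) → Tape g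
  fromCells []       = tape [] □ []
  fromCells (s ∷ ss) = tape [] s ss

  wordTape : Word → Tape g
  wordTape w = fromCells (List.map bit w)

  write : Symbol g → Tape g → Tape g
  write s (tape l _ r) = tape l s r

  move : Move → Tape g → Tape g
  move stay  t                  = t
  move left  (tape []       s r) = tape [] □ (s ∷ r)
  move left  (tape (x ∷ l)  s r) = tape l x (s ∷ r)
  move right (tape l s [])       = tape (s ∷ l) □ []
  move right (tape l s (x ∷ r))  = tape (s ∷ l) x r

  act : Symbol g × Move → Tape g → Tape g
  act (s , m) t = move m (write s t)

  bitPrefix : List (Symbol g) → Word
  bitPrefix (bit b ∷ ss) = b ∷ bitPrefix ss
  bitPrefix _            = []

  -- The output is the longest bit string starting at the scanned cell.
  readWord : Tape g → Word
  readWord t = bitPrefix (scanned t ∷ after t)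

record Configuration (q g n : ℕ) : Set where
  constructor config
  field
    state   : Fin q
    content : Vec (Tape g) n

-- Tape 0 is the output tape; it is followed by r input tapes, one for each
-- argument, and by the work tapes.  All tapes may be read and written.
-- The machine halts when δ is undefined.
record TM (r : ℕ) : Set where
  field
    states work auxs : ℕ

  tapes : ℕ
  tapes = suc (r + work)

  field
    start : Fin states
    δ     : Fin states → Vec (Symbol auxs) tapes →
            Maybe (Fin states × Vec (Symbol auxs × Move) tapes)

  Config : Set
  Config = Configuration states auxs tapes

  initial : Vec Word r → Config
  initial ws = config start
    (wordTape [] ∷ (Vec.map wordTape ws Vec.++ Vec.replicate work (wordTape [])))

  perform : Vec (Tape auxs) tapes →
            Fin states × Vec (Symbol auxs × Move) tapes → Config
  perform ts (q , as) = config q (Vec.zipWith act as ts)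

  step : Config → Maybe Config
  step (config q ts) = Maybe.map (perform ts) (δ q (Vec.map scanned ts))

  output : Config → Word
  output (config _ (t ∷ _)) = readWord t

  -- c ⇓[ t ] d : from c the machine makes exactly t steps and halts in d.
  data _⇓[_]_ : Config → ℕ → Config → Set where
    halt : ∀ {c} → step c ≡ nothing → c ⇓[ 0 ] c
    next : ∀ {c c′ d t} → step c ≡ just c′ → c′ ⇓[ t ] d → c ⇓[ suc t ] d

infixl 6 _⊕_
infixl 7 _⊗_

data Poly : Set where
  con     : ℕ → Poly
  X       : Poly
  _⊕_ _⊗_ : Poly → Poly → Poly

eval : Poly → ℕ → ℕ
eval (con c) n = c
eval X       n = n
eval (p ⊕ q) n = eval p n + eval q n
eval (p ⊗ q) n = eval p n * eval q n

inputSize : ∀ {r} → Vec Word r → ℕ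
inputSize ws = Vec.sum (Vec.map length ws)

ComputesInTime : ∀ {r} → TM r → (Vec Word r → Word) → Poly → Set
ComputesInTime M f p =
  ∀ ws → ∃[ t ] ∃[ d ] (initial ws ⇓[ t ] d × output d ≡ f ws × t ≤ eval p (inputSize ws))
  where open TM M

PolyTime : ∀ {r} → (Vec Word r → Word) → Set
PolyTime {r} f = Σ[ M ∈ TM r ] ∃[ p ] ComputesInTime M f p

unary : (Word → Word) → Vec Word 1 → Word
unary f (x ∷ []) = f x

binary : (Word → Word → Word) → Vec Word 2 → Word
binary f (x ∷ y ∷ []) = f x y

PolyTimeFunction : (Word → Word) → Set
PolyTimeFunction f = PolyTime (unary f)

PolyTimePredicate₂ : (Word → Word → Bool) → Set
PolyTimePredicate₂ V = PolyTime (binary λ x y → V x y ∷ [])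

Language : Set₁
Language = Word → Set

NP : Language → Set
NP L = ∃[ V ] ∃[ p ] (PolyTimePredicate₂ V ×
  (∀ x → L x ⇔ (∃[ y ] (length y ≤ eval p (length x) × V x y ≡ true))))

_≤ₚ_ : Language → Language → Set
L ≤ₚ L′ = ∃[ f ] (PolyTimeFunction f × (∀ x → L x ⇔ L′ (f x)))

NPHard : Language → Set₁
NPHard L = ∀ L′ → NP L′ → L′ ≤ₚ L

NPComplete : Language → Set₁
NPComplete L = NP L × NPHard L

record DecisionProblem : Set₁ where
  field
    Instance : Set
    encode   : Instance → Word
    Yes      : Instance → Set

  -- Words that encode no instance are not in the language.
  language : Language
  language w = ∃[ i ] (encode i ≡ w × Yes i)

-- An adjacency matrix, so parallel arcs cannot occur.
record Digraph : Set where
  field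
    order    : ℕ
    arc      : Fin order → Fin order → Bool
    loopless : ∀ v → arc v v ≡ false

  Vertex : Set
  Vertex = Fin order

record Subgraph (D : Digraph) : Set where
  open Digraph D
  field
    vertices : Subset order
    arcs     : Vertex → Vertex → Bool
    arcs⊆    : ∀ {u v} → T (arcs u v) → T (arc u v)
    tail∈    : ∀ {u v} → T (arcs u v) → u ∈ vertices
    head∈    : ∀ {u v} → T (arcs u v) → v ∈ vertices

  Reaches : Vertex → Vertex → Set
  Reaches = Star (λ u v → T (arcs u v))

  Strong : Set
  Strong = ∀ {u v} → u ∈ vertices → v ∈ vertices → Reaches u v

module _ (D : Digraph) where
  open Digraph D
  open Subgraph

  ArcDisjoint : Subgraph D → Subgraph D → Set
  ArcDisjoint H K = ∀ u v → ¬ (T (arcs H u v) × T (arcs K u v))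

  record Packing (S : Subset order) (m : ℕ) : Set where
    field
      member   : Fin m → Subgraph D
      strong   : ∀ i → Strong (member i)
      contains : ∀ i → S ⊆ vertices (member i)
      disjoint : ∀ {i j} → i ≢ j → ArcDisjoint (member i) (member j)

  -- λ_S(D) = m.  The maximum exists whenever ∣ S ∣ ≥ 2, since each member of
  -- a packing then uses at least one arc.
  IsLambda : Subset order → ℕ → Set
  IsLambda S m = Packing S m × (∀ m′ → Packing S m′ → m′ ≤ m)

  Lambda≥ : Subset order → ℕ → Set
  Lambda≥ S ℓ = ∃[ m ] (IsLambda S m × ℓ ≤ m)

record TerminalDigraph (k : ℕ) : Set where
  field
    digraph : Digraph

  open Digraph digraph public

  field
    terminals   : Subset order
    ∣terminals∣ : ∣ terminals ∣ ≡ k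

-- The order in unary, terminated by false, then the adjacency matrix row by
-- row, then the characteristic vector of the terminal set.
encodeTerminalDigraph : ∀ {k} → TerminalDigraph k → Word
encodeTerminalDigraph G =
  List.replicate order true ++ false ∷
  List.concat (List.tabulate (λ u → List.tabulate (arc u))) ++
  Vec.toList terminals
  where open TerminalDigraph G

StrongSubgraphPacking : ℕ → ℕ → DecisionProblem
StrongSubgraphPacking k ℓ = record
  { Instance = TerminalDigraph k
  ; encode   = encodeTerminalDigraph
  ; Yes      = λ G → let open TerminalDigraph G in Lambda≥ digraph terminals ℓ
  }

{-# OPTIONS --safe #-}
-- Membership: a certificate lists, for each of the ℓ subgraphs, a closed walk (with pauses) through all of its vertices.
-- Since such certificates can be searched exhaustively, the maximum λ_S(D) exists constructively.
--
-- Hardness: a computation of a verifier M on x and an unknown certificate is described by a propositional formula, in which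
-- tape cells are addressed relative to the head, so that every clause is one of finitely many templates.  The formula is
-- turned into a digraph made of nodes, that is, arcs through which at most one subgraph can pass.  For every literal y
-- and clause c there is a switch of six nodes
--
--   Q j → α h → P j,   α h → ι (not h),   ι h → o h → α h,   ι h → Q (suc j),   P (suc j) → o h   (h : Bool).
--
-- If one subgraph A uses P j and another subgraph B uses Q j, then the only way for every node to keep a predecessor and a
-- successor in its own subgraph is that A also uses P (suc j), that B uses Q (suc j), and that exactly one side h stays
-- free.  By induction this holds in all switches, and then B can only pass a switch along ι h → o h on the free side.
-- Behind the switches B has to follow, for each variable, the route of one of its two literals through the sides false, and
-- then, for each clause, one of its literals through the side true; so the routes not taken satisfy all clauses.
-- The terminals s and t are joined to one node for each of the ℓ subgraphs, in such a way that the subgraphs using the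
-- first two of these nodes are forced to be A and B.
--
-- Both the verifier and the reduction are evaluated by a language of bounded arithmetic on unary numbers, whose programs
-- are compiled once and for all to Turing machines that run in polynomial time.
module Submission where

-- A model of the formula may make too many facts true, since no clause forbids two symbols in one
-- cell or two states at one time. This is harmless: once a certificate has been read off the model,
-- the run is deterministic, and by induction on time every fact true of the run is true in the
-- model; a run ending with output false would therefore violate a clause.
--
-- Strong connectivity enters the hardness proof only locally: every subgraph contains two
-- terminals, so each of its vertices has an arc of the subgraph going out and one coming in. The
-- switches have to work with this alone. For that reason A and B cross them in opposite directions,
-- A down the nodes `P` and B up the nodes `Q`: each node held by one of them takes away a
-- predecessor or a successor from the other, and nothing but the side remains to be chosen.
--
-- Terminals beyond the first two are joined in both directions to all nodes standing for subgraphs,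
-- and each subgraph beyond A and B consists of the terminals and its own node. So k and ℓ enter as
-- constants only.

open import Data.Bool.Base using (Bool; true; false; T; if_then_else_; not)
open import Data.Bool.Properties using (not-involutive) renaming (_≟_ to _≟ᵇ_)
open import Data.Empty using (⊥; ⊥-elim)
open import Data.Fin.Base as Fin using (Fin; zero; suc; toℕ; fromℕ<; _↑ˡ_; _↑ʳ_; splitAt)
open import Data.Fin using (#_)
import Data.Fin.Properties as Fin
open import Data.Fin.Subset.Properties using () renaming (_∈?_ to _∈ₛ?_)
open import Data.Fin.Subset using (Subset; ∣_∣) renaming (_∈_ to _∈ₛ_)
open import Data.List.Base as List using (List; []; _∷_; _++_; length)
import Data.List.Properties as List
open import Data.List.Relation.Unary.All as All using (All; []; _∷_)
open import Data.List.Relation.Unary.Any.Properties using (lookup-index)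
open import Data.List.Relation.Unary.Any as Any using (Any; here; there)
open import Data.List.Membership.Propositional using (_∈_)
open import Data.List.Membership.Propositional.Properties using (∈-lookup; ∈-allFin; ∈-++⁺ˡ; ∈-++⁺ʳ; ∈-map⁺; ∈-concatMap⁺; ∈-concat⁺′)
open import Data.List.Relation.Unary.Unique.Propositional using (Unique; []; _∷_)
open import Data.Maybe.Base as Maybe using (Maybe; just; nothing)
open import Data.Nat.Base using (ℕ; zero; suc; _+_; _*_; _∸_; _⊔_; _≡ᵇ_; _≤ᵇ_; _<ᵇ_; _≤_; _<_; z≤n; s≤s; s≤s⁻¹)
import Data.Nat.Properties as ℕ
import Data.Maybe.Properties as Maybe
open import Data.Product.Base using (∃-syntax; Σ-syntax; _×_; _,_; proj₁; proj₂)
open import Data.Sum.Base as Sum using (_⊎_; inj₁; inj₂)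
open import Data.Unit.Base using (⊤; tt)
open import Data.Vec.Base as Vec using (Vec; []; _∷_)
import Data.Vec.Properties as Vec
open import Function.Base using (_∘_; id)
open import Function.Bundles using (_⇔_; mk⇔; Equivalence)
open import Relation.Binary.Definitions using (tri<; tri≈; tri>)
open import Relation.Binary.PropositionalEquality using (_≡_; _≢_; refl; sym; trans; cong; cong₂; subst; subst₂)
open import Relation.Binary.Construct.Closure.ReflexiveTransitive using (Star; ε; _◅_; _◅◅_)
open import Relation.Nullary.Decidable using (⌊_⌋; toWitness; fromWitness; _×-dec_; ¬?; T?; map′)
open import Relation.Nullary using (¬_; Dec; yes; no; contradiction)
open import Defs

-- Flowchart programs

-- Numbers are kept as head positions, so blanks and bits make up the whole alphabet of the compiled
-- machines.
Sym : Set
Sym = Symbol 0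

record Code (m : ℕ) : Set where
  field
    size  : ℕ
    entry : Fin size
    instr  : Fin size → Vec Sym m → Maybe (Fin size) × Vec (Sym × Move) m

open Code

Tapes : ℕ → Set
Tapes = Vec (Tape 0)

applyActs : ∀ {m} → Vec (Sym × Move) m → Tapes m → Tapes m
applyActs = Vec.zipWith act

-- The control point nothing is the exit.
data Path {m} (A : Code m) : Maybe (Fin (size A)) → Tapes m → ℕ → Maybe (Fin (size A)) → Tapes m → Set where
  arrived : ∀ {x ts} → Path A x ts 0 x ts
  tick : ∀ {p x y as ts t us} → instr A p (Vec.map scanned ts) ≡ (x , as) →
         Path A x (applyActs as ts) t y us → Path A (just p) ts (suc t) y us

_∶_⟶[_]_ : ∀ {m} → Code m → Tapes m → ℕ → Tapes m → Set
A ∶ ts ⟶[ t ] us = Path A (just (entry A)) ts t nothing us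

joinPaths : ∀ {m} {A : Code m} {x ts t y us t′ z vs} →
            Path A x ts t y us → Path A y us t′ z vs → Path A x ts (t + t′) z vs
joinPaths arrived       q = q
joinPaths (tick e p) q = tick e (joinPaths p q)

redirect : ∀ {a b} {W : Set} → (Fin a → Fin b) → Maybe (Fin b) → Maybe (Fin a) × W → Maybe (Fin b) × W
redirect f e (just p  , w) = just (f p) , w
redirect f e (nothing , w) = e , w

redirectPoint : ∀ {a b} → (Fin a → Fin b) → Maybe (Fin b) → Maybe (Fin a) → Maybe (Fin b)
redirectPoint f e (just p) = just (f p)
redirectPoint f e nothing  = e

redirect-point : ∀ {a b} {W : Set} (f : Fin a → Fin b) e x (w : W) →
                 redirect f e (x , w) ≡ (redirectPoint f e x , w)
redirect-point f e (just p) w = refl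
redirect-point f e nothing  w = refl

-- The one simulation lemma behind all combinators: when `B` copies the instructions of `A` along
-- `f` and reroutes the exit of `A` to `e`, paths are replayed with the same number of steps.
-- Sequencing takes the entry of the second program for `e`, a loop takes its test.
embedPath : ∀ {m} {A B : Code m} (f : Fin (size A) → Fin (size B)) (e : Maybe (Fin (size B))) →
            (∀ p ss → instr B (f p) ss ≡ redirect f e (instr A p ss)) →
            ∀ {x ts t y us} → Path A x ts t y us →
            Path B (redirectPoint f e x) ts t (redirectPoint f e y) us
embedPath f e h arrived = arrived
embedPath f e h (tick {p} {x} {as = as} {ts = ts} eq q) =
  tick (trans (h p (Vec.map scanned ts)) (trans (cong (redirect f e) eq) (redirect-point f e x as)))
       (embedPath f e h q)

keepAll : ∀ {m} → Vec Sym m → Vec (Sym × Move) m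
keepAll = Vec.map (_, stay)

applyActs-keepAll : ∀ {m} (ts : Tapes m) → applyActs (keepAll (Vec.map scanned ts)) ts ≡ ts
applyActs-keepAll []               = refl
applyActs-keepAll (tape b s a ∷ ts) = cong (tape b s a ∷_) (applyActs-keepAll ts)

prim : ∀ {m} → (Vec Sym m → Vec (Sym × Move) m) → Code m
prim f = record { size = 1 ; entry = zero ; instr = λ _ ss → nothing , f ss }

prim-run : ∀ {m} (f : Vec Sym m → Vec (Sym × Move) m) ts →
           prim f ∶ ts ⟶[ 1 ] applyActs (f (Vec.map scanned ts)) ts
prim-run f ts = tick refl arrived

infixr 5 _⨾_

_⨾_ : ∀ {m} → Code m → Code m → Code m
A ⨾ B = record
  { size  = size A + size B
  ; entry = entry A ↑ˡ size B
  ; instr  = λ p ss → Sum.[ (λ q → redirect (_↑ˡ size B) (just (size A ↑ʳ entry B)) (instr A q ss))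
                         , (λ q → redirect (size A ↑ʳ_) nothing (instr B q ss)) ]′ (splitAt (size A) p)
  }

⨾-run : ∀ {m} {A B : Code m} {ts t us t′ vs} →
        A ∶ ts ⟶[ t ] us → B ∶ us ⟶[ t′ ] vs → (A ⨾ B) ∶ ts ⟶[ t + t′ ] vs
⨾-run {A = A} {B} p q =
  joinPaths (embedPath (_↑ˡ size B) _ inA p) (embedPath (size A ↑ʳ_) nothing inB q)
  where
  inA : ∀ i ss → instr (A ⨾ B) (i ↑ˡ size B) ss ≡ _
  inA i ss rewrite Fin.splitAt-↑ˡ (size A) i (size B) = refl
  inB : ∀ i ss → instr (A ⨾ B) (size A ↑ʳ i) ss ≡ _
  inB i ss rewrite Fin.splitAt-↑ʳ (size A) (size B) i = refl

cond : ∀ {m} → (Vec Sym m → Bool) → Code m → Code m → Code m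
cond test A B = record { size = suc (size A + size B) ; entry = zero ; instr = go }
  where
  go : Fin (suc (size A + size B)) → Vec Sym _ → _
  go zero    ss = just (suc (if test ss then entry A ↑ˡ size B else size A ↑ʳ entry B)) , keepAll ss
  go (suc p) ss = Sum.[ (λ q → redirect (suc ∘ (_↑ˡ size B)) nothing (instr A q ss))
                      , (λ q → redirect (suc ∘ (size A ↑ʳ_)) nothing (instr B q ss)) ]′ (splitAt (size A) p)

cond-run-true : ∀ {m} {test} {A B : Code m} {ts t us} → test (Vec.map scanned ts) ≡ true →
                A ∶ ts ⟶[ t ] us → cond test A B ∶ ts ⟶[ suc t ] us
cond-run-true {test = test} {A} {B} {ts} e p =
  tick (cong (λ b → just (suc (if b then entry A ↑ˡ size B else size A ↑ʳ entry B)) , keepAll _) e)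
       (subst (λ ts′ → Path _ _ ts′ _ _ _) (sym (applyActs-keepAll ts))
         (embedPath {A = A} {cond test A B} (suc ∘ (_↑ˡ size B)) nothing inA p))
  where
  inA : ∀ i ss → instr (cond test A B) (suc (i ↑ˡ size B)) ss ≡ _
  inA i ss rewrite Fin.splitAt-↑ˡ (size A) i (size B) = refl

cond-run-false : ∀ {m} {test} {A B : Code m} {ts t us} → test (Vec.map scanned ts) ≡ false →
                 B ∶ ts ⟶[ t ] us → cond test A B ∶ ts ⟶[ suc t ] us
cond-run-false {test = test} {A} {B} {ts} e p =
  tick (cong (λ b → just (suc (if b then entry A ↑ˡ size B else size A ↑ʳ entry B)) , keepAll _) e)
       (subst (λ ts′ → Path _ _ ts′ _ _ _) (sym (applyActs-keepAll ts))
         (embedPath {A = B} {cond test A B} (suc ∘ (size A ↑ʳ_)) nothing inB p))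
  where
  inB : ∀ i ss → instr (cond test A B) (suc (size A ↑ʳ i)) ss ≡ _
  inB i ss rewrite Fin.splitAt-↑ʳ (size A) (size B) i = refl

while : ∀ {m} → (Vec Sym m → Bool) → Code m → Code m
while test A = record { size = suc (size A) ; entry = zero ; instr = go }
  where
  go : Fin (suc (size A)) → Vec Sym _ → _
  go zero    ss = (if test ss then just (suc (entry A)) else nothing) , keepAll ss
  go (suc p) ss = redirect suc (just zero) (instr A p ss)

while-run-false : ∀ {m} {test} {A : Code m} {ts} → test (Vec.map scanned ts) ≡ false →
                  while test A ∶ ts ⟶[ 1 ] ts
while-run-false {A = A} {ts} e =
  tick (cong (λ b → (if b then just (suc (entry A)) else nothing) , keepAll _) e)
       (subst (Path _ _ _ _ _) (applyActs-keepAll ts) arrived)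

while-run-true : ∀ {m} {test} {A : Code m} {ts t us t′ vs} → test (Vec.map scanned ts) ≡ true →
                 A ∶ ts ⟶[ t ] us → while test A ∶ us ⟶[ t′ ] vs → while test A ∶ ts ⟶[ suc (t + t′) ] vs
while-run-true {test = test} {A} {ts} e p q =
  tick (cong (λ b → (if b then just (suc (entry A)) else nothing) , keepAll _) e)
       (subst (λ ts′ → Path _ _ ts′ _ _ _) (sym (applyActs-keepAll ts))
         (joinPaths (embedPath {A = A} {while test A} suc (just zero) (λ _ _ → refl) p) q))

leave : ∀ {n} {W : Set} → Maybe (Fin n) × W → Fin (suc n) × W
leave (just p  , as) = suc p , as
leave (nothing , as) = zero , as

-- State `zero` represents the exit: `δ` is undefined there, which is how a machine halts. Control
-- point `p` becomes state `suc p`, and leaving costs no extra step.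
toTM : ∀ {r w} → Code (suc (r + w)) → TM r
toTM {r} {w} A = record { states = suc (size A) ; work = w ; auxs = 0 ; start = suc (entry A) ; δ = δ }
  where
  δ : Fin (suc (size A)) → Vec Sym (suc (r + w)) → Maybe (Fin (suc (size A)) × Vec (Sym × Move) (suc (r + w)))
  δ zero    ss = nothing
  δ (suc p) ss = just (leave (instr A p ss))

toTM-run : ∀ {r w} (A : Code (suc (r + w))) {ts t us} → A ∶ ts ⟶[ t ] us →
           TM._⇓[_]_ (toTM {r} {w} A) (config (suc (entry A)) ts) t (config zero us)
toTM-run {r} {w} A = go
  where
  open TM (toTM {r} {w} A) using (_⇓[_]_; halt; perform) renaming (next to continue)
  go : ∀ {p ts t us} → Path A (just p) ts t nothing us → config (suc p) ts ⇓[ t ] config zero us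
  go (tick {x = just _}  e q)    = continue (cong (λ y → just (perform _ (leave y))) e) (go q)
  go (tick {x = nothing} e arrived) = continue (cong (λ y → just (perform _ (leave y))) e) (halt refl)

-- Counters on tapes

nth : ∀ {A : Set} → A → List A → ℕ → A
nth d []       i       = d
nth d (x ∷ xs) zero    = x
nth d (x ∷ xs) (suc i) = nth d xs i

bitAt : Word → ℕ → Bool
bitAt = nth false

AllBlank : List Sym → Set
AllBlank = All (_≡ □)

ʳ++-++ : ∀ {A : Set} (b : List A) {ys zs : List A} → (b List.ʳ++ ys) ++ zs ≡ b List.ʳ++ (ys ++ zs)
ʳ++-++ []      = refl
ʳ++-++ (x ∷ b) = ʳ++-++ b

nth-ʳ++ : ∀ {A : Set} {d : A} (b : List A) {ys} i → nth d (b List.ʳ++ ys) (length b + i) ≡ nth d ys i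
nth-ʳ++ []      i = refl
nth-ʳ++ {d = d} (x ∷ b) {ys} i =
  trans (cong (nth d (b List.ʳ++ (x ∷ ys))) (sym (ℕ.+-suc (length b) i))) (nth-ʳ++ b {x ∷ ys} (suc i))

isOne isBit isMark : Sym → Bool
isOne (bit b) = b
isOne □       = false
isBit (bit b) = true
isBit □       = false
isMark = isBit

nth-blank : ∀ {bl} i → AllBlank bl → nth □ bl i ≡ □
nth-blank i       []         = refl
nth-blank zero    (refl ∷ _) = refl
nth-blank (suc i) (_ ∷ bl)   = nth-blank i bl

isOne-nth : ∀ w {bl} i → AllBlank bl → isOne (nth □ (List.map bit w ++ bl) i) ≡ bitAt w i
isOne-nth []      i       bl rewrite nth-blank i bl = refl
isOne-nth (b ∷ w) zero    bl = refl
isOne-nth (b ∷ w) (suc i) bl = isOne-nth w i bl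

isBit-nth-< : ∀ w {bl} i m → i + suc m ≡ length w → isBit (nth □ (List.map bit w ++ bl) i) ≡ true
isBit-nth-< (b ∷ w) zero    m e = refl
isBit-nth-< (b ∷ w) (suc i) m e = isBit-nth-< w i m (ℕ.suc-injective e)

isBit-nth-end : ∀ w {bl} → AllBlank bl → isBit (nth □ (List.map bit w ++ bl) (length w)) ≡ false
isBit-nth-end []      bl rewrite nth-blank 0 bl = refl
isBit-nth-end (b ∷ w) bl = isBit-nth-end w bl

-- The value of a counter is the distance of the head from a marked cell.
record IsCounter (v : ℕ) (t : Tape 0) : Set where
  constructor isCounter
  field
    marked : scanned t ∷ before t ≡ List.replicate v □ ++ bit true ∷ []
    rest   : AllBlank (after t)

-- The value of an input tape is the position of its head.
record IsInput (w : Word) (v : ℕ) (t : Tape 0) : Set where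
  constructor isInput
  field
    {blanks} : List Sym
    allBlank : AllBlank blanks
    contents : before t List.ʳ++ (scanned t ∷ after t) ≡ List.map bit w ++ blanks
    position : length (before t) ≡ v

record IsOutput (o : Word) (t : Tape 0) : Set where
  constructor isOutput
  field
    written : before t List.ʳ++ [] ≡ List.map bit o
    atEnd   : scanned t ≡ □
    rest    : AllBlank (after t)

keep : Move → Sym → Sym × Move
keep d s = s , d

run : (Sym → Sym × Move) → Tape 0 → Tape 0
run f t = act (f (scanned t)) t

counter-inc : ∀ {v t} → IsCounter v t → IsCounter (suc v) (run (keep right) t)
counter-inc {t = tape b s []}      (isCounter m r)          = isCounter (cong (□ ∷_) m) []
counter-inc {t = tape b s (x ∷ a)} (isCounter m (refl ∷ r)) = isCounter (cong (□ ∷_) m) r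

counter-dec : ∀ {v t} → IsCounter (suc v) t → IsCounter v (run (keep left) t)
counter-dec {t = tape (x ∷ b) s a} (isCounter m r) = isCounter (List.∷-injectiveʳ m) (List.∷-injectiveˡ m ∷ r)
counter-dec {zero}  {t = tape [] s a} (isCounter () r)
counter-dec {suc v} {t = tape [] s a} (isCounter () r)

counter-zero : ∀ {t} → IsCounter 0 t → isMark (scanned t) ≡ true
counter-zero {tape b .(bit true) a} (isCounter refl r) = refl

counter-suc : ∀ {v t} → IsCounter (suc v) t → isMark (scanned t) ≡ false
counter-suc {v} {tape b s a} (isCounter m r) = cong isMark (List.∷-injectiveˡ m)

input-inc : ∀ {w v t} → IsInput w v t → IsInput w (suc v) (run (keep right) t)
-- Moving beyond the end of the list creates a cell, so one blank is appended to `blanks`.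
input-inc {w} {t = tape b s []} (isInput {bl} ab c p) =
  isInput {blanks = bl ++ □ ∷ []} (All-snoc ab)
    (trans (sym (ʳ++-++ b)) (trans (cong (_++ □ ∷ []) c) (List.++-assoc (List.map bit w) bl _))) (cong suc p)
  where
  All-snoc : ∀ {xs} → AllBlank xs → AllBlank (xs ++ □ ∷ [])
  All-snoc []       = refl ∷ []
  All-snoc (e ∷ es) = e ∷ All-snoc es
input-inc {t = tape b s (x ∷ a)} (isInput ab c p) = isInput ab c (cong suc p)

input-dec : ∀ {w v t} → IsInput w (suc v) t → IsInput w v (run (keep left) t)
input-dec {t = tape (x ∷ b) s a} (isInput ab c p) = isInput ab c (ℕ.suc-injective p)

input-scanned : ∀ {w v t} → IsInput w v t →
                ∃[ bl ] (AllBlank bl × scanned t ≡ nth □ (List.map bit w ++ bl) v)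
input-scanned {w} {v} {tape b s a} (isInput {bl} ab c refl) = bl , ab ,
  trans (sym (nth-ʳ++ b 0)) (trans (cong (nth □ (b List.ʳ++ (s ∷ a))) (ℕ.+-identityʳ _)) (cong (λ xs → nth □ xs (length b)) c))

emitBit : Bool → Sym → Sym × Move
emitBit b _ = bit b , right

output-emit : ∀ {o t} b → IsOutput o t → IsOutput (o ++ b ∷ []) (run (emitBit b) t)
output-emit {o} {tape bf s []}      b (isOutput wr e r) =
  isOutput (trans (sym (ʳ++-++ bf)) (trans (cong (_++ bit b ∷ []) wr) (sym (List.map-++ bit o _)))) refl []
output-emit {o} {tape bf s (x ∷ a)} b (isOutput wr e (refl ∷ r)) =
  isOutput (trans (sym (ʳ++-++ bf)) (trans (cong (_++ bit b ∷ []) wr) (sym (List.map-++ bit o _)))) refl r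

Store : Set
Store = ℕ → ℕ

infixl 6 _[_↦_]

_[_↦_] : Store → ℕ → ℕ → Store
(v [ x ↦ k ]) y = if y ≡ᵇ x then k else v y

≡ᵇ-refl : ∀ x → (x ≡ᵇ x) ≡ true
≡ᵇ-refl zero    = refl
≡ᵇ-refl (suc x) = ≡ᵇ-refl x

upd-same : ∀ v x k → (v [ x ↦ k ]) x ≡ k
upd-same v x k rewrite ≡ᵇ-refl x = refl

upd-other : ∀ v x k {y} → y ≢ x → (v [ x ↦ k ]) y ≡ v y
upd-other v x k {y} ne with y ≡ᵇ x in e
... | true  = contradiction (ℕ.≡ᵇ⇒≡ y x (subst T (sym e) tt)) ne
... | false = refl

-- Programs address tapes by plain numbers. Clamping makes every address meaningful, so code is
-- written without bounds and these are demanded only where correctness is proved.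
clamp : ∀ n → ℕ → Fin (suc n)
clamp zero    j       = zero
clamp (suc n) zero    = zero
clamp (suc n) (suc j) = suc (clamp n j)

clamp-injective : ∀ n {i j} → i ≤ n → j ≤ n → clamp n i ≡ clamp n j → i ≡ j
clamp-injective zero    z≤n       z≤n       e = refl
clamp-injective (suc n) z≤n       z≤n       e = refl
clamp-injective (suc n) z≤n       (s≤s _)   ()
clamp-injective (suc n) (s≤s _)   z≤n       ()
clamp-injective (suc n) (s≤s i≤n) (s≤s j≤n) e = cong suc (clamp-injective n i≤n j≤n (Fin.suc-injective e))

-- Tape 0 is the output tape, tapes 1, …, r are the inputs and the remaining ones are counters.
module Programs (r w : ℕ) where

  top : ℕ
  top = r + w

  Prog : Set
  Prog = Code (suc top)

  tp : ℕ → Fin (suc top)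
  tp = clamp top

  op : ℕ → (Sym → Sym × Move) → Prog
  op x f = prim (λ ss → Vec.updateAt (keepAll ss) (tp x) (λ _ → f (Vec.lookup ss (tp x))))

  inc dec : ℕ → Prog
  inc x = op x (keep right)
  dec x = op x (keep left)

  emitP : Bool → Prog
  emitP b = op 0 (emitBit b)

  skip : Prog
  skip = prim keepAll

  nonzero? : ℕ → Vec Sym (suc top) → Bool
  nonzero? x ss = not (isMark (Vec.lookup ss (tp x)))

  one? nonblank? : ℕ → Vec Sym (suc top) → Bool
  one? x ss = isOne (Vec.lookup ss (tp x))
  nonblank? x ss = isBit (Vec.lookup ss (tp x))

  countdown : ℕ → Prog → Prog
  countdown x A = while (nonzero? x) (dec x ⨾ A)

  module Semantics (ws : Vec Word r) where

    record Rep (v : Store) (o : Word) (ts : Tapes (suc top)) : Set where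
      constructor rep
      field
        outs : IsOutput o (Vec.lookup ts (tp 0))
        ins  : ∀ i → IsInput (Vec.lookup ws i) (v (suc (toℕ i))) (Vec.lookup ts (tp (suc (toℕ i))))
        ctrs : ∀ {j} → r < j → j ≤ top → IsCounter (v j) (Vec.lookup ts (tp j))

    open Rep

    -- A total correctness triple with a time bound. The store covers counters and input heads
    -- alike; the word is what has been printed so far.
    Triple : Prog → Store → Word → ℕ → Store → Word → Set
    Triple A v o b v′ o′ = ∀ {ts} → Rep v o ts →
      ∃[ us ] ∃[ t ] (t ≤ b × Rep v′ o′ us × A ∶ ts ⟶[ t ] us)

    input≤top : ∀ i → suc (toℕ {r} i) ≤ top
    input≤top i = ℕ.≤-trans (Fin.toℕ<n i) (ℕ.m≤m+n r w)

    input≢counter : ∀ {i : Fin r} {x} → r < x → suc (toℕ i) ≢ x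
    input≢counter {i} r<x refl = ℕ.<-irrefl refl (ℕ.≤-trans r<x (Fin.toℕ<n i))

    op-run : ∀ x f ts → op x f ∶ ts ⟶[ 1 ] Vec.updateAt ts (tp x) (run f)
    op-run x f ts = subst (op x f ∶ ts ⟶[ 1 ]_) (lemma (tp x) ts) (prim-run _ ts)
      where
      lemma : ∀ {n} (i : Fin n) (ts : Tapes n) →
              applyActs (Vec.updateAt (keepAll (Vec.map scanned ts)) i (λ _ → f (Vec.lookup (Vec.map scanned ts) i))) ts
              ≡ Vec.updateAt ts i (run f)
      lemma zero    (t ∷ ts)          = cong (_ ∷_) (applyActs-keepAll ts)
      lemma (suc i) (tape b s a ∷ ts) = cong (tape b s a ∷_) (lemma i ts)

    module _ (f : Sym → Sym × Move) (x : ℕ) (x≤ : x ≤ top) (ts : Tapes (suc top)) where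

      changed : Vec.lookup (Vec.updateAt ts (tp x) (run f)) (tp x) ≡ run f (Vec.lookup ts (tp x))
      changed = Vec.lookup∘updateAt (tp x) ts

      unchanged : ∀ {y} → y ≤ top → y ≢ x → Vec.lookup (Vec.updateAt ts (tp x) (run f)) (tp y) ≡ Vec.lookup ts (tp y)
      unchanged y≤ y≢x = Vec.lookup∘updateAt′ _ _ (λ e → y≢x (clamp-injective top y≤ x≤ e)) ts

    op-counter : ∀ {f k′ x v o} → r < x → x ≤ top → (∀ {t} → IsCounter (v x) t → IsCounter k′ (run f t)) →
                 Triple (op x f) v o 1 (v [ x ↦ k′ ]) o
    op-counter {f} {k′} {x} {v} {o} r<x x≤ h {ts} R = _ , 1 , ℕ.≤-refl , R′ , op-run x f ts
      where
      x≢0 : 0 ≢ x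
      x≢0 refl = contradiction r<x λ ()
      R′ : Rep (v [ x ↦ k′ ]) o (Vec.updateAt ts (tp x) (run f))
      outs R′ = subst (IsOutput o) (sym (unchanged f x x≤ ts z≤n x≢0)) (outs R)
      ins R′ i rewrite upd-other v x k′ (input≢counter {i} r<x) =
        subst (IsInput _ _) (sym (unchanged f x x≤ ts (input≤top i) (input≢counter r<x))) (ins R i)
      ctrs R′ {j} r<j j≤ with j ℕ.≟ x
      ... | yes refl rewrite upd-same v x k′ = subst (IsCounter k′) (sym (changed f x x≤ ts)) (h (ctrs R r<j j≤))
      ... | no ne rewrite upd-other v x k′ ne = subst (IsCounter (v j)) (sym (unchanged f x x≤ ts j≤ ne)) (ctrs R r<j j≤)

    op-input : ∀ {f k′} (i : Fin r) {v o} →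
               (∀ {t} → IsInput (Vec.lookup ws i) (v (suc (toℕ i))) t → IsInput (Vec.lookup ws i) k′ (run f t)) →
               Triple (op (suc (toℕ i)) f) v o 1 (v [ suc (toℕ i) ↦ k′ ]) o
    op-input {f} {k′} i {v} {o} h {ts} R = _ , 1 , ℕ.≤-refl , R′ , op-run x f ts
      where
      x = suc (toℕ i)
      R′ : Rep (v [ x ↦ k′ ]) o (Vec.updateAt ts (tp x) (run f))
      outs R′ = subst (IsOutput o) (sym (unchanged f x (input≤top i) ts z≤n λ ())) (outs R)
      ins R′ i′ with suc (toℕ i′) ℕ.≟ x
      ... | no ne rewrite upd-other v x k′ ne = subst (IsInput _ _) (sym (unchanged f x (input≤top i) ts (input≤top i′) ne)) (ins R i′)
      ... | yes e with Fin.toℕ-injective (ℕ.suc-injective e)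
      ...   | refl rewrite upd-same v x k′ = subst (IsInput _ k′) (sym (changed f x (input≤top i) ts)) (h (ins R i))
      ctrs R′ {j} r<j j≤ rewrite upd-other v x k′ (input≢counter {i} r<j ∘ sym) =
        subst (IsCounter _) (sym (unchanged f x (input≤top i) ts j≤ (input≢counter {i} r<j ∘ sym))) (ctrs R r<j j≤)

    inc-ctr : ∀ {x v o} → r < x → x ≤ top → Triple (inc x) v o 1 (v [ x ↦ suc (v x) ]) o
    inc-ctr r<x x≤ = op-counter r<x x≤ counter-inc

    dec-ctr : ∀ {x v o m} → r < x → x ≤ top → v x ≡ suc m → Triple (dec x) v o 1 (v [ x ↦ m ]) o
    dec-ctr r<x x≤ e = op-counter r<x x≤ (λ {t} c → counter-dec (subst (λ k → IsCounter k t) e c))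

    inc-inp : ∀ (i : Fin r) {v o} → Triple (inc (suc (toℕ i))) v o 1 (v [ suc (toℕ i) ↦ suc (v (suc (toℕ i))) ]) o
    inc-inp i = op-input i input-inc

    dec-inp : ∀ (i : Fin r) {v o m} → v (suc (toℕ i)) ≡ suc m →
              Triple (dec (suc (toℕ i))) v o 1 (v [ suc (toℕ i) ↦ m ]) o
    dec-inp i e = op-input i (λ {t} R → input-dec (subst (λ k → IsInput _ k t) e R))

    emitP-spec : ∀ {b v o} → Triple (emitP b) v o 1 v (o ++ b ∷ [])
    emitP-spec {b} {v} {o} {ts} R = _ , 1 , ℕ.≤-refl , R′ , op-run 0 _ ts
      where
      f = emitBit b
      R′ : Rep v (o ++ b ∷ []) (Vec.updateAt ts (tp 0) (run f))
      outs R′ = subst (IsOutput _) (sym (changed f 0 z≤n ts)) (output-emit b (outs R))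
      ins R′ i = subst (IsInput _ _) (sym (unchanged f 0 z≤n ts (input≤top i) λ ())) (ins R i)
      ctrs R′ r<j j≤ = subst (IsCounter _) (sym (unchanged f 0 z≤n ts j≤ λ { refl → contradiction r<j λ () })) (ctrs R r<j j≤)

    skip-spec : ∀ {v o} → Triple skip v o 1 v o
    skip-spec {ts = ts} R = ts , 1 , ℕ.≤-refl , R , subst (skip ∶ ts ⟶[ 1 ]_) (applyActs-keepAll ts) (prim-run keepAll ts)

    weaken : ∀ {A v o b b′ v′ o′} → b ≤ b′ → Triple A v o b v′ o′ → Triple A v o b′ v′ o′
    weaken b≤ T R with T R
    ... | us , t , t≤ , R′ , p = us , t , ℕ.≤-trans t≤ b≤ , R′ , p

    infixr 5 _⨾ₜ_

    _⨾ₜ_ : ∀ {A B v o b v′ o′ b′ v″ o″} → Triple A v o b v′ o′ → Triple B v′ o′ b′ v″ o″ →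
           Triple (A ⨾ B) v o (b + b′) v″ o″
    _⨾ₜ_ {A} {B} T U R with T R
    ... | us , t , t≤ , R′ , p with U R′
    ...   | us′ , t′ , t′≤ , R″ , q = us′ , t + t′ , ℕ.+-mono-≤ t≤ t′≤ , R″ , ⨾-run {A = A} {B} p q

    Tests : (Vec Sym (suc top) → Bool) → Store → Word → Bool → Set
    Tests test v o b = ∀ {ts} → Rep v o ts → test (Vec.map scanned ts) ≡ b

    cond-true : ∀ {test A B v o b v′ o′} → Tests test v o true → Triple A v o b v′ o′ →
                Triple (cond test A B) v o (suc b) v′ o′
    cond-true {test} {A} {B} c T R with T R
    ... | us , t , t≤ , R′ , p = us , suc t , s≤s t≤ , R′ , cond-run-true {test = test} {A} {B} (c R) p

    cond-false : ∀ {test A B v o b v′ o′} → Tests test v o false → Triple B v o b v′ o′ →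
                 Triple (cond test A B) v o (suc b) v′ o′
    cond-false {test} {A} {B} c T R with T R
    ... | us , t , t≤ , R′ , p = us , suc t , s≤s t≤ , R′ , cond-run-false {test = test} {A} {B} (c R) p

    while-false : ∀ {test A v o} → Tests test v o false → Triple (while test A) v o 1 v o
    while-false {test} {A} c R = _ , 1 , ℕ.≤-refl , R , while-run-false {test = test} {A} (c R)

    while-true : ∀ {test A v o b v′ o′ b′ v″ o″} → Tests test v o true → Triple A v o b v′ o′ →
                 Triple (while test A) v′ o′ b′ v″ o″ → Triple (while test A) v o (suc (b + b′)) v″ o″
    while-true {test} {A} c T U R with T R
    ... | us , t , t≤ , R′ , p with U R′
    ...   | us′ , t′ , t′≤ , R″ , q =
      us′ , suc (t + t′) , s≤s (ℕ.+-mono-≤ t≤ t′≤) , R″ , while-run-true {test = test} {A} (c R) p q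

    tests-lookup : ∀ {x} (g : Sym → Bool) (ts : Tapes (suc top)) →
                   g (Vec.lookup (Vec.map scanned ts) (tp x)) ≡ g (scanned (Vec.lookup ts (tp x)))
    tests-lookup {x} g ts = cong g (Vec.lookup-map (tp x) scanned ts)

    nonzero?-zero : ∀ {x v o} → r < x → x ≤ top → v x ≡ 0 → Tests (nonzero? x) v o false
    nonzero?-zero {x} r<x x≤ e {ts} R =
      trans (tests-lookup {x} (not ∘ isMark) ts) (cong not (counter-zero (subst (λ k → IsCounter k _) e (ctrs R r<x x≤))))

    nonzero?-suc : ∀ {x v o m} → r < x → x ≤ top → v x ≡ suc m → Tests (nonzero? x) v o true
    nonzero?-suc {x} r<x x≤ e {ts} R =
      trans (tests-lookup {x} (not ∘ isMark) ts) (cong not (counter-suc (subst (λ k → IsCounter k _) e (ctrs R r<x x≤))))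

    one?-spec : ∀ (i : Fin r) {v o} → Tests (one? (suc (toℕ i))) v o (bitAt (Vec.lookup ws i) (v (suc (toℕ i))))
    one?-spec i {v} {ts = ts} R with input-scanned (ins R i)
    ... | bl , ab , e = trans (tests-lookup {suc (toℕ i)} isOne ts) (trans (cong isOne e) (isOne-nth (Vec.lookup ws i) _ ab))

    nonblank?-< : ∀ (i : Fin r) {v o m} → v (suc (toℕ i)) + suc m ≡ length (Vec.lookup ws i) →
                  Tests (nonblank? (suc (toℕ i))) v o true
    nonblank?-< i {m = m} lt {ts} R with input-scanned (ins R i)
    ... | bl , ab , e = trans (tests-lookup {suc (toℕ i)} isBit ts) (trans (cong isBit e) (isBit-nth-< (Vec.lookup ws i) _ m lt))

    nonblank?-end : ∀ (i : Fin r) {v o} → v (suc (toℕ i)) ≡ length (Vec.lookup ws i) →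
                    Tests (nonblank? (suc (toℕ i))) v o false
    nonblank?-end i {v} end {ts} R with input-scanned (ins R i)
    ... | bl , ab , e = trans (tests-lookup {suc (toℕ i)} isBit ts)
      (trans (cong isBit (trans e (cong (nth □ (List.map bit (Vec.lookup ws i) ++ bl)) end))) (isBit-nth-end (Vec.lookup ws i) ab))

    -- The final store is left existential and described by a property: stores are functions, and
    -- compiled code is understood only through their values at single registers.
    Reaches : Prog → Store → Word → ℕ → (Store → Word → Set) → Set
    Reaches A v o b Q = ∃[ v′ ] ∃[ o′ ] (Triple A v o b v′ o′ × Q v′ o′)

    -- `P m` is the invariant when `m` rounds remain. A round costs one step for the test, one for
    -- the decrement and `b` for the body; the last step is the failing test.
    countdown-rule : ∀ {x A b} → r < x → x ≤ top → (P : ℕ → Store → Word → Set) →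
                     (∀ {m v o} → P m v o → v x ≡ m) →
                     (∀ {m v o} → P (suc m) v o → Reaches A (v [ x ↦ m ]) o b (P m)) →
                     ∀ m {v o} → P m v o → Reaches (countdown x A) v o (m * (2 + b) + 1) (P 0)
    countdown-rule r<x x≤ P val body zero Pv =
      _ , _ , while-false (nonzero?-zero r<x x≤ (val Pv)) , Pv
    countdown-rule {b = b} r<x x≤ P val body (suc m) Pv with body Pv
    ... | v₁ , o₁ , T₁ , P₁ with countdown-rule r<x x≤ P val body m P₁
    ...   | v₂ , o₂ , T₂ , P₂ = v₂ , o₂ ,
      weaken (ℕ.≤-reflexive (cong suc (cong suc (sym (ℕ.+-assoc b (m * (2 + b)) 1)))))
        (while-true (nonzero?-suc r<x x≤ (val Pv)) (dec-ctr r<x x≤ (val Pv) ⨾ₜ T₁) T₂) , P₂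

-- Bounded arithmetic

-- The only iteration is a sum whose range is computed beforehand, so all values are polynomial in
-- the variables. This is what makes evaluation on unary counters run in polynomial time.
data Expr (r n : ℕ) : Set where
  var       : Fin n → Expr r n
  num       : ℕ → Expr r n
  _∔_ _⊠_   : Expr r n → Expr r n → Expr r n
  leq       : Expr r n → Expr r n → Expr r n
  bitOf     : Fin r → Expr r n → Expr r n
  sumOf     : Expr r n → Expr r (suc n) → Expr r n

infixl 6 _∔_
infixl 7 _⊠_

sumTo : ℕ → (ℕ → ℕ) → ℕ
sumTo zero    g = 0
sumTo (suc n) g = sumTo n g + g n

isZero : ℕ → ℕ
isZero zero    = 1
isZero (suc _) = 0

boolVal : Bool → ℕ
boolVal b = if b then 1 else 0

⟦_⟧ : ∀ {r n} → Expr r n → Vec Word r → Vec ℕ n → ℕ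
⟦ var i ⟧     ws ρ = Vec.lookup ρ i
⟦ num c ⟧     ws ρ = c
⟦ a ∔ b ⟧     ws ρ = ⟦ a ⟧ ws ρ + ⟦ b ⟧ ws ρ
⟦ a ⊠ b ⟧     ws ρ = ⟦ a ⟧ ws ρ * ⟦ b ⟧ ws ρ
⟦ leq a b ⟧   ws ρ = isZero (⟦ a ⟧ ws ρ ∸ ⟦ b ⟧ ws ρ)
⟦ bitOf i a ⟧ ws ρ = boolVal (bitAt (Vec.lookup ws i) (⟦ a ⟧ ws ρ))
⟦ sumOf a b ⟧ ws ρ = sumTo (⟦ a ⟧ ws ρ) (λ i → ⟦ b ⟧ ws (i ∷ ρ))

infixl 8 _∘ₚ_

_∘ₚ_ : Poly → Poly → Poly
con c   ∘ₚ q = con c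
X       ∘ₚ q = q
(p ⊕ s) ∘ₚ q = p ∘ₚ q ⊕ s ∘ₚ q
(p ⊗ s) ∘ₚ q = (p ∘ₚ q) ⊗ (s ∘ₚ q)

eval-∘ₚ : ∀ p q n → eval (p ∘ₚ q) n ≡ eval p (eval q n)
eval-∘ₚ (con c) q n = refl
eval-∘ₚ X       q n = refl
eval-∘ₚ (p ⊕ s) q n = cong₂ _+_ (eval-∘ₚ p q n) (eval-∘ₚ s q n)
eval-∘ₚ (p ⊗ s) q n = cong₂ _*_ (eval-∘ₚ p q n) (eval-∘ₚ s q n)

eval-mono : ∀ p {m n} → m ≤ n → eval p m ≤ eval p n
eval-mono (con c) m≤n = ℕ.≤-refl
eval-mono X       m≤n = m≤n
eval-mono (p ⊕ q) m≤n = ℕ.+-mono-≤ (eval-mono p m≤n) (eval-mono q m≤n)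
eval-mono (p ⊗ q) m≤n = ℕ.*-mono-≤ (eval-mono p m≤n) (eval-mono q m≤n)

-- Under the binder of `sumOf` the new variable is bounded by the range and the old ones by `M`;
-- their common bound is the sum of the two, hence the substitution of `X ⊕ sizeP a`.
sizeP : ∀ {r n} → Expr r n → Poly
sizeP (var i)     = X
sizeP (num c)     = con c
sizeP (a ∔ b)     = sizeP a ⊕ sizeP b
sizeP (a ⊠ b)     = sizeP a ⊗ sizeP b
sizeP (leq a b)   = con 1
sizeP (bitOf i a) = con 1
sizeP (sumOf a b) = sizeP a ⊗ sizeP b ∘ₚ (X ⊕ sizeP a)

BoundedBy : ∀ {n} → ℕ → Vec ℕ n → Set
BoundedBy M ρ = ∀ i → Vec.lookup ρ i ≤ M

boundedBy-∷ : ∀ {n M N k} {ρ : Vec ℕ n} → BoundedBy M ρ → k ≤ N → BoundedBy (M + N) (k ∷ ρ)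
boundedBy-∷ {M = M} {N} h k≤ zero    = ℕ.≤-trans k≤ (ℕ.m≤n+m N M)
boundedBy-∷ {M = M} {N} h k≤ (suc i) = ℕ.≤-trans (h i) (ℕ.m≤m+n M N)

sumTo-≤ : ∀ n {g b} → (∀ {i} → i < n → g i ≤ b) → sumTo n g ≤ n * b
sumTo-≤ zero    h = z≤n
sumTo-≤ (suc n) {b = b} h =
  ℕ.≤-trans (ℕ.+-mono-≤ (sumTo-≤ n (h ∘ ℕ.m<n⇒m<1+n)) (h ℕ.≤-refl)) (ℕ.≤-reflexive (ℕ.+-comm (n * b) b))

isZero-≤ : ∀ n → isZero n ≤ 1
isZero-≤ zero    = ℕ.≤-refl
isZero-≤ (suc _) = z≤n

boolVal-≤ : ∀ b → boolVal b ≤ 1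
boolVal-≤ true  = ℕ.≤-refl
boolVal-≤ false = z≤n

size-bound : ∀ {r n} (e : Expr r n) {ws ρ M} → BoundedBy M ρ → ⟦ e ⟧ ws ρ ≤ eval (sizeP e) M
size-bound (var i)     h = h i
size-bound (num c)     h = ℕ.≤-refl
size-bound (a ∔ b)     h = ℕ.+-mono-≤ (size-bound a h) (size-bound b h)
size-bound (a ⊠ b)     h = ℕ.*-mono-≤ (size-bound a h) (size-bound b h)
size-bound (leq a b)   h = isZero-≤ _
size-bound (bitOf i a) h = boolVal-≤ _
size-bound (sumOf a b) {ws} {ρ} {M} h = ℕ.≤-trans
  (sumTo-≤ (⟦ a ⟧ ws ρ) (λ i< → ℕ.≤-trans (size-bound b (boundedBy-∷ h (ℕ.≤-trans (ℕ.<⇒≤ i<) (size-bound a h))))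
                                            (ℕ.≤-reflexive (sym (eval-∘ₚ (sizeP b) (X ⊕ sizeP a) M)))))
  (ℕ.*-monoˡ-≤ (eval (sizeP b ∘ₚ (X ⊕ sizeP a)) M) (size-bound a h))

countdownP : Poly → ℕ → Poly
countdownP p c = p ⊗ con c ⊕ con 1

-- The factors come from `countdown-rule`: a round costs two steps more than its body, so bodies of
-- two steps give 4 and bodies of one step give 3.
timeP : ∀ {r n} → Expr r n → Poly
timeP (var i)     = countdownP X 4 ⊕ countdownP X 3
timeP (num c)     = con (suc c)
timeP (a ∔ b)     = timeP a ⊕ timeP b
timeP (a ⊠ b)     = timeP a ⊕ (sizeP a ⊗ (con 2 ⊕ timeP b) ⊕ con 1)
timeP (leq a b)   = timeP a ⊕ (timeP b ⊕ (countdownP (sizeP b) 4 ⊕ (con 2 ⊕ countdownP (sizeP a) 3)))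
timeP (bitOf i a) = timeP a ⊕ (countdownP (sizeP a) 4 ⊕ (con 2 ⊕ countdownP (sizeP a) 3))
timeP (sumOf a b) = timeP a ⊕ ((sizeP a ⊗ (con 2 ⊕ (timeP b ∘ₚ (X ⊕ sizeP a) ⊕ con 1)) ⊕ con 1) ⊕ countdownP (sizeP a) 3)

Off : List ℕ → Store → Store → Set
Off xs v v′ = ∀ {y} → All (y ≢_) xs → v′ y ≡ v y

-- A register restored to its old value can be struck from the list of those possibly changed. In
-- this way temporaries vanish from the specifications.
off-close : ∀ {x xs v v′} → Off (x ∷ xs) v v′ → v′ x ≡ v x → Off xs v v′
off-close {x} o e {y} ne with y ℕ.≟ x
... | yes refl = e
... | no y≢x   = o (y≢x ∷ ne)

-- An upper bound for the counters used to evaluate an expression when those from f on are free.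
registers : ∀ {r n} → Expr r n → ℕ → ℕ
registers (var i)     f = 2 + f
registers (num c)     f = f
registers (a ∔ b)     f = registers a f ⊔ registers b f
registers (a ⊠ b)     f = registers a (2 + f) ⊔ registers b (2 + f)
registers (leq a b)   f = registers a (2 + f) ⊔ registers b (2 + f)
registers (bitOf i a) f = registers a (2 + f)
registers (sumOf a b) f = registers a (2 + f) ⊔ registers b (2 + f)

registers-≥ : ∀ {r n} (e : Expr r n) f → f ≤ registers e f
registers-≥ (var i)     f = ℕ.m≤n+m f 2
registers-≥ (num c)     f = ℕ.≤-refl
registers-≥ (a ∔ b)     f = ℕ.≤-trans (registers-≥ a f) (ℕ.m≤m⊔n _ _)
registers-≥ (a ⊠ b)     f = ℕ.≤-trans (ℕ.m≤n+m f 2) (ℕ.≤-trans (registers-≥ a (2 + f)) (ℕ.m≤m⊔n _ _))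
registers-≥ (leq a b)   f = ℕ.≤-trans (ℕ.m≤n+m f 2) (ℕ.≤-trans (registers-≥ a (2 + f)) (ℕ.m≤m⊔n _ _))
registers-≥ (bitOf i a) f = ℕ.≤-trans (ℕ.m≤n+m f 2) (registers-≥ a (2 + f))
registers-≥ (sumOf a b) f = ℕ.≤-trans (ℕ.m≤n+m f 2) (ℕ.≤-trans (registers-≥ a (2 + f)) (ℕ.m≤m⊔n _ _))

module Compiler (r w : ℕ) where
  open Programs r w

  add : ℕ → ℕ → Prog
  add zero    x = skip
  add (suc c) x = inc x ⨾ add c x

  clear : ℕ → Prog
  clear x = countdown x skip

  -- The value is added to register `x` instead of being assigned. So a sum runs both parts on the
  -- same target, and a product or `sumOf` runs its second part repeatedly on it. Registers from `f`
  -- on are zero before and after.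
  comp : ∀ {n} → Expr r n → Vec ℕ n → ℕ → ℕ → Prog
  -- Counting down destroys the variable; a copy is built in `f` and moved back afterwards.
  comp (var i) ns x f =
    countdown (Vec.lookup ns i) (inc x ⨾ inc f) ⨾ countdown f (inc (Vec.lookup ns i))
  comp (num c) ns x f = add c x
  comp (a ∔ b) ns x f = comp a ns x f ⨾ comp b ns x f
  comp (a ⊠ b) ns x f = comp a ns f (2 + f) ⨾ countdown f (comp b ns x (2 + f))
  -- For every unit of `1 + f` the counter `f` loses one unit if it has any. What is left is the
  -- truncated difference, which is zero exactly if the inequality holds.
  comp (leq a b) ns x f =
    comp a ns f (2 + f) ⨾ comp b ns (1 + f) (2 + f) ⨾
    countdown (1 + f) (cond (nonzero? f) (dec f) skip) ⨾ cond (nonzero? f) skip (inc x) ⨾ clear f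
  -- The head walks to the position while `1 + f` records the distance, and after the test it walks
  -- back by that distance.
  comp (bitOf i a) ns x f =
    comp a ns f (2 + f) ⨾ countdown f (inc (1 + f) ⨾ inc (suc (toℕ i))) ⨾
    cond (one? (suc (toℕ i))) (inc x) skip ⨾ countdown (1 + f) (dec (suc (toℕ i)))
  comp (sumOf a b) ns x f =
    comp a ns f (2 + f) ⨾ countdown f (comp b ((1 + f) ∷ ns) x (2 + f) ⨾ inc (1 + f)) ⨾ clear (1 + f)

  record Fresh {n} (ns : Vec ℕ n) (x f : ℕ) : Set where
    constructor fresh
    field
      r<x  : r < x
      x<f  : x < f
      r<ns : ∀ i → r < Vec.lookup ns i
      ns<f : ∀ i → Vec.lookup ns i < f
      ns≢x : ∀ i → Vec.lookup ns i ≢ x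

  open Fresh

  module _ {n} {ns : Vec ℕ n} {x f} (F : Fresh ns x f) where

    r<f : r < f
    r<f = ℕ.<-trans (r<x F) (x<f F)

    fresh-target : Fresh ns x (2 + f)
    fresh-target = fresh (r<x F) (ℕ.m<n⇒m<1+n (ℕ.m<n⇒m<1+n (x<f F))) (r<ns F)
                         (λ i → ℕ.m<n⇒m<1+n (ℕ.m<n⇒m<1+n (ns<f F i))) (ns≢x F)

    fresh-f : Fresh ns f (2 + f)
    fresh-f = fresh r<f (ℕ.m<n⇒m<1+n ℕ.≤-refl) (r<ns F) (ns<f fresh-target) (λ i → ℕ.<⇒≢ (ns<f F i))

    fresh-1+f : Fresh ns (1 + f) (2 + f)
    fresh-1+f = fresh (ℕ.m<n⇒m<1+n r<f) ℕ.≤-refl (r<ns F) (ns<f fresh-target) (λ i → ℕ.<⇒≢ (ℕ.m<n⇒m<1+n (ns<f F i)))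

    fresh-body : Fresh ((1 + f) ∷ ns) x (2 + f)
    r<x  fresh-body = r<x F
    x<f  fresh-body = x<f fresh-target
    r<ns fresh-body zero    = r<x fresh-1+f
    r<ns fresh-body (suc i) = r<ns F i
    ns<f fresh-body zero    = ℕ.≤-refl
    ns<f fresh-body (suc i) = ns<f fresh-target i
    ns≢x fresh-body zero    = ℕ.<⇒≢ (ℕ.m<n⇒m<1+n (x<f F)) ∘ sym
    ns≢x fresh-body (suc i) = ns≢x F i

    x≢f : x ≢ f
    x≢f = ℕ.<⇒≢ (x<f F)

    x≢1+f : x ≢ 1 + f
    x≢1+f = ℕ.<⇒≢ (ℕ.m<n⇒m<1+n (x<f F))

  f≢1+f : ∀ {f} → f ≢ 1 + f
  f≢1+f = ℕ.<⇒≢ ℕ.≤-refl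

  record Ready {n} (ns : Vec ℕ n) (ρ : Vec ℕ n) (f : ℕ) (v : Store) : Set where
    constructor ready
    field
      zeros  : ∀ {y} → f ≤ y → v y ≡ 0
      env    : ∀ i → v (Vec.lookup ns i) ≡ Vec.lookup ρ i
      inputs : ∀ (i : Fin r) → v (suc (toℕ i)) ≡ 0

  open Ready

  module _ {n} {ns ρ : Vec ℕ n} where

    ready-mono : ∀ {f v} → Ready ns ρ f v → Ready ns ρ (2 + f) v
    ready-mono {f} (ready z e i) = ready (λ p → z (ℕ.≤-trans (ℕ.m≤n+m f 2) p)) e i

    ready-off : ∀ {f v v′ xs} → All (λ x → Fresh ns x f) xs → Off xs v v′ → Ready ns ρ f v → Ready ns ρ f v′
    ready-off {f} Fs o (ready z e i) = ready
      (λ f≤y → trans (o (All.map (λ { F refl → ℕ.<-irrefl refl (ℕ.≤-trans (x<f F) f≤y) }) Fs)) (z f≤y))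
      (λ j → trans (o (All.map (λ F → ns≢x F j) Fs)) (e j))
      (λ j → trans (o (All.map (λ { F refl → ℕ.<-irrefl refl (ℕ.≤-trans (r<x F) (Fin.toℕ<n j)) }) Fs)) (i j))

  module Correctness (ws : Vec Word r) where
    open Semantics ws

    EvaluatesTo : ∀ {n} → Expr r n → Vec ℕ n → Vec ℕ n → ℕ → ℕ → Set
    EvaluatesTo e ns ρ x f = ∀ {v o M} → BoundedBy M ρ → Ready ns ρ f v →
      Reaches (comp e ns x f) v o (eval (timeP e) M) λ v′ o′ →
        o′ ≡ o × v′ x ≡ v x + ⟦ e ⟧ ws ρ × Off (x ∷ []) v v′

    add-spec : ∀ c {x v o} → r < x → x ≤ top →
               Reaches (add c x) v o (suc c) λ v′ o′ → o′ ≡ o × v′ x ≡ v x + c × Off (x ∷ []) v v′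
    add-spec zero {v = v} r<x x≤ = v , _ , skip-spec , refl , sym (ℕ.+-identityʳ _) , λ _ → refl
    add-spec (suc c) {x} {v} r<x x≤ with add-spec c {x} {v [ x ↦ suc (v x) ]} r<x x≤
    ... | v′ , o′ , T , refl , e , off = v′ , o′ , inc-ctr r<x x≤ ⨾ₜ T , refl ,
      trans e (trans (cong (_+ c) (upd-same v x _)) (sym (ℕ.+-suc (v x) c))) ,
      λ { (ne ∷ []) → trans (off (ne ∷ [])) (upd-other v x _ ne) }

    clear-spec : ∀ {x v o} → r < x → x ≤ top →
                 Reaches (clear x) v o (v x * 3 + 1) λ v′ o′ → o′ ≡ o × v′ x ≡ 0 × Off (x ∷ []) v v′
    clear-spec {x} {v} {o} r<x x≤ = countdown-rule r<x x≤ (λ m v′ o′ → o′ ≡ o × v′ x ≡ m × Off (x ∷ []) v v′)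
      (λ (_ , e , _) → e)
      (λ {m} {v₁} (e₀ , e , off) → v₁ [ x ↦ m ] , _ , skip-spec , e₀ , upd-same v₁ x m ,
         λ { (ne ∷ []) → trans (upd-other v₁ x m ne) (off (ne ∷ [])) })
      (v x) (refl , refl , λ _ → refl)

    move-bound : ∀ {a} p M c → a ≤ eval p M → a * c + 1 ≤ eval (countdownP p c) M
    move-bound p M c a≤ = ℕ.+-monoˡ-≤ 1 (ℕ.*-monoˡ-≤ c a≤)

    swap-suc : ∀ a {m k} → a + suc m ≡ k → suc a + m ≡ k
    swap-suc a {m} e = trans (sym (ℕ.+-suc a m)) e

    var-spec : ∀ {n} (i : Fin n) {ns ρ x f} → Fresh ns x f → registers {r} (var i) f ≤ suc top →
               EvaluatesTo (var i) ns ρ x f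
    var-spec i {ns} {ρ} {x} {f} F h {v} {o} {M} bd R =
      v₂ , o₂ , weaken (ℕ.+-mono-≤ (move-bound X M 4 K≤) (move-bound X M 3 K≤)) (T₁ ⨾ₜ T₂) , trans o₂≡ o₁≡ ,
      trans (off₂ ((x≢f F) ∷ (ns≢x F i ∘ sym) ∷ []))
        (trans (sym (ℕ.+-identityʳ _)) (trans x₁ (cong (v x +_) (env R i)))) ,
      off-close (off-close {y} {f ∷ x ∷ []}
          (λ { (p ∷ q ∷ s ∷ []) → trans (off₂ (q ∷ p ∷ [])) (off₁ (p ∷ s ∷ q ∷ [])) })
          (trans (sym (ℕ.+-identityʳ _)) y₂))
        (trans f₂ (sym (zeros R ℕ.≤-refl)))
      where
      y = Vec.lookup ns i
      K = v y
      K≤ : K ≤ eval X M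
      K≤ = ℕ.≤-trans (ℕ.≤-reflexive (env R i)) (bd i)
      f≤ : f ≤ top
      f≤ = ℕ.≤-trans (ℕ.n≤1+n f) (s≤s⁻¹ h)
      x≤ : x ≤ top
      x≤ = ℕ.≤-trans (ℕ.<⇒≤ (x<f F)) f≤
      y≤ : y ≤ top
      y≤ = ℕ.≤-trans (ℕ.<⇒≤ (ns<f F i)) f≤
      y≢x = ns≢x F i
      y≢f : y ≢ f
      y≢f = ℕ.<⇒≢ (ns<f F i)
      P : ℕ → Store → Word → Set
      -- What has left `y` has arrived both in `x` and in `f`, so their sums with the remaining `m`
      -- are constant.
      P m v′ o′ = o′ ≡ o × v′ y ≡ m × v′ x + m ≡ v x + K × v′ f + m ≡ K × Off (y ∷ x ∷ f ∷ []) v v′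
      body : ∀ {m v′ o′} → P (suc m) v′ o′ → Reaches (inc x ⨾ inc f) (v′ [ y ↦ m ]) o′ 2 (P m)
      body {m} {v′} (eo , ey , ex , ef , off) =
        _ , _ , inc-ctr (r<x F) x≤ ⨾ₜ inc-ctr (r<f F) f≤ , eo ,
        trans (upd-other u₁ f _ y≢f) (trans (upd-other u x _ y≢x) (upd-same v′ y m)) ,
        trans (cong (_+ m) (trans (upd-other u₁ f _ (x≢f F)) (trans (upd-same u x _) (cong suc (upd-other v′ y m (y≢x ∘ sym))))))
              (swap-suc (v′ x) ex) ,
        trans (cong (_+ m) (trans (upd-same u₁ f _) (cong suc (trans (upd-other u x _ (x≢f F ∘ sym)) (upd-other v′ y m (y≢f ∘ sym))))))
              (swap-suc (v′ f) ef) ,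
        λ { (p ∷ q ∷ s ∷ []) → trans (upd-other u₁ f _ s) (trans (upd-other u x _ q) (trans (upd-other v′ y m p) (off (p ∷ q ∷ s ∷ [])))) }
        where
        u = v′ [ y ↦ m ]
        u₁ = u [ x ↦ suc (u x) ]
      first = countdown-rule (r<ns F i) y≤ P (λ p → proj₁ (proj₂ p)) body K {v} {o}
                (refl , refl , refl , cong (_+ K) (zeros R ℕ.≤-refl) , λ _ → refl)
      v₁ = proj₁ first
      o₁ = proj₁ (proj₂ first)
      T₁ = proj₁ (proj₂ (proj₂ first))
      P₁ = proj₂ (proj₂ (proj₂ first))
      o₁≡ = proj₁ P₁
      y₁ = proj₁ (proj₂ P₁)
      x₁ = proj₁ (proj₂ (proj₂ P₁))
      f₁ = proj₁ (proj₂ (proj₂ (proj₂ P₁)))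
      off₁ = proj₂ (proj₂ (proj₂ (proj₂ P₁)))
      Q : ℕ → Store → Word → Set
      Q m v′ o′ = o′ ≡ o₁ × v′ f ≡ m × v′ y + m ≡ K × Off (f ∷ y ∷ []) v₁ v′
      body′ : ∀ {m v′ o′} → Q (suc m) v′ o′ → Reaches (inc y) (v′ [ f ↦ m ]) o′ 1 (Q m)
      body′ {m} {v′} (eo , ef , ey , off) =
        _ , _ , inc-ctr (r<ns F i) y≤ , eo ,
        trans (upd-other u y _ (y≢f ∘ sym)) (upd-same v′ f m) ,
        trans (cong (_+ m) (trans (upd-same u y _) (cong suc (upd-other v′ f m y≢f)))) (swap-suc (v′ y) ey) ,
        λ { (p ∷ q ∷ []) → trans (upd-other u y _ q) (trans (upd-other v′ f m p) (off (p ∷ q ∷ []))) }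
        where u = v′ [ f ↦ m ]
      second = countdown-rule (r<f F) f≤ Q (λ p → proj₁ (proj₂ p)) body′ K {v₁} {o₁}
                 (refl , trans (sym (ℕ.+-identityʳ _)) f₁ , cong (_+ K) y₁ , λ _ → refl)
      v₂ = proj₁ second
      o₂ = proj₁ (proj₂ second)
      T₂ = proj₁ (proj₂ (proj₂ second))
      P₂ = proj₂ (proj₂ (proj₂ second))
      o₂≡ = proj₁ P₂
      f₂ = proj₁ (proj₂ P₂)
      y₂ = proj₁ (proj₂ (proj₂ P₂))
      off₂ = proj₂ (proj₂ (proj₂ P₂))

    ready-body : ∀ {n} {ns ρ : Vec ℕ n} {f j v} → Ready ns ρ (2 + f) v → v (1 + f) ≡ j → Ready ((1 + f) ∷ ns) (j ∷ ρ) (2 + f) v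
    ready-body R e = ready (zeros R) (λ { zero → e ; (suc i) → env R i }) (inputs R)

    +0 : ∀ {a b} → a + 0 ≡ b → a ≡ b
    +0 e = trans (sym (ℕ.+-identityʳ _)) e

    comp-spec : ∀ {n} (e : Expr r n) {ns ρ x f} → Fresh ns x f → registers e f ≤ suc top → EvaluatesTo e ns ρ x f
    product-spec : ∀ {n} (a b : Expr r n) {ns ρ x f} → Fresh ns x f → registers (a ⊠ b) f ≤ suc top →
                   EvaluatesTo (a ⊠ b) ns ρ x f
    leq-spec : ∀ {n} (a b : Expr r n) {ns ρ x f} → Fresh ns x f → registers (leq a b) f ≤ suc top →
               EvaluatesTo (leq a b) ns ρ x f
    bitOf-spec : ∀ {n} i (a : Expr r n) {ns ρ x f} → Fresh ns x f → registers (bitOf i a) f ≤ suc top →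
                 EvaluatesTo (bitOf i a) ns ρ x f
    sumOf-spec : ∀ {n} (a : Expr r n) b {ns ρ x f} → Fresh ns x f → registers (sumOf a b) f ≤ suc top →
                 EvaluatesTo (sumOf a b) ns ρ x f

    comp-spec (var i)     F h = var-spec i F h
    comp-spec (num c)     F h bd R = add-spec c (r<x F) (s≤s⁻¹ (ℕ.≤-trans (x<f F) h))
    comp-spec (a ∔ b) {ns} {ρ} {x} F h {v} bd R with comp-spec a F (ℕ.m⊔n≤o⇒m≤o _ _ h) bd R
    ... | v₁ , _ , T₁ , refl , e₁ , off₁
      with comp-spec b F (ℕ.m⊔n≤o⇒n≤o (registers a _) _ h) bd (ready-off (F ∷ []) off₁ R)
    ... | v₂ , _ , T₂ , refl , e₂ , off₂ =
      v₂ , _ , T₁ ⨾ₜ T₂ , refl ,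
      trans e₂ (trans (cong (_+ ⟦ b ⟧ ws ρ) e₁) (ℕ.+-assoc (v x) (⟦ a ⟧ ws ρ) (⟦ b ⟧ ws ρ))) ,
      λ ne → trans (off₂ ne) (off₁ ne)
    comp-spec (a ⊠ b)     F h = product-spec a b F h
    comp-spec (leq a b)   F h = leq-spec a b F h
    comp-spec (bitOf i a) F h = bitOf-spec i a F h
    comp-spec (sumOf a b) F h = sumOf-spec a b F h

    product-spec a b {ns} {ρ} {x} {f} F h {v} {o} {M} bd R with comp-spec a (fresh-f F) (ℕ.m⊔n≤o⇒m≤o _ _ h) bd (ready-mono R)
    ... | v₁ , _ , T₁ , refl , e₁ , off₁ = finish
      where
      A = ⟦ a ⟧ ws ρ
      B = ⟦ b ⟧ ws ρ
      hb : registers b (2 + f) ≤ suc top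
      hb = ℕ.m⊔n≤o⇒n≤o (registers a _) _ h
      f≤ : f ≤ top
      f≤ = ℕ.≤-trans (ℕ.n≤1+n f) (s≤s⁻¹ (ℕ.≤-trans (registers-≥ b (2 + f)) hb))
      P : ℕ → Store → Word → Set
      P m v′ o′ = o′ ≡ o × v′ f ≡ m × v′ x + m * B ≡ v x + A * B × Off (f ∷ x ∷ []) v v′
      body : ∀ {m v′ o′} → P (suc m) v′ o′ → Reaches (comp b ns x (2 + f)) (v′ [ f ↦ m ]) o′ (eval (timeP b) M) (P m)
      body {m} {v′} (refl , ef , ex , off)
        with comp-spec b (fresh-target F) hb {v′ [ f ↦ m ]} bd
               (ready-off (fresh-f F ∷ fresh-target F ∷ [])
                 (λ { (p ∷ q ∷ []) → trans (upd-other v′ f m p) (off (p ∷ q ∷ [])) }) (ready-mono R))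
      ... | v₂ , _ , T₂ , refl , e₂ , off₂ =
        v₂ , _ , T₂ , refl ,
        trans (off₂ ((x≢f F ∘ sym) ∷ [])) (upd-same v′ f m) ,
        trans (cong (_+ m * B) (trans e₂ (cong (_+ B) (upd-other v′ f m (x≢f F)))))
          (trans (ℕ.+-assoc (v′ x) B (m * B)) ex) ,
        λ { (p ∷ q ∷ []) → trans (off₂ (q ∷ [])) (trans (upd-other v′ f m p) (off (p ∷ q ∷ []))) }
      finish : Reaches (comp (a ⊠ b) ns x f) v o (eval (timeP (a ⊠ b)) M) λ v′ o′ →
               o′ ≡ o × v′ x ≡ v x + A * B × Off (x ∷ []) v v′
      finish with countdown-rule (r<f F) f≤ P (λ p → proj₁ (proj₂ p)) body A {v₁}
                    (refl , trans e₁ (cong (_+ A) (zeros R ℕ.≤-refl)) , cong (_+ A * B) (off₁ (x≢f F ∷ [])) ,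
                     λ { (p ∷ q ∷ []) → off₁ (p ∷ []) })
      ... | v₂ , _ , T₂ , refl , ef , ex , off =
        v₂ , _ , T₁ ⨾ₜ weaken (ℕ.+-monoˡ-≤ 1 (ℕ.*-monoˡ-≤ (2 + eval (timeP b) M) (size-bound a bd))) T₂ , refl ,
        +0 ex , off-close off (trans ef (sym (zeros R ℕ.≤-refl)))

    leq-spec a b {ns} {ρ} {x} {f} F h {v} {o} {M} bd R with comp-spec a (fresh-f F) (ℕ.m⊔n≤o⇒m≤o _ _ h) bd (ready-mono R)
    ... | v₁ , _ , T₁ , refl , e₁ , off₁
      with comp-spec b (fresh-1+f F) (ℕ.m⊔n≤o⇒n≤o (registers a _) _ h) bd (ready-off (fresh-f F ∷ []) off₁ (ready-mono R))
    ... | v₂ , _ , T₂ , refl , e₂ , off₂ = finish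
      where
      A = ⟦ a ⟧ ws ρ
      B = ⟦ b ⟧ ws ρ
      1+f≤ : 1 + f ≤ top
      1+f≤ = s≤s⁻¹ (ℕ.≤-trans (registers-≥ b (2 + f)) (ℕ.m⊔n≤o⇒n≤o (registers a _) _ h))
      f≤ : f ≤ top
      f≤ = ℕ.≤-trans (ℕ.n≤1+n f) 1+f≤
      x≤ : x ≤ top
      x≤ = ℕ.≤-trans (ℕ.<⇒≤ (x<f F)) f≤
      r<1+f = r<x (fresh-1+f F)
      P : ℕ → Store → Word → Set
      -- The truncated difference of the two counters is invariant, also once `f` is empty: from
      -- then on it is zero.
      P m v′ o′ = o′ ≡ o × v′ (1 + f) ≡ m × v′ f ∸ m ≡ A ∸ B × Off (1 + f ∷ f ∷ []) v v′
      body : ∀ {m v′ o′} → P (suc m) v′ o′ → Reaches (cond (nonzero? f) (dec f) skip) (v′ [ 1 + f ↦ m ]) o′ 2 (P m)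
      body {m} {v′} (refl , eg , ef , off) with v′ f in eq
      ... | zero  = v′ [ 1 + f ↦ m ] , _ ,
        cond-false (nonzero?-zero (r<f F) f≤ (trans (upd-other v′ (1 + f) m f≢1+f) eq)) skip-spec , refl ,
        upd-same v′ (1 + f) m ,
        trans (cong (_∸ m) (trans (upd-other v′ (1 + f) m f≢1+f) eq)) (trans (ℕ.0∸n≡0 m) ef) ,
        λ { (p ∷ q ∷ []) → trans (upd-other v′ (1 + f) m p) (off (p ∷ q ∷ [])) }
      ... | suc k = v′ [ 1 + f ↦ m ] [ f ↦ k ] , _ ,
        cond-true (nonzero?-suc (r<f F) f≤ (trans (upd-other v′ (1 + f) m f≢1+f) eq))
          (dec-ctr (r<f F) f≤ (trans (upd-other v′ (1 + f) m f≢1+f) eq)) , refl ,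
        trans (upd-other (v′ [ 1 + f ↦ m ]) f k (f≢1+f ∘ sym)) (upd-same v′ (1 + f) m) ,
        trans (cong (_∸ m) (upd-same (v′ [ 1 + f ↦ m ]) f k)) ef ,
        λ { (p ∷ q ∷ []) → trans (upd-other (v′ [ 1 + f ↦ m ]) f k q) (trans (upd-other v′ (1 + f) m p) (off (p ∷ q ∷ []))) }
      answer : ∀ {v′ D} → v′ f ≡ D → Reaches (cond (nonzero? f) skip (inc x)) v′ o 2 λ v″ o′ →
               o′ ≡ o × v″ x ≡ v′ x + isZero D × Off (x ∷ []) v′ v″
      answer {v′} {zero}  e = _ , _ , cond-false (nonzero?-zero (r<f F) f≤ e) (inc-ctr (r<x F) x≤) , refl ,
        trans (upd-same v′ x _) (sym (ℕ.+-comm (v′ x) 1)) , λ { (p ∷ []) → upd-other v′ x _ p }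
      answer {v′} {suc D} e = _ , _ , cond-true (nonzero?-suc (r<f F) f≤ e) skip-spec , refl ,
        sym (ℕ.+-identityʳ _) , λ _ → refl
      finish : Reaches (comp (leq a b) ns x f) v o (eval (timeP (leq a b)) M) λ v′ o′ →
               o′ ≡ o × v′ x ≡ v x + isZero (A ∸ B) × Off (x ∷ []) v v′
      finish with countdown-rule r<1+f 1+f≤ P (λ p → proj₁ (proj₂ p)) body B {v₂}
                    (refl , trans e₂ (cong (_+ B) (trans (off₁ ((f≢1+f ∘ sym) ∷ [])) (zeros R (ℕ.n≤1+n f)))) ,
                     cong (_∸ B) (trans (off₂ (f≢1+f ∷ [])) (trans e₁ (cong (_+ A) (zeros R ℕ.≤-refl)))) ,
                     λ { (p ∷ q ∷ []) → trans (off₂ (p ∷ [])) (off₁ (q ∷ [])) })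
      ... | v₃ , _ , T₃ , refl , eg , ef , off₃ with answer {v₃} ef
      ... | v₄ , _ , T₄ , refl , e₄ , off₄ with clear-spec {f} {v₄} {o} (r<f F) f≤
      ... | v₅ , _ , T₅ , refl , e₅ , off₅ =
        v₅ , _ ,
        T₁ ⨾ₜ T₂ ⨾ₜ weaken (move-bound (sizeP b) M 4 (size-bound b bd)) T₃ ⨾ₜ T₄ ⨾ₜ
          weaken (move-bound (sizeP a) M 3 (ℕ.≤-trans (ℕ.≤-reflexive (trans (off₄ ((x≢f F ∘ sym) ∷ [])) ef))
                                           (ℕ.≤-trans (ℕ.m∸n≤m A B) (size-bound a bd)))) T₅ , refl ,
        trans (off₅ (x≢f F ∷ [])) (trans e₄ (cong (_+ _) (off₃ (x≢1+f F ∷ x≢f F ∷ [])))) ,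
        off-close (off-close {1 + f} {f ∷ x ∷ []}
            (λ { (p ∷ q ∷ s ∷ []) → trans (off₅ (q ∷ [])) (trans (off₄ (s ∷ [])) (off₃ (p ∷ q ∷ []))) })
            (trans (off₅ ((f≢1+f ∘ sym) ∷ [])) (trans (off₄ ((x≢1+f F ∘ sym) ∷ [])) (trans eg (sym (zeros R (ℕ.n≤1+n f)))))))
          (trans e₅ (sym (zeros R ℕ.≤-refl)))

    bitOf-spec i a {ns} {ρ} {x} {f} F h {v} {o} {M} bd R with comp-spec a (fresh-f F) h bd (ready-mono R)
    ... | v₁ , _ , T₁ , refl , e₁ , off₁ = finish
      where
      A = ⟦ a ⟧ ws ρ
      s = suc (toℕ i)
      g = 1 + f
      1+f≤ : 1 + f ≤ top
      1+f≤ = s≤s⁻¹ (ℕ.≤-trans (registers-≥ a (2 + f)) h)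
      f≤ : f ≤ top
      f≤ = ℕ.≤-trans (ℕ.n≤1+n f) 1+f≤
      x≤ : x ≤ top
      x≤ = ℕ.≤-trans (ℕ.<⇒≤ (x<f F)) f≤
      r<1+f = r<x (fresh-1+f F)
      s≢f : s ≢ f
      s≢f = input≢counter (r<f F)
      s≢g : s ≢ g
      s≢g = input≢counter r<1+f
      s≢x : s ≢ x
      s≢x = input≢counter (r<x F)
      g≢f : g ≢ f
      g≢f = f≢1+f ∘ sym
      P : ℕ → Store → Word → Set
      P m v′ o′ = o′ ≡ o × v′ f ≡ m × v′ g + m ≡ A × v′ s + m ≡ A × Off (f ∷ g ∷ s ∷ []) v v′
      body : ∀ {m v′ o′} → P (suc m) v′ o′ → Reaches (inc g ⨾ inc s) (v′ [ f ↦ m ]) o′ 2 (P m)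
      body {m} {v′} (refl , ef , eg , es , off) = _ , _ , inc-ctr r<1+f 1+f≤ ⨾ₜ inc-inp i , refl ,
        trans (upd-other u₁ s _ (s≢f ∘ sym)) (trans (upd-other u g _ (g≢f ∘ sym)) (upd-same v′ f m)) ,
        trans (cong (_+ m) (trans (upd-other u₁ s _ (s≢g ∘ sym)) (trans (upd-same u g _) (cong suc (upd-other v′ f m g≢f)))))
              (swap-suc (v′ g) eg) ,
        trans (cong (_+ m) (trans (upd-same u₁ s _) (cong suc (trans (upd-other u g _ s≢g) (upd-other v′ f m s≢f)))))
              (swap-suc (v′ s) es) ,
        λ { (p ∷ q ∷ t ∷ []) → trans (upd-other u₁ s _ t) (trans (upd-other u g _ q) (trans (upd-other v′ f m p) (off (p ∷ q ∷ t ∷ [])))) }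
        where
        u = v′ [ f ↦ m ]
        u₁ = u [ g ↦ suc (u g) ]
      answer : ∀ {v′ b} → bitAt (Vec.lookup ws i) (v′ s) ≡ b → Reaches (cond (one? s) (inc x) skip) v′ o 2 λ v″ o′ →
               o′ ≡ o × v″ x ≡ v′ x + boolVal b × Off (x ∷ []) v′ v″
      answer {v′} {true}  e = _ , _ , cond-true (λ Re → trans (one?-spec i Re) e) (inc-ctr (r<x F) x≤) , refl ,
        trans (upd-same v′ x _) (sym (ℕ.+-comm (v′ x) 1)) , λ { (p ∷ []) → upd-other v′ x _ p }
      answer {v′} {false} e = _ , _ , cond-false (λ Re → trans (one?-spec i Re) e) skip-spec , refl ,
        sym (ℕ.+-identityʳ _) , λ _ → refl
      Q : Store → ℕ → Store → Word → Set
      Q v₃ m v′ o′ = o′ ≡ o × v′ g ≡ m × v′ s ≡ m × Off (g ∷ s ∷ []) v₃ v′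
      body′ : ∀ {v₃ m v′ o′} → Q v₃ (suc m) v′ o′ → Reaches (dec s) (v′ [ g ↦ m ]) o′ 1 (Q v₃ m)
      body′ {m = m} {v′} (refl , eg , es , off) = _ , _ , dec-inp i (trans (upd-other v′ g m s≢g) es) , refl ,
        trans (upd-other u s m (s≢g ∘ sym)) (upd-same v′ g m) , upd-same u s m ,
        λ { (p ∷ q ∷ []) → trans (upd-other u s m q) (trans (upd-other v′ g m p) (off (p ∷ q ∷ []))) }
        where u = v′ [ g ↦ m ]
      finish : Reaches (comp (bitOf i a) ns x f) v o (eval (timeP (bitOf i a)) M) λ v′ o′ →
               o′ ≡ o × v′ x ≡ v x + boolVal (bitAt (Vec.lookup ws i) A) × Off (x ∷ []) v v′
      finish with countdown-rule (r<f F) f≤ P (λ p → proj₁ (proj₂ p)) body A {v₁}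
                    (refl , trans e₁ (cong (_+ A) (zeros R ℕ.≤-refl)) ,
                     cong (_+ A) (trans (off₁ (g≢f ∷ [])) (zeros R (ℕ.n≤1+n f))) ,
                     cong (_+ A) (trans (off₁ (s≢f ∷ [])) (inputs R i)) ,
                     λ { (p ∷ q ∷ t ∷ []) → off₁ (p ∷ []) })
      ... | v₂ , _ , T₂ , refl , ef , eg , es , off₂ with answer {v₂} refl
      ... | v₃ , _ , T₃ , refl , e₃ , off₃ with countdown-rule r<1+f 1+f≤ (Q v₃) (λ p → proj₁ (proj₂ p)) body′ A {v₃}
                    (refl , trans (off₃ ((x≢1+f F ∘ sym) ∷ [])) (+0 eg) , trans (off₃ (s≢x ∷ [])) (+0 es) , λ _ → refl)
      ... | v₄ , _ , T₄ , refl , eg′ , es′ , off₄ =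
        v₄ , _ ,
        T₁ ⨾ₜ weaken (move-bound (sizeP a) M 4 (size-bound a bd)) T₂ ⨾ₜ T₃ ⨾ₜ
          weaken (move-bound (sizeP a) M 3 (size-bound a bd)) T₄ , refl ,
        trans (off₄ (x≢1+f F ∷ (s≢x ∘ sym) ∷ []))
          (trans e₃ (cong₂ _+_ (off₂ (x≢f F ∷ x≢1+f F ∷ (s≢x ∘ sym) ∷ []))
                               (cong (boolVal ∘ bitAt (Vec.lookup ws i)) (+0 es)))) ,
        off-close (off-close (off-close {g} {s ∷ f ∷ x ∷ []}
              (λ { (p ∷ q ∷ t ∷ y ∷ []) → trans (off₄ (p ∷ q ∷ [])) (trans (off₃ (y ∷ [])) (off₂ (t ∷ p ∷ q ∷ []))) })
              (trans eg′ (sym (zeros R (ℕ.n≤1+n f)))))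
            (trans es′ (sym (inputs R i))))
          (trans (off₄ ((g≢f ∘ sym) ∷ (s≢f ∘ sym) ∷ [])) (trans (off₃ ((x≢f F ∘ sym) ∷ [])) (trans ef (sym (zeros R ℕ.≤-refl)))))

    sumOf-spec a b {ns} {ρ} {x} {f} F h {v} {o} {M} bd R with comp-spec a (fresh-f F) (ℕ.m⊔n≤o⇒m≤o _ _ h) bd (ready-mono R)
    ... | v₁ , _ , T₁ , refl , e₁ , off₁ = finish
      where
      A = ⟦ a ⟧ ws ρ
      B : ℕ → ℕ
      B j = ⟦ b ⟧ ws (j ∷ ρ)
      g = 1 + f
      hb : registers b (2 + f) ≤ suc top
      hb = ℕ.m⊔n≤o⇒n≤o (registers a _) _ h
      1+f≤ : 1 + f ≤ top
      1+f≤ = s≤s⁻¹ (ℕ.≤-trans (registers-≥ b (2 + f)) hb)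
      f≤ : f ≤ top
      f≤ = ℕ.≤-trans (ℕ.n≤1+n f) 1+f≤
      r<1+f = r<x (fresh-1+f F)
      g≢f : g ≢ f
      g≢f = f≢1+f ∘ sym
      tb = eval (timeP b ∘ₚ (X ⊕ sizeP a)) M
      P : ℕ → Store → Word → Set
      -- `f` counts the rounds left and `g` holds the bound variable, so `x` has received exactly
      -- the terms with index below `g`.
      P m v′ o′ = o′ ≡ o × v′ f ≡ m × v′ g + m ≡ A × v′ x ≡ v x + sumTo (v′ g) B × Off (f ∷ g ∷ x ∷ []) v v′
      body : ∀ {m v′ o′} → P (suc m) v′ o′ →
             Reaches (comp b (g ∷ ns) x (2 + f) ⨾ inc g) (v′ [ f ↦ m ]) o′ (tb + 1) (P m)
      body {m} {v′} (refl , ef , eg , ex , off)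
        with comp-spec b {ρ = v′ g ∷ ρ} (fresh-body F) hb {v′ [ f ↦ m ]} {_} {M + eval (sizeP a) M}
               (boundedBy-∷ bd (ℕ.≤-trans (ℕ.m+n≤o⇒m≤o (v′ g) (ℕ.≤-reflexive eg)) (size-bound a bd)))
               (ready-body (ready-off (fresh-f F ∷ fresh-1+f F ∷ fresh-target F ∷ [])
                 (λ { (p ∷ q ∷ t ∷ []) → trans (upd-other v′ f m p) (off (p ∷ q ∷ t ∷ [])) }) (ready-mono R))
                 (upd-other v′ f m g≢f))
      ... | v₂ , _ , T₂ , refl , e₂ , off₂ =
        v₂ [ g ↦ suc (v₂ g) ] , _ ,
        weaken (ℕ.≤-reflexive (sym (eval-∘ₚ (timeP b) (X ⊕ sizeP a) M))) T₂ ⨾ₜ inc-ctr r<1+f 1+f≤ , refl ,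
        trans (upd-other v₂ g _ f≢1+f) (trans (off₂ ((x≢f F ∘ sym) ∷ [])) (upd-same v′ f m)) ,
        trans (cong (_+ m) g₂) (swap-suc (v′ g) eg) ,
        trans (upd-other v₂ g _ (x≢1+f F))
          (trans e₂ (trans (cong (_+ B (v′ g)) (trans (upd-other v′ f m (x≢f F)) ex))
            (trans (ℕ.+-assoc (v x) (sumTo (v′ g) B) (B (v′ g))) (cong (λ j → v x + sumTo j B) (sym g₂))))) ,
        λ { (p ∷ q ∷ t ∷ []) → trans (upd-other v₂ g _ q) (trans (off₂ (t ∷ [])) (trans (upd-other v′ f m p) (off (p ∷ q ∷ t ∷ [])))) }
        where
        g₂ : (v₂ [ g ↦ suc (v₂ g) ]) g ≡ suc (v′ g)
        g₂ = trans (upd-same v₂ g _) (cong suc (trans (off₂ ((x≢1+f F ∘ sym) ∷ [])) (upd-other v′ f m g≢f)))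
      finish : Reaches (comp (sumOf a b) ns x f) v o (eval (timeP (sumOf a b)) M) λ v′ o′ →
               o′ ≡ o × v′ x ≡ v x + sumTo A B × Off (x ∷ []) v v′
      finish with countdown-rule (r<f F) f≤ P (λ p → proj₁ (proj₂ p)) body A {v₁}
                    (refl , trans e₁ (cong (_+ A) (zeros R ℕ.≤-refl)) , cong (_+ A) g₁ ,
                     trans (off₁ (x≢f F ∷ [])) (trans (sym (ℕ.+-identityʳ _)) (cong (λ j → v x + sumTo j B) (sym g₁))) ,
                     λ { (p ∷ q ∷ t ∷ []) → off₁ (p ∷ []) })
        where
        g₁ : v₁ g ≡ 0
        g₁ = trans (off₁ (g≢f ∷ [])) (zeros R (ℕ.n≤1+n f))
      ... | v₂ , _ , T₂ , refl , ef , eg , ex , off₂ with clear-spec {g} {v₂} {o} r<1+f 1+f≤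
      ... | v₃ , _ , T₃ , refl , e₃ , off₃ =
        v₃ , _ ,
        T₁ ⨾ₜ weaken (ℕ.+-monoˡ-≤ 1 (ℕ.*-monoˡ-≤ (2 + (tb + 1)) (size-bound a bd))) T₂ ⨾ₜ
          weaken (move-bound (sizeP a) M 3 (ℕ.≤-trans (ℕ.≤-reflexive (+0 eg)) (size-bound a bd))) T₃ , refl ,
        trans (off₃ (x≢1+f F ∷ [])) (trans ex (cong (λ j → v x + sumTo j B) (+0 eg))) ,
        off-close (off-close {g} {f ∷ x ∷ []}
            (λ { (p ∷ q ∷ t ∷ []) → trans (off₃ (p ∷ [])) (off₂ (q ∷ p ∷ t ∷ [])) })
            (trans e₃ (sym (zeros R (ℕ.n≤1+n f)))))
          (trans (off₃ ((g≢f ∘ sym) ∷ [])) (trans ef (sym (zeros R ℕ.≤-refl))))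

-- Programs that print words

data Out (r n : ℕ) : Set where
  emit  : Expr r n → Out r n
  _▹_   : Out r n → Out r n → Out r n
  forOf : Expr r n → Out r (suc n) → Out r n

infixr 5 _▹_

positive : ℕ → Bool
positive zero    = false
positive (suc _) = true

concatTo : ℕ → (ℕ → Word) → Word
concatTo zero    g = []
concatTo (suc n) g = concatTo n g ++ g n

outWord : ∀ {r n} → Out r n → Vec Word r → Vec ℕ n → Word
outWord (emit e)    ws ρ = positive (⟦ e ⟧ ws ρ) ∷ []
outWord (o ▹ p)     ws ρ = outWord o ws ρ ++ outWord p ws ρ
outWord (forOf a o) ws ρ = concatTo (⟦ a ⟧ ws ρ) (λ i → outWord o ws (i ∷ ρ))

outSizeP outTimeP : ∀ {r n} → Out r n → Poly
outSizeP (emit e)    = con 1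
outSizeP (o ▹ p)     = outSizeP o ⊕ outSizeP p
outSizeP (forOf a o) = sizeP a ⊗ outSizeP o ∘ₚ (X ⊕ sizeP a)
outTimeP (emit e)    = timeP e ⊕ (con 2 ⊕ countdownP (sizeP e) 3)
outTimeP (o ▹ p)     = outTimeP o ⊕ outTimeP p
outTimeP (forOf a o) =
  timeP a ⊕ ((sizeP a ⊗ (con 2 ⊕ (outTimeP o ∘ₚ (X ⊕ sizeP a) ⊕ con 1)) ⊕ con 1) ⊕ countdownP (sizeP a) 3)

concatTo-≤ : ∀ n {g b} → (∀ {i} → i < n → length (g i) ≤ b) → length (concatTo n g) ≤ n * b
concatTo-≤ zero    h = z≤n
concatTo-≤ (suc n) {g} {b} h = ℕ.≤-trans (ℕ.≤-reflexive (List.length-++ (concatTo n g)))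
  (ℕ.≤-trans (ℕ.+-mono-≤ (concatTo-≤ n (h ∘ ℕ.m<n⇒m<1+n)) (h ℕ.≤-refl)) (ℕ.≤-reflexive (ℕ.+-comm (n * b) b)))

outSize-bound : ∀ {r n} (o : Out r n) {ws ρ M} → BoundedBy M ρ → length (outWord o ws ρ) ≤ eval (outSizeP o) M
outSize-bound (emit e)    h = ℕ.≤-refl
outSize-bound (o ▹ p) {ws} {ρ} h = ℕ.≤-trans (ℕ.≤-reflexive (List.length-++ (outWord o ws ρ)))
  (ℕ.+-mono-≤ (outSize-bound o h) (outSize-bound p h))
outSize-bound (forOf a o) {ws} {ρ} {M} h = ℕ.≤-trans
  (concatTo-≤ (⟦ a ⟧ ws ρ) (λ i< → ℕ.≤-trans (outSize-bound o (boundedBy-∷ h (ℕ.≤-trans (ℕ.<⇒≤ i<) (size-bound a h))))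
                                               (ℕ.≤-reflexive (sym (eval-∘ₚ (outSizeP o) (X ⊕ sizeP a) M)))))
  (ℕ.*-monoˡ-≤ (eval (outSizeP o ∘ₚ (X ⊕ sizeP a)) M) (size-bound a h))

outRegisters : ∀ {r n} → Out r n → ℕ → ℕ
outRegisters (emit e)    f = registers e (2 + f)
outRegisters (o ▹ p)     f = outRegisters o f ⊔ outRegisters p f
outRegisters (forOf a o) f = registers a (2 + f) ⊔ outRegisters o (2 + f)

outRegisters-≥ : ∀ {r n} (o : Out r n) f → f ≤ outRegisters o f
outRegisters-≥ (emit e)    f = ℕ.≤-trans (ℕ.m≤n+m f 2) (registers-≥ e (2 + f))
outRegisters-≥ (o ▹ p)     f = ℕ.≤-trans (outRegisters-≥ o f) (ℕ.m≤m⊔n _ _)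
outRegisters-≥ (forOf a o) f = ℕ.≤-trans (ℕ.m≤n+m f 2) (ℕ.≤-trans (registers-≥ a (2 + f)) (ℕ.m≤m⊔n _ _))

toℕ-clamp : ∀ n {j} → j ≤ n → toℕ (clamp n j) ≡ j
toℕ-clamp zero    z≤n       = refl
toℕ-clamp (suc n) z≤n       = refl
toℕ-clamp (suc n) (s≤s j≤n) = cong suc (toℕ-clamp n j≤n)

length≤inputSize : ∀ {r} (ws : Vec Word r) i → length (Vec.lookup ws i) ≤ inputSize ws
length≤inputSize (w ∷ ws) zero    = ℕ.m≤m+n _ _
length≤inputSize (w ∷ ws) (suc i) = ℕ.≤-trans (length≤inputSize ws i) (ℕ.m≤n+m _ (length w))

module OutCompiler (r w : ℕ) where
  open Programs r w
  open Compiler r w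

  compOut : ∀ {n} → Out r n → Vec ℕ n → ℕ → Prog
  compOut (emit e) ns f =
    comp e ns f (2 + f) ⨾ cond (nonzero? f) (emitP true) (emitP false) ⨾ clear f
  compOut (o ▹ p) ns f = compOut o ns f ⨾ compOut p ns f
  compOut (forOf a o) ns f =
    comp a ns f (2 + f) ⨾ countdown f (compOut o ((1 + f) ∷ ns) (2 + f) ⨾ inc (1 + f)) ⨾ clear (1 + f)

  lengthReg : Fin r → ℕ
  lengthReg i = suc (r + toℕ i)

  spare : ℕ
  spare = suc (r + r)

  -- The lengths of the inputs are the numbers a program starts from. The scan is counted twice: the
  -- length register keeps its count, while the count in `spare` is used up in walking the head
  -- back.
  measure : Fin r → Prog
  measure i = while (nonblank? (suc (toℕ i))) (inc (suc (toℕ i)) ⨾ inc (lengthReg i) ⨾ inc spare) ⨾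
              countdown spare (dec (suc (toℕ i)))

  measureUpTo : ∀ k → k ≤ r → Prog
  measureUpTo zero    _   = skip
  measureUpTo (suc k) k<r = measureUpTo k (ℕ.<⇒≤ k<r) ⨾ measure (fromℕ< k<r)

  markAct : ℕ → Sym → Sym × Move
  markAct j s = (if j ≤ᵇ r then s else bit true) , stay

  -- A counter with value 0 scans a marked cell, whereas work tapes start blank. One step writes all
  -- the marks at once.
  markCounters : Prog
  markCounters = prim λ ss → Vec.tabulate λ j → markAct (toℕ j) (Vec.lookup ss j)

  -- `readWord` reads to the right of the head, which after printing stands behind the word. The
  -- first move leaves the blank behind the word, the loop runs to the blank in front of it, and the
  -- last move returns to the first bit.
  rewind : Prog
  rewind = op 0 (keep left) ⨾ while (nonblank? 0) (op 0 (keep left)) ⨾ op 0 (keep right)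

  program : Out r r → Prog
  program o = markCounters ⨾ measureUpTo r ℕ.≤-refl ⨾ compOut o (Vec.tabulate lengthReg) (suc spare) ⨾ rewind

  module OutCorrectness (ws : Vec Word r) where
    open Semantics ws
    open Correctness ws
    open Fresh
    open Ready

    Prints : ∀ {n} → Out r n → Vec ℕ n → Vec ℕ n → ℕ → Set
    Prints o ns ρ f = ∀ {v out M} → BoundedBy M ρ → Ready ns ρ f v →
      Reaches (compOut o ns f) v out (eval (outTimeP o) M) λ v′ out′ →
        out′ ≡ out ++ outWord o ws ρ × Off [] v v′

    compOut-spec : ∀ {n} (o : Out r n) {ns ρ x f} → Fresh ns x f → outRegisters o f ≤ suc top → Prints o ns ρ f
    compOut-spec (emit e) {ns} {ρ} {x} {f} F h {v} {out} {M} bd R with comp-spec e (fresh-f F) h bd (ready-mono R)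
    ... | v₁ , _ , T₁ , refl , e₁ , off₁ = finish (trans e₁ (cong (_+ ⟦ e ⟧ ws ρ) (zeros R ℕ.≤-refl)))
      where
      f≤ : f ≤ top
      f≤ = ℕ.≤-trans (ℕ.n≤1+n f) (s≤s⁻¹ (ℕ.≤-trans (registers-≥ e (2 + f)) h))
      answer : ∀ {D} → v₁ f ≡ D → Triple (cond (nonzero? f) (emitP true) (emitP false)) v₁ out 2 v₁ (out ++ positive D ∷ [])
      answer {zero}  eq = cond-false (nonzero?-zero (r<f F) f≤ eq) emitP-spec
      answer {suc D} eq = cond-true (nonzero?-suc (r<f F) f≤ eq) emitP-spec
      finish : v₁ f ≡ ⟦ e ⟧ ws ρ → Reaches (compOut (emit e) ns f) v out (eval (outTimeP (emit e)) M) λ v′ out′ →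
               out′ ≡ out ++ outWord (emit e) ws ρ × Off [] v v′
      finish eq with clear-spec {f} {v₁} {out ++ positive (⟦ e ⟧ ws ρ) ∷ []} (r<f F) f≤
      ... | v₂ , _ , T₂ , refl , e₂ , off₂ =
        v₂ , _ , T₁ ⨾ₜ answer eq ⨾ₜ weaken (move-bound (sizeP e) M 3 (ℕ.≤-trans (ℕ.≤-reflexive eq) (size-bound e bd))) T₂ , refl ,
        off-close (λ ne → trans (off₂ ne) (off₁ ne)) (trans e₂ (sym (zeros R ℕ.≤-refl)))
    compOut-spec (o ▹ p) {ns} {ρ} F h {v} {out} bd R with compOut-spec o F (ℕ.m⊔n≤o⇒m≤o _ _ h) {out = out} bd R
    ... | v₁ , _ , T₁ , refl , off₁
      with compOut-spec p F (ℕ.m⊔n≤o⇒n≤o (outRegisters o _) _ h) {out = out ++ outWord o ws ρ} bd (ready-off [] off₁ R)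
    ... | v₂ , _ , T₂ , refl , off₂ =
      v₂ , _ , T₁ ⨾ₜ T₂ , List.++-assoc out (outWord o ws ρ) (outWord p ws ρ) , λ ne → trans (off₂ ne) (off₁ ne)
    compOut-spec (forOf a o) {ns} {ρ} {x} {f} F h {v} {out} {M} bd R
      with comp-spec a (fresh-f F) (ℕ.m⊔n≤o⇒m≤o _ _ h) bd (ready-mono R)
    ... | v₁ , _ , T₁ , refl , e₁ , off₁ = finish
      where
      A = ⟦ a ⟧ ws ρ
      B : ℕ → Word
      B j = outWord o ws (j ∷ ρ)
      g = 1 + f
      hb : outRegisters o (2 + f) ≤ suc top
      hb = ℕ.m⊔n≤o⇒n≤o (registers a _) _ h
      1+f≤ : 1 + f ≤ top
      1+f≤ = s≤s⁻¹ (ℕ.≤-trans (outRegisters-≥ o (2 + f)) hb)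
      f≤ : f ≤ top
      f≤ = ℕ.≤-trans (ℕ.n≤1+n f) 1+f≤
      r<1+f = r<x (fresh-1+f F)
      g≢f : g ≢ f
      g≢f = f≢1+f ∘ sym
      tb = eval (outTimeP o ∘ₚ (X ⊕ sizeP a)) M
      P : ℕ → Store → Word → Set
      P m v′ o′ = v′ f ≡ m × v′ g + m ≡ A × o′ ≡ out ++ concatTo (v′ g) B × Off (f ∷ g ∷ []) v v′
      body : ∀ {m v′ o′} → P (suc m) v′ o′ →
             Reaches (compOut o (g ∷ ns) (2 + f) ⨾ inc g) (v′ [ f ↦ m ]) o′ (tb + 1) (P m)
      body {m} {v′} (ef , eg , refl , off)
        with compOut-spec o {ρ = v′ g ∷ ρ} (fresh-body F) hb {v′ [ f ↦ m ]} {out ++ concatTo (v′ g) B} {M + eval (sizeP a) M}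
               (boundedBy-∷ bd (ℕ.≤-trans (ℕ.m+n≤o⇒m≤o (v′ g) (ℕ.≤-reflexive eg)) (size-bound a bd)))
               (ready-body (ready-off (fresh-f F ∷ fresh-1+f F ∷ [])
                 (λ { (p ∷ q ∷ []) → trans (upd-other v′ f m p) (off (p ∷ q ∷ [])) }) (ready-mono R))
                 (upd-other v′ f m g≢f))
      ... | v₂ , _ , T₂ , refl , off₂ =
        v₂ [ g ↦ suc (v₂ g) ] , _ ,
        weaken (ℕ.≤-reflexive (sym (eval-∘ₚ (outTimeP o) (X ⊕ sizeP a) M))) T₂ ⨾ₜ inc-ctr r<1+f 1+f≤ ,
        trans (upd-other v₂ g _ f≢1+f) (trans (off₂ []) (upd-same v′ f m)) ,
        trans (cong (_+ m) g₂) (swap-suc (v′ g) eg) ,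
        trans (List.++-assoc out (concatTo (v′ g) B) (B (v′ g))) (cong (λ j → out ++ concatTo j B) (sym g₂)) ,
        λ { (p ∷ q ∷ []) → trans (upd-other v₂ g _ q) (trans (off₂ []) (trans (upd-other v′ f m p) (off (p ∷ q ∷ [])))) }
        where
        g₂ : (v₂ [ g ↦ suc (v₂ g) ]) g ≡ suc (v′ g)
        g₂ = trans (upd-same v₂ g _) (cong suc (trans (off₂ []) (upd-other v′ f m g≢f)))
      finish : Reaches (compOut (forOf a o) ns f) v out (eval (outTimeP (forOf a o)) M) λ v′ out′ →
               out′ ≡ out ++ concatTo A B × Off [] v v′
      finish with countdown-rule (r<f F) f≤ P proj₁ body A {v₁} {out}
                    (trans e₁ (cong (_+ A) (zeros R ℕ.≤-refl)) , cong (_+ A) g₁ ,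
                     trans (sym (List.++-identityʳ out)) (cong (λ j → out ++ concatTo j B) (sym g₁)) ,
                     λ { (p ∷ q ∷ []) → off₁ (p ∷ []) })
        where
        g₁ : v₁ g ≡ 0
        g₁ = trans (off₁ (g≢f ∷ [])) (zeros R (ℕ.n≤1+n f))
      ... | v₂ , out₂ , T₂ , ef , eg , eo , off₂ with clear-spec {g} {v₂} {out₂} r<1+f 1+f≤
      ... | v₃ , _ , T₃ , refl , e₃ , off₃ =
        v₃ , _ ,
        T₁ ⨾ₜ weaken (ℕ.+-monoˡ-≤ 1 (ℕ.*-monoˡ-≤ (2 + (tb + 1)) (size-bound a bd))) T₂ ⨾ₜ
          weaken (move-bound (sizeP a) M 3 (ℕ.≤-trans (ℕ.≤-reflexive (+0 eg)) (size-bound a bd))) T₃ ,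
        trans eo (cong (λ j → out ++ concatTo j B) (+0 eg)) ,
        off-close (off-close {g} {f ∷ []}
            (λ { (p ∷ q ∷ []) → trans (off₃ (p ∷ [])) (off₂ (q ∷ p ∷ [])) })
            (trans e₃ (sym (zeros R (ℕ.n≤1+n f)))))
          (trans (off₃ ((g≢f ∘ sym) ∷ [])) (trans ef (sym (zeros R ℕ.≤-refl))))

    r<lengthReg : ∀ i → r < lengthReg i
    r<lengthReg i = s≤s (ℕ.m≤m+n r (toℕ i))

    lengthReg<spare : ∀ i → lengthReg i < spare
    lengthReg<spare i = s≤s (ℕ.+-monoʳ-< r (Fin.toℕ<n i))

    r<spare : r < spare
    r<spare = s≤s (ℕ.m≤m+n r r)

    lengthReg-injective : ∀ {i j} → lengthReg i ≡ lengthReg j → i ≡ j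
    lengthReg-injective e = Fin.toℕ-injective (ℕ.+-cancelˡ-≡ r _ _ (ℕ.suc-injective e))

    measureTime : ℕ → ℕ
    measureTime n = (n * 4 + 1) + (n * 3 + 1)

    module _ (i : Fin r) (h : spare ≤ top) where
      private
        s l L : ℕ
        s = suc (toℕ i)
        l = lengthReg i
        L = length (Vec.lookup ws i)
        l≤ : l ≤ top
        l≤ = ℕ.≤-trans (ℕ.<⇒≤ (lengthReg<spare i)) h
        s≢l : s ≢ l
        s≢l = input≢counter (r<lengthReg i)
        s≢spare : s ≢ spare
        s≢spare = input≢counter r<spare
        l≢spare : l ≢ spare
        l≢spare = ℕ.<⇒≢ (lengthReg<spare i)

      scan-spec : ∀ m {v o} → v s + m ≡ L → v l ≡ v s → v spare ≡ v s →
                  Reaches (while (nonblank? s) (inc s ⨾ inc l ⨾ inc spare)) v o (m * 4 + 1)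
                    λ v′ o′ → o′ ≡ o × v′ s ≡ L × v′ l ≡ L × v′ spare ≡ L × Off (s ∷ l ∷ spare ∷ []) v v′
      scan-spec zero {v} es el et = v , _ , while-false (nonblank?-end i (+0 es)) , refl , +0 es ,
        trans el (+0 es) , trans et (+0 es) , λ _ → refl
      scan-spec (suc m) {v} {o} es el et
        with scan-spec m {v₃} {o} (trans (cong (_+ m) s₃) (swap-suc (v s) es)) (trans l₃ (sym s₃)) (trans t₃ (sym s₃))
        where
        v₁ = v [ s ↦ suc (v s) ]
        v₂ = v₁ [ l ↦ suc (v₁ l) ]
        v₃ = v₂ [ spare ↦ suc (v₂ spare) ]
        s₃ : v₃ s ≡ suc (v s)
        s₃ = trans (upd-other v₂ spare _ s≢spare) (trans (upd-other v₁ l _ s≢l) (upd-same v s _))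
        l₃ : v₃ l ≡ suc (v s)
        l₃ = trans (upd-other v₂ spare _ l≢spare) (trans (upd-same v₁ l _) (cong suc (trans (upd-other v s _ (s≢l ∘ sym)) el)))
        t₃ : v₃ spare ≡ suc (v s)
        t₃ = trans (upd-same v₂ spare _) (cong suc (trans (upd-other v₁ l _ (l≢spare ∘ sym)) (trans (upd-other v s _ (s≢spare ∘ sym)) et)))
      ... | v′ , _ , T , refl , es′ , el′ , et′ , off =
        v′ , _ , while-true (nonblank?-< i es) (inc-inp i ⨾ₜ inc-ctr (r<lengthReg i) l≤ ⨾ₜ inc-ctr r<spare h) T , refl ,
        es′ , el′ , et′ , λ { (p ∷ q ∷ t ∷ []) → trans (off (p ∷ q ∷ t ∷ []))
          (trans (upd-other (v [ s ↦ suc (v s) ] [ l ↦ suc ((v [ s ↦ suc (v s) ]) l) ]) spare _ t) (trans (upd-other (v [ s ↦ suc (v s) ]) l _ q) (upd-other v s _ p))) }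

      measure-spec : ∀ {v o} → v s ≡ 0 → v l ≡ 0 → v spare ≡ 0 →
                     Reaches (measure i) v o (measureTime L) λ v′ o′ → o′ ≡ o × v′ l ≡ L × Off (l ∷ []) v v′
      measure-spec {v} {o} es el et with scan-spec L {v} {o} (cong (_+ L) es) (trans el (sym es)) (trans et (sym es))
      ... | v₁ , _ , T₁ , refl , es₁ , el₁ , et₁ , off₁
        with countdown-rule r<spare h Q (λ p → proj₁ (proj₂ p)) body L {v₁} {o} (refl , et₁ , es₁ , λ _ → refl)
        where
        Q : ℕ → Store → Word → Set
        Q m v′ o′ = o′ ≡ o × v′ spare ≡ m × v′ s ≡ m × Off (s ∷ spare ∷ []) v₁ v′
        body : ∀ {m v′ o′} → Q (suc m) v′ o′ → Reaches (dec s) (v′ [ spare ↦ m ]) o′ 1 (Q m)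
        body {m} {v′} (refl , ef , eg , off) = _ , _ , dec-inp i (trans (upd-other v′ spare m s≢spare) eg) , refl ,
          trans (upd-other (v′ [ spare ↦ m ]) s m (s≢spare ∘ sym)) (upd-same v′ spare m) , upd-same (v′ [ spare ↦ m ]) s m ,
          λ { (p ∷ q ∷ []) → trans (upd-other (v′ [ spare ↦ m ]) s m p) (trans (upd-other v′ spare m q) (off (p ∷ q ∷ []))) }
      ... | v₂ , _ , T₂ , refl , et₂ , es₂ , off₂ =
        v₂ , _ , T₁ ⨾ₜ T₂ , refl , trans (off₂ ((s≢l ∘ sym) ∷ l≢spare ∷ [])) el₁ ,
        off-close (off-close {s} {spare ∷ l ∷ []}
            (λ { (p ∷ q ∷ t ∷ []) → trans (off₂ (p ∷ q ∷ [])) (off₁ (p ∷ t ∷ q ∷ [])) })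
            (trans es₂ (sym es)))
          (trans et₂ (sym et))

    measureTime-mono : ∀ {m n} → m ≤ n → measureTime m ≤ measureTime n
    measureTime-mono le = ℕ.+-mono-≤ (ℕ.+-monoˡ-≤ 1 (ℕ.*-monoˡ-≤ 4 le)) (ℕ.+-monoˡ-≤ 1 (ℕ.*-monoˡ-≤ 3 le))

    measureUpTo-spec : spare ≤ top → ∀ k (k≤r : k ≤ r) {v o} → (∀ y → v y ≡ 0) →
      Reaches (measureUpTo k k≤r) v o (1 + k * measureTime (inputSize ws)) λ v′ o′ → o′ ≡ o ×
        (∀ i → toℕ i < k → v′ (lengthReg i) ≡ length (Vec.lookup ws i)) ×
        (∀ {y} → (∀ i → toℕ i < k → y ≢ lengthReg i) → v′ y ≡ 0)
    measureUpTo-spec h zero    _   {v} z = v , _ , skip-spec , refl , (λ _ ()) , λ {y} _ → z y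
    measureUpTo-spec h (suc k) k<r {v} {o} z with measureUpTo-spec h k (ℕ.<⇒≤ k<r) {v} {o} z
    ... | v₁ , _ , T₁ , refl , ls , zs
      with measure-spec i₀ h {v₁} {o}
             (zs λ j _ → input≢counter {i₀} (r<lengthReg j))
             (zs λ j j<k e → ℕ.<-irrefl (trans (cong toℕ (sym (lengthReg-injective {i₀} {j} e))) (Fin.toℕ-fromℕ< k<r)) j<k)
             (zs λ j _ → ℕ.<⇒≢ (lengthReg<spare j) ∘ sym)
      where i₀ = fromℕ< k<r
    ... | v₂ , _ , T₂ , refl , l₂ , off₂ =
      v₂ , _ ,
      weaken (ℕ.≤-trans (ℕ.+-monoʳ-≤ (1 + k * t) (measureTime-mono (length≤inputSize ws i₀)))
                        (s≤s (ℕ.≤-reflexive (ℕ.+-comm (k * t) t)))) (T₁ ⨾ₜ T₂) , refl ,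
      lens , λ {y} ne → trans (off₂ (ne i₀ (ℕ.≤-reflexive (cong suc (Fin.toℕ-fromℕ< k<r))) ∷ []))
                              (zs (λ i i<k → ne i (ℕ.m<n⇒m<1+n i<k)))
      where
      t = measureTime (inputSize ws)
      i₀ = fromℕ< k<r
      lens : ∀ i → toℕ i < suc k → v₂ (lengthReg i) ≡ length (Vec.lookup ws i)
      lens i i<1+k with i Fin.≟ i₀
      ... | yes refl = l₂
      ... | no i≢    = trans (off₂ ((i≢ ∘ lengthReg-injective) ∷ []))
        (ls i (ℕ.≤∧≢⇒< (s≤s⁻¹ i<1+k) λ e → i≢ (Fin.toℕ-injective (trans e (sym (Fin.toℕ-fromℕ< k<r))))))

    initialTapes : Tapes (suc top)
    initialTapes = wordTape [] ∷ (Vec.map wordTape ws Vec.++ Vec.replicate w (wordTape []))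

    lookup-input : ∀ i → Vec.lookup initialTapes (tp (suc (toℕ i))) ≡ wordTape (Vec.lookup ws i)
    lookup-input i = trans (cong (Vec.lookup initialTapes) tp≡)
      (trans (Vec.lookup-++ˡ (Vec.map wordTape ws) _ i) (Vec.lookup-map i wordTape ws))
      where
      tp≡ : tp (suc (toℕ i)) ≡ suc (i ↑ˡ w)
      tp≡ = Fin.toℕ-injective (trans (toℕ-clamp top (input≤top i)) (cong suc (sym (Fin.toℕ-↑ˡ i w))))

    lookup-counter : ∀ {j} → r < j → j ≤ top → Vec.lookup initialTapes (tp j) ≡ wordTape []
    lookup-counter {suc j} (s≤s r≤j) j≤ = trans (cong (Vec.lookup initialTapes) tp≡)
      (trans (Vec.lookup-++ʳ (Vec.map wordTape ws) _ c) (Vec.lookup-replicate c _))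
      where
      j∸r< : j ∸ r < w
      j∸r< = ℕ.+-cancelˡ-< r _ _ (ℕ.≤-trans (ℕ.≤-reflexive (cong suc (ℕ.m+[n∸m]≡n r≤j))) j≤)
      c = fromℕ< j∸r<
      tp≡ : tp (suc j) ≡ suc (r ↑ʳ c)
      tp≡ = Fin.toℕ-injective (trans (toℕ-clamp top j≤)
        (cong suc (sym (trans (Fin.toℕ-↑ʳ r c) (trans (cong (r +_) (Fin.toℕ-fromℕ< j∸r<)) (ℕ.m+[n∸m]≡n r≤j))))))

    clamp-zero : ∀ n → clamp n 0 ≡ zero
    clamp-zero zero    = refl
    clamp-zero (suc n) = refl

    wordTape-input : ∀ w → IsInput w 0 (wordTape w)
    wordTape-input []      = isInput {blanks = □ ∷ []} (refl ∷ []) refl refl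
    wordTape-input (b ∷ w) = isInput {blanks = []} [] (sym (List.++-identityʳ _)) refl

    markCounters-spec : ∃[ us ] (Rep (λ _ → 0) [] us × markCounters ∶ initialTapes ⟶[ 1 ] us)
    markCounters-spec = _ , rep outs′ ins′ ctrs′ , prim-run _ initialTapes
      where
      acts : Vec (Sym × Move) (suc top)
      acts = Vec.tabulate λ j → markAct (toℕ j) (Vec.lookup (Vec.map scanned initialTapes) j)
      marked : ∀ {x} → x ≤ top → Vec.lookup (applyActs acts initialTapes) (tp x) ≡ run (markAct x) (Vec.lookup initialTapes (tp x))
      marked {x} x≤ = trans (Vec.lookup-zipWith act (tp x) acts initialTapes)
        (cong (λ a → act a (Vec.lookup initialTapes (tp x)))
          (trans (Vec.lookup∘tabulate (λ j → markAct (toℕ j) (Vec.lookup (Vec.map scanned initialTapes) j)) (tp x))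
            (cong₂ markAct (toℕ-clamp top x≤) (Vec.lookup-map (tp x) scanned initialTapes))))
      ≤ᵇ-true : ∀ {x} → x ≤ r → (x ≤ᵇ r) ≡ true
      ≤ᵇ-true {x} x≤ with x ≤ᵇ r | ℕ.≤⇒≤ᵇ x≤
      ... | true | _ = refl
      ≤ᵇ-false : ∀ {x} → r < x → (x ≤ᵇ r) ≡ false
      ≤ᵇ-false {x} r< with x ≤ᵇ r in e
      ... | false = refl
      ... | true  = contradiction (ℕ.≤-trans r< (ℕ.≤ᵇ⇒≤ x r (subst T (sym e) tt))) (ℕ.<-irrefl refl)
      kept : ∀ {x} → x ≤ r → x ≤ top → Vec.lookup (applyActs acts initialTapes) (tp x) ≡ Vec.lookup initialTapes (tp x)
      kept {x} x≤r x≤ = trans (marked x≤)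
        (cong (λ b → run (λ s → (if b then s else bit true) , stay) (Vec.lookup initialTapes (tp x))) (≤ᵇ-true x≤r))
      outs′ : IsOutput [] (Vec.lookup (applyActs acts initialTapes) (tp 0))
      outs′ = subst (IsOutput []) (sym (trans (kept z≤n z≤n) (cong (Vec.lookup initialTapes) (clamp-zero top))))
                    (isOutput refl refl [])
      ins′ : ∀ i → IsInput (Vec.lookup ws i) 0 (Vec.lookup (applyActs acts initialTapes) (tp (suc (toℕ i))))
      ins′ i = subst (IsInput (Vec.lookup ws i) 0) (sym (trans (kept (Fin.toℕ<n i) (input≤top i)) (lookup-input i)))
                     (wordTape-input (Vec.lookup ws i))
      ctrs′ : ∀ {j} → r < j → j ≤ top → IsCounter 0 (Vec.lookup (applyActs acts initialTapes) (tp j))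
      ctrs′ {j} r<j j≤ = subst (IsCounter 0) (sym (trans (marked j≤)
          (trans (cong (λ b → run (λ s → (if b then s else bit true) , stay) (Vec.lookup initialTapes (tp j))) (≤ᵇ-false r<j))
                 (cong (run (λ _ → bit true , stay)) (lookup-counter r<j j≤)))))
        (isCounter refl [])

    bitPrefix-blank : ∀ o {bl : List Sym} → AllBlank bl → bitPrefix (List.map bit o ++ bl) ≡ o
    bitPrefix-blank []      []         = refl
    bitPrefix-blank []      (refl ∷ _) = refl
    bitPrefix-blank (b ∷ o) bl         = cong (b ∷_) (bitPrefix-blank o bl)

    -- While the head is brought back the output tape violates `IsOutput`, so `Rep` is given up and
    -- this single tape is followed.
    Moves : (A : Prog) (t : ℕ) (a b : Tape 0) → Set
    Moves A t a b = ∀ {ts} → Vec.lookup ts (tp 0) ≡ a → ∃[ us ] (Vec.lookup us (tp 0) ≡ b × A ∶ ts ⟶[ t ] us)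

    moveOnce : ∀ f a → Moves (op 0 f) 1 a (run f a)
    moveOnce f a {ts} refl = _ , Vec.lookup∘updateAt (tp 0) ts , op-run 0 f ts

    sweep : ∀ p b a → Moves (while (nonblank? 0) (op 0 (keep left))) (suc (length p) * 2 + 1)
                            (tape (List.map bit p) (bit b) a) (tape [] □ (List.map bit p List.ʳ++ (bit b ∷ a)))
    sweep p b a {ts} e with moveOnce (keep left) _ {ts} e
    sweep [] b a {ts} e | us , e₁ , q = us , e₁ ,
      while-run-true {A = op 0 (keep left)} (trans (tests-lookup {0} isBit ts) (cong (isBit ∘ scanned) e)) q
        (while-run-false {A = op 0 (keep left)} (trans (tests-lookup {0} isBit us) (cong (isBit ∘ scanned) e₁)))
    sweep (c ∷ p) b a {ts} e | us , e₁ , q with sweep p c (bit b ∷ a) {us} e₁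
    ... | us′ , e₂ , q′ = us′ , e₂ ,
      while-run-true {A = op 0 (keep left)} (trans (tests-lookup {0} isBit ts) (cong (isBit ∘ scanned) e)) q q′

    rewind-spec : ∀ {v o ts} → Rep v o ts →
      ∃[ us ] ∃[ t ] (t ≤ length o * 2 + 3 × readWord (Vec.lookup us (tp 0)) ≡ o × rewind ∶ ts ⟶[ t ] us)
    rewind-spec {o = o} {ts} R with Vec.lookup ts (tp 0) in e | Rep.outs R
    ... | tape bf _ af | isOutput wr refl bl with reversed o bf wr
      where
      reversed : ∀ o bf → bf List.ʳ++ [] ≡ List.map bit o → ∃[ p ] (length p ≡ length o × bf ≡ List.map bit p)
      reversed o bf wr = List.reverse o , List.length-reverse o ,
        trans (sym (List.reverse-involutive bf)) (trans (cong List.reverse wr) (sym (List.reverse-map bit o)))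
    ... | [] , le , refl with moveOnce (keep left) _ {ts} e
    ...   | us , e₁ , q₁ with moveOnce (keep right) _ {us} e₁
    ...     | us′ , e₂ , q₂ = us′ , 3 , ℕ.m≤n+m 3 _ ,
      trans (cong readWord e₂) (empty o wr) ,
      ⨾-run {A = op 0 (keep left)} q₁ (⨾-run {A = while (nonblank? 0) (op 0 (keep left))} (while-run-false {A = op 0 (keep left)}
        (trans (tests-lookup {0} isBit us) (cong (isBit ∘ scanned) e₁))) q₂)
      where
      empty : ∀ o → [] ≡ List.map bit o → [] ≡ o
      empty [] _ = refl
    rewind-spec {o = o} {ts} R | tape _ _ af | isOutput wr refl bl | c ∷ p , le , refl with moveOnce (keep left) _ {ts} e
    ... | us , e₁ , q₁ with sweep p c (□ ∷ af) {us} e₁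
    ...   | us₂ , e₂ , q₂ with moveOnce (keep right) _ {us₂} e₂
    ...     | us₃ , e₃ , q₃ = us₃ , _ , bound ,
      trans (cong readWord e₃) (trans (readRight (List.map bit p List.ʳ++ (bit c ∷ □ ∷ af)))
        (trans (cong bitPrefix (trans (sym (ʳ++-++ (List.map bit p))) (cong (_++ □ ∷ af) wr))) (bitPrefix-blank o (refl ∷ bl)))) ,
      ⨾-run {A = op 0 (keep left)} q₁ (⨾-run {A = while (nonblank? 0) (op 0 (keep left))} q₂ q₃)
      where
      readRight : ∀ (xs : List Sym) → readWord (move right (tape [] □ xs)) ≡ bitPrefix xs
      readRight []       = refl
      readRight (x ∷ xs) = refl
      bound : 1 + (suc (length p) * 2 + 1 + 1) ≤ length o * 2 + 3
      bound = ℕ.≤-reflexive (trans (cong (λ n → 1 + (n * 2 + 1 + 1)) le)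
        (trans (cong suc (ℕ.+-assoc (length o * 2) 1 1)) (sym (ℕ.+-suc (length o * 2) 2))))

    program-spec : ∀ (o : Out r r) → outRegisters o (suc spare) ≤ suc top → spare ≤ top →
      let ρ = Vec.map length ws ; S = inputSize ws in
      ∃[ us ] ∃[ t ] (t ≤ 1 + ((1 + r * measureTime S) + (eval (outTimeP o) S + (eval (outSizeP o) S * 2 + 3))) ×
        readWord (Vec.lookup us zero) ≡ outWord o ws ρ × program o ∶ initialTapes ⟶[ t ] us)
    program-spec o h sp≤ with markCounters-spec
    ... | us₁ , R₁ , q₁ with measureUpTo-spec sp≤ r ℕ.≤-refl {λ _ → 0} {[]} (λ _ → refl)
    ... | v₂ , _ , T₂ , refl , ls , zs with T₂ R₁
    ... | us₂ , t₂ , t₂≤ , R₂ , q₂ with compOut-spec o names-fresh h {v₂} {[]} {inputSize ws} bounded lengths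
      where
      lookup-reg : ∀ i → Vec.lookup (Vec.tabulate lengthReg) i ≡ lengthReg i
      lookup-reg = Vec.lookup∘tabulate lengthReg
      names-fresh : Fresh (Vec.tabulate lengthReg) spare (suc spare)
      names-fresh = fresh r<spare ℕ.≤-refl
        (λ i → subst (r <_) (sym (lookup-reg i)) (r<lengthReg i))
        (λ i → subst (_< suc spare) (sym (lookup-reg i)) (ℕ.m<n⇒m<1+n (lengthReg<spare i)))
        (λ i e → ℕ.<⇒≢ (lengthReg<spare i) (trans (sym (lookup-reg i)) e))
      bounded : BoundedBy (inputSize ws) (Vec.map length ws)
      bounded i = subst (_≤ inputSize ws) (sym (Vec.lookup-map i length ws)) (length≤inputSize ws i)
      lengths : Ready (Vec.tabulate lengthReg) (Vec.map length ws) (suc spare) v₂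
      lengths = ready
        (λ sp<y → zs λ i _ → λ { refl → ℕ.<-irrefl refl (ℕ.<-trans sp<y (lengthReg<spare i)) })
        (λ i → trans (cong v₂ (lookup-reg i)) (trans (ls i (Fin.toℕ<n i)) (sym (Vec.lookup-map i length ws))))
        (λ i → zs λ j _ → input≢counter {i} (r<lengthReg j))
    ... | v₃ , _ , T₃ , refl , off₃ with T₃ R₂
    ... | us₃ , t₃ , t₃≤ , R₃ , q₃ with rewind-spec R₃
    ... | us₄ , t₄ , t₄≤ , rd , q₄ =
      us₄ , 1 + (t₂ + (t₃ + t₄)) ,
      s≤s (ℕ.+-mono-≤ t₂≤ (ℕ.+-mono-≤ t₃≤ (ℕ.≤-trans t₄≤ (ℕ.+-monoˡ-≤ 3 (ℕ.*-monoˡ-≤ 2 (outSize-bound o bounded)))))) ,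
      trans (cong (readWord ∘ Vec.lookup us₄) (sym (clamp-zero top))) rd ,
      ⨾-run {A = markCounters} q₁ (⨾-run {A = measureUpTo r ℕ.≤-refl} q₂ (⨾-run {A = compOut o (Vec.tabulate lengthReg) (suc spare)} q₃ q₄))
      where
      bounded : BoundedBy (inputSize ws) (Vec.map length ws)
      bounded i = subst (_≤ inputSize ws) (sym (Vec.lookup-map i length ws)) (length≤inputSize ws i)

-- The bridge from machines to arithmetic: from here on, polynomial time is shown by writing down an
-- expression or a printing program in the lengths of the inputs.
polyTime-outWord : ∀ {r} (o : Out r r) (f : Vec Word r → Word) → (∀ ws → outWord o ws (Vec.map length ws) ≡ f ws) → PolyTime f
polyTime-outWord {r} o f h = toTM {r} {w} (program o) , bound , correct
  where
  sp = suc (r + r)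
  w = outRegisters o (suc sp)
  open OutCompiler r w using (program; module OutCorrectness)
  regs≤ : outRegisters o (suc sp) ≤ suc (r + w)
  regs≤ = ℕ.≤-trans (ℕ.m≤n+m w r) (ℕ.n≤1+n _)
  spare≤ : sp ≤ r + w
  spare≤ = ℕ.≤-trans (ℕ.≤-trans (ℕ.n≤1+n sp) (outRegisters-≥ o (suc sp))) (ℕ.m≤n+m w r)
  bound : Poly
  bound = con 1 ⊕ ((con 1 ⊕ con r ⊗ ((X ⊗ con 4 ⊕ con 1) ⊕ (X ⊗ con 3 ⊕ con 1))) ⊕ (outTimeP o ⊕ (outSizeP o ⊗ con 2 ⊕ con 3)))
  correct : ComputesInTime (toTM {r} {w} (program o)) f bound
  correct ws with OutCorrectness.program-spec ws o regs≤ spare≤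
  ... | t ∷ us , n , n≤ , rd , q = n , config zero (t ∷ us) , toTM-run {r} {w} (program o) q , trans rd (h ws) , n≤

-- Bounded formulas

data Form (r n : ℕ) : Set where
  _≐_ _⋖_        : Expr r n → Expr r n → Form r n
  bitF           : Fin r → Expr r n → Form r n
  _∧ᶠ_ _∨ᶠ_ _⇒ᶠ_ : Form r n → Form r n → Form r n
  ¬ᶠ_            : Form r n → Form r n
  ∃ᶠ ∀ᶠ          : Expr r n → Form r (suc n) → Form r n

infix  5 _≐_ _⋖_
infixr 4 _∧ᶠ_
infixr 3 _∨ᶠ_
infixr 2 _⇒ᶠ_
infix  5 ¬ᶠ_

Holds : ∀ {r n} → Form r n → Vec Word r → Vec ℕ n → Set
Holds (a ≐ b)    ws ρ = ⟦ a ⟧ ws ρ ≡ ⟦ b ⟧ ws ρ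
Holds (a ⋖ b)    ws ρ = ⟦ a ⟧ ws ρ < ⟦ b ⟧ ws ρ
Holds (bitF i a) ws ρ = bitAt (Vec.lookup ws i) (⟦ a ⟧ ws ρ) ≡ true
Holds (φ ∧ᶠ ψ)   ws ρ = Holds φ ws ρ × Holds ψ ws ρ
Holds (φ ∨ᶠ ψ)   ws ρ = Holds φ ws ρ ⊎ Holds ψ ws ρ
Holds (φ ⇒ᶠ ψ)   ws ρ = Holds φ ws ρ → Holds ψ ws ρ
Holds (¬ᶠ φ)     ws ρ = ¬ Holds φ ws ρ
Holds (∃ᶠ a φ)   ws ρ = ∃[ i ] (i < ⟦ a ⟧ ws ρ × Holds φ ws (i ∷ ρ))
Holds (∀ᶠ a φ)   ws ρ = ∀ i → i < ⟦ a ⟧ ws ρ → Holds φ ws (i ∷ ρ)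

-- Truth is being non-zero. Conjunction is then a product, disjunction a sum and existential
-- quantification a bounded sum; a universal formula says that the number of counterexamples is
-- zero.
toExpr : ∀ {r n} → Form r n → Expr r n
toExpr (a ≐ b)    = leq a b ⊠ leq b a
toExpr (a ⋖ b)    = leq (num 1 ∔ a) b
toExpr (bitF i a) = bitOf i a
toExpr (φ ∧ᶠ ψ)   = toExpr φ ⊠ toExpr ψ
toExpr (φ ∨ᶠ ψ)   = toExpr φ ∔ toExpr ψ
toExpr (φ ⇒ᶠ ψ)   = leq (toExpr φ) (num 0) ∔ toExpr ψ
toExpr (¬ᶠ φ)     = leq (toExpr φ) (num 0)
toExpr (∃ᶠ a φ)   = sumOf a (toExpr φ)
toExpr (∀ᶠ a φ)   = leq (sumOf a (leq (toExpr φ) (num 0))) (num 0)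

private
  isZero⁺ : ∀ {n} → n ≡ 0 → isZero n ≢ 0
  isZero⁺ refl ()

  isZero⁻ : ∀ n → isZero n ≢ 0 → n ≡ 0
  isZero⁻ zero    _ = refl
  isZero⁻ (suc n) h = contradiction refl h

  *≢0⁺ : ∀ {m n} → m ≢ 0 → n ≢ 0 → m * n ≢ 0
  *≢0⁺ {m} p q e with ℕ.m*n≡0⇒m≡0∨n≡0 m e
  ... | inj₁ z = p z
  ... | inj₂ z = q z

  *≢0⁻ˡ : ∀ m {n} → m * n ≢ 0 → m ≢ 0
  *≢0⁻ˡ _ h refl = h refl

  *≢0⁻ʳ : ∀ m {n} → m * n ≢ 0 → n ≢ 0
  *≢0⁻ʳ m h refl = h (ℕ.*-zeroʳ m)

  +≢0⁻ : ∀ m {n} → m + n ≢ 0 → (m ≢ 0) ⊎ (n ≢ 0)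
  +≢0⁻ zero    h = inj₂ h
  +≢0⁻ (suc m) h = inj₁ λ ()

  +≢0⁺ʳ : ∀ m {n} → n ≢ 0 → m + n ≢ 0
  +≢0⁺ʳ m h e = h (ℕ.m+n≡0⇒n≡0 m e)

  +≢0⁺ˡ : ∀ {m} n → m ≢ 0 → m + n ≢ 0
  +≢0⁺ˡ {m} n h e = h (ℕ.m+n≡0⇒m≡0 m e)

  leq⁺ : ∀ {m n} → m ≤ n → isZero (m ∸ n) ≢ 0
  leq⁺ m≤n = isZero⁺ (ℕ.m≤n⇒m∸n≡0 m≤n)

  leq⁻ : ∀ m n → isZero (m ∸ n) ≢ 0 → m ≤ n
  leq⁻ m n h = ℕ.m∸n≡0⇒m≤n (isZero⁻ (m ∸ n) h)

  sumTo≢0⁻ : ∀ n {g} → sumTo n g ≢ 0 → ∃[ i ] (i < n × g i ≢ 0)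
  sumTo≢0⁻ zero    h = contradiction refl h
  sumTo≢0⁻ (suc n) {g} h with +≢0⁻ (sumTo n g) h
  ... | inj₂ q = n , ℕ.≤-refl , q
  ... | inj₁ p with sumTo≢0⁻ n p
  ...   | i , i<n , q = i , ℕ.m<n⇒m<1+n i<n , q

  sumTo≢0⁺ : ∀ n {g i} → i < n → g i ≢ 0 → sumTo n g ≢ 0
  sumTo≢0⁺ (suc n) {g} {i} i<1+n h with i ℕ.≟ n
  ... | yes refl = +≢0⁺ʳ (sumTo n g) h
  ... | no i≢n   = +≢0⁺ˡ (g n) (sumTo≢0⁺ n (ℕ.≤∧≢⇒< (s≤s⁻¹ i<1+n) i≢n) h)

  ¬⁺ : ∀ {m} → m ≡ 0 → isZero (m ∸ 0) ≢ 0
  ¬⁺ refl ()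

  ¬⁻ : ∀ m → isZero (m ∸ 0) ≢ 0 → m ≡ 0
  ¬⁻ m h = isZero⁻ m h

module _ {r : ℕ} {ws : Vec Word r} where

  -- The three statements are mutual because implication and negation exchange the two directions.
  -- `fails⁺` is constructive since a value is visibly zero or not, which also makes all bounded
  -- formulas decidable.
  holds⁺ : ∀ {n} (φ : Form r n) {ρ} → Holds φ ws ρ → ⟦ toExpr φ ⟧ ws ρ ≢ 0
  holds⁻ : ∀ {n} (φ : Form r n) {ρ} → ⟦ toExpr φ ⟧ ws ρ ≢ 0 → Holds φ ws ρ
  fails⁺ : ∀ {n} (φ : Form r n) {ρ} → ¬ Holds φ ws ρ → ⟦ toExpr φ ⟧ ws ρ ≡ 0

  holds⁺ (a ≐ b)    e = *≢0⁺ (leq⁺ (ℕ.≤-reflexive e)) (leq⁺ (ℕ.≤-reflexive (sym e)))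
  holds⁺ (a ⋖ b)    h = leq⁺ h
  holds⁺ (bitF i a) h rewrite h = λ ()
  holds⁺ (φ ∧ᶠ ψ) (p , q)  = *≢0⁺ (holds⁺ φ p) (holds⁺ ψ q)
  holds⁺ (φ ∨ᶠ ψ) (inj₁ p) = +≢0⁺ˡ _ (holds⁺ φ p)
  holds⁺ (φ ∨ᶠ ψ) (inj₂ q) = +≢0⁺ʳ (⟦ toExpr φ ⟧ ws _) (holds⁺ ψ q)
  holds⁺ (φ ⇒ᶠ ψ) {ρ} h with ⟦ toExpr φ ⟧ ws ρ in e
  ... | zero  = λ ()
  ... | suc _ = holds⁺ ψ (h (holds⁻ φ (λ z → contradiction (trans (sym e) z) λ ())))
  holds⁺ (¬ᶠ φ)   h = ¬⁺ (fails⁺ φ h)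
  holds⁺ (∃ᶠ a φ) (i , i< , p) = sumTo≢0⁺ _ i< (holds⁺ φ p)
  holds⁺ (∀ᶠ a φ) {ρ} h with sumTo (⟦ a ⟧ ws ρ) (λ i → isZero (⟦ toExpr φ ⟧ ws (i ∷ ρ) ∸ 0)) in e
  ... | zero  = λ ()
  ... | suc _ with sumTo≢0⁻ (⟦ a ⟧ ws ρ) (λ z → contradiction (trans (sym e) z) λ ())
  ...   | i , i< , p = contradiction (¬⁻ _ p) (holds⁺ φ (h i i<))

  holds⁻ (a ≐ b) {ρ} h = ℕ.≤-antisym (leq⁻ _ _ (*≢0⁻ˡ (isZero (⟦ a ⟧ ws ρ ∸ ⟦ b ⟧ ws ρ)) h))
                                     (leq⁻ _ _ (*≢0⁻ʳ (isZero (⟦ a ⟧ ws ρ ∸ ⟦ b ⟧ ws ρ)) h))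
  holds⁻ (a ⋖ b)    h = leq⁻ _ _ h
  holds⁻ (bitF i a) {ρ} h with bitAt (Vec.lookup ws i) (⟦ a ⟧ ws ρ)
  ... | true  = refl
  ... | false = contradiction refl h
  holds⁻ (φ ∧ᶠ ψ) {ρ} h = holds⁻ φ (*≢0⁻ˡ _ h) , holds⁻ ψ (*≢0⁻ʳ (⟦ toExpr φ ⟧ ws ρ) h)
  holds⁻ (φ ∨ᶠ ψ) {ρ} h = Sum.map (holds⁻ φ) (holds⁻ ψ) (+≢0⁻ (⟦ toExpr φ ⟧ ws ρ) h)
  holds⁻ (φ ⇒ᶠ ψ) {ρ} h p with +≢0⁻ (isZero (⟦ toExpr φ ⟧ ws ρ ∸ 0)) h
  ... | inj₁ z = contradiction (¬⁻ _ z) (holds⁺ φ p)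
  ... | inj₂ q = holds⁻ ψ q
  holds⁻ (¬ᶠ φ)   h p = holds⁺ φ p (¬⁻ _ h)
  holds⁻ (∃ᶠ a φ) h with sumTo≢0⁻ _ h
  ... | i , i< , p = i , i< , holds⁻ φ p
  holds⁻ (∀ᶠ a φ) {ρ} h i i< = holds⁻ φ λ z → sumTo≢0⁺ _ {λ i → isZero (⟦ toExpr φ ⟧ ws (i ∷ ρ) ∸ 0)} i< (¬⁺ z) (¬⁻ _ h)

  fails⁺ φ {ρ} h with ⟦ toExpr φ ⟧ ws ρ in e
  ... | zero  = refl
  ... | suc _ = contradiction (holds⁻ φ (λ z → contradiction (trans (sym e) z) λ ())) h

positive⁺ : ∀ {n} → n ≢ 0 → positive n ≡ true
positive⁺ {zero}  h = contradiction refl h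
positive⁺ {suc n} h = refl

positive⁻ : ∀ {n} → positive n ≡ true → n ≢ 0
positive⁻ {suc n} _ ()

abstract
  check : ∀ {r n} → Form r n → Vec Word r → Vec ℕ n → Bool
  check φ ws ρ = positive (⟦ toExpr φ ⟧ ws ρ)

  check-value : ∀ {r n} (φ : Form r n) ws ρ → positive (⟦ toExpr φ ⟧ ws ρ) ≡ check φ ws ρ
  check-value φ ws ρ = refl

  check⁺ : ∀ {r n} (φ : Form r n) {ws ρ} → Holds φ ws ρ → check φ ws ρ ≡ true
  check⁺ φ h = positive⁺ (holds⁺ φ h)

  check⁻ : ∀ {r n} (φ : Form r n) {ws ρ} → check φ ws ρ ≡ true → Holds φ ws ρ
  check⁻ φ h = holds⁻ φ (positive⁻ h)

anyOf : ∀ {r n} {A : Set} → List A → (A → Form r n) → Form r n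
anyOf []       f = num 1 ≐ num 0
anyOf (x ∷ xs) f = f x ∨ᶠ anyOf xs f

module _ {r n : ℕ} {A : Set} {f : A → Form r n} {ws : Vec Word r} {ρ : Vec ℕ n} where

  anyOf⁺ : ∀ {x xs} → x ∈ xs → Holds (f x) ws ρ → Holds (anyOf xs f) ws ρ
  anyOf⁺ (here refl) p = inj₁ p
  anyOf⁺ (there x∈)  p = inj₂ (anyOf⁺ x∈ p)

  anyOf⁻ : ∀ xs → Holds (anyOf xs f) ws ρ → ∃[ x ] (x ∈ xs × Holds (f x) ws ρ)
  anyOf⁻ (x ∷ xs) (inj₁ p) = x , here refl , p
  anyOf⁻ (x ∷ xs) (inj₂ q) with anyOf⁻ xs q
  ... | y , y∈ , p = y , there y∈ , p

polyE : ∀ {r n} → Poly → Fin n → Expr r n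
polyE (con c) i = num c
polyE X       i = var i
polyE (p ⊕ q) i = polyE p i ∔ polyE q i
polyE (p ⊗ q) i = polyE p i ⊠ polyE q i

⟦polyE⟧ : ∀ {r n} p (i : Fin n) (ws : Vec Word r) ρ → ⟦ polyE p i ⟧ ws ρ ≡ eval p (Vec.lookup ρ i)
⟦polyE⟧ (con c) i ws ρ = refl
⟦polyE⟧ X       i ws ρ = refl
⟦polyE⟧ (p ⊕ q) i ws ρ = cong₂ _+_ (⟦polyE⟧ p i ws ρ) (⟦polyE⟧ q i ws ρ)
⟦polyE⟧ (p ⊗ q) i ws ρ = cong₂ _*_ (⟦polyE⟧ p i ws ρ) (⟦polyE⟧ q i ws ρ)

-- Words and instances

-- Uniqueness of division with remainder by `B`. Literals, variables, clauses and switches are all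
-- addressed by pairs coded in this way.
pairing-injective : ∀ {B} a a′ {b b′} → b < B → b′ < B → a * B + b ≡ a′ * B + b′ → a ≡ a′ × b ≡ b′
pairing-injective zero    zero     b< b′< e = refl , e
pairing-injective {B} zero (suc a′) {b} {b′} b< b′< e = contradiction
  (ℕ.≤-trans b< (ℕ.≤-trans (ℕ.≤-trans (ℕ.m≤m+n B (a′ * B)) (ℕ.m≤m+n _ b′)) (ℕ.≤-reflexive (sym e)))) (ℕ.<-irrefl refl)
pairing-injective {B} (suc a) zero {b} b< b′< e = contradiction
  (ℕ.≤-trans b′< (ℕ.≤-trans (ℕ.≤-trans (ℕ.m≤m+n B (a * B)) (ℕ.m≤m+n _ b)) (ℕ.≤-reflexive e))) (ℕ.<-irrefl refl)
pairing-injective {B} (suc a) (suc a′) {b} {b′} b< b′< e with pairing-injective a a′ b< b′<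
  (ℕ.+-cancelˡ-≡ B _ _ (trans (sym (ℕ.+-assoc B (a * B) b)) (trans e (ℕ.+-assoc B (a′ * B) b′))))
... | refl , refl = refl , refl

pairing-surjective : ∀ A {B n} → n < A * B → ∃[ a ] ∃[ b ] (a < A × b < B × n ≡ a * B + b)
pairing-surjective (suc A) {B} {n} n< with n ℕ.<? B
... | yes n<B = 0 , n , s≤s z≤n , n<B , refl
... | no n≮B with ℕ.m≤n⇒∃[o]m+o≡n (ℕ.≮⇒≥ n≮B)
...   | n′ , refl with pairing-surjective A (ℕ.+-cancelˡ-< B n′ (A * B) n<)
...     | a , b , a< , b< , refl = suc a , b , s≤s a< , b< , sym (ℕ.+-assoc B (a * B) b)

pairing-< : ∀ {A B a b} → a < A → b < B → a * B + b < A * B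
pairing-< {A} {B} {a} {b} a<A b<B = ℕ.≤-trans (ℕ.+-monoʳ-< (a * B) b<B)
  (ℕ.≤-trans (ℕ.≤-reflexive (ℕ.+-comm (a * B) B)) (ℕ.*-monoˡ-≤ B a<A))

<⇒gap : ∀ {m n} → m < n → ∃[ j ] (m + suc j ≡ n)
<⇒gap {m} m<n with ℕ.m≤n⇒∃[o]m+o≡n m<n
... | j , e = j , trans (ℕ.+-suc m j) e

module _ {A : Set} {d : A} where

  nth-++ʳ : ∀ xs {ys} i → nth d (xs ++ ys) (length xs + i) ≡ nth d ys i
  nth-++ʳ []       i = refl
  nth-++ʳ (x ∷ xs) i = nth-++ʳ xs i

  nth-++ˡ : ∀ xs {ys i} → i < length xs → nth d (xs ++ ys) i ≡ nth d xs i
  nth-++ˡ (x ∷ xs) {i = zero}  _        = refl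
  nth-++ˡ (x ∷ xs) {i = suc i} (s≤s i<) = nth-++ˡ xs i<

  nth-tabulate : ∀ {n} (f : Fin n → A) i → nth d (List.tabulate f) (toℕ i) ≡ f i
  nth-tabulate f zero    = refl
  nth-tabulate f (suc i) = nth-tabulate (f ∘ suc) i

  nth-toList : ∀ {n} (xs : Vec A n) i → nth d (Vec.toList xs) (toℕ i) ≡ Vec.lookup xs i
  nth-toList (x ∷ xs) zero    = refl
  nth-toList (x ∷ xs) (suc i) = nth-toList xs i

  nth-replicate : ∀ n {x : A} {i} → i < n → nth d (List.replicate n x) i ≡ x
  nth-replicate (suc n) {i = zero}  _        = refl
  nth-replicate (suc n) {i = suc i} (s≤s i<) = nth-replicate n i<

  nth-extensional : ∀ xs ys → length xs ≡ length ys → (∀ {i} → i < length xs → nth d xs i ≡ nth d ys i) → xs ≡ ys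
  nth-extensional []       []       _  h = refl
  nth-extensional (x ∷ xs) (y ∷ ys) le h =
    cong₂ _∷_ (h {0} (s≤s z≤n)) (nth-extensional xs ys (ℕ.suc-injective le) (λ {i} i< → h {suc i} (s≤s i<)))

  length-rows : ∀ {n} m (F : Fin m → List A) → (∀ u → length (F u) ≡ n) → length (List.concat (List.tabulate F)) ≡ m * n
  length-rows zero    F h = refl
  length-rows (suc m) F h = trans (List.length-++ (F zero)) (cong₂ _+_ (h zero) (length-rows m (F ∘ suc) (h ∘ suc)))

  nth-rows : ∀ {n} m (F : Fin m → List A) → (∀ u → length (F u) ≡ n) → ∀ u {j} → j < n →
             nth d (List.concat (List.tabulate F)) (toℕ u * n + j) ≡ nth d (F u) j
  nth-rows (suc m) F h zero    j< = nth-++ˡ (F zero) (ℕ.≤-trans j< (ℕ.≤-reflexive (sym (h zero))))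
  nth-rows {n} (suc m) F h (suc u) {j} j< = trans
    (cong (nth d (F zero ++ List.concat (List.tabulate (F ∘ suc))))
      (trans (ℕ.+-assoc n (toℕ u * n) j) (cong (_+ (toℕ u * n + j)) (sym (h zero)))))
    (trans (nth-++ʳ (F zero) (toℕ u * n + j)) (nth-rows m (F ∘ suc) (h ∘ suc) u j<))

notTrue : ∀ {b} → ¬ b ≡ true → b ≡ false
notTrue {false} _ = refl
notTrue {true}  h = contradiction refl h

sumTo-front : ∀ n g → sumTo (suc n) g ≡ g 0 + sumTo n (g ∘ suc)
sumTo-front zero    g = sym (ℕ.+-identityʳ (g 0))
sumTo-front (suc n) g = trans (cong (_+ g (suc n)) (sumTo-front n g)) (ℕ.+-assoc (g 0) _ _)

count-tabulate : ∀ n (f : Fin n → Bool) g → (∀ i → f i ≡ g (toℕ i)) → ∣ Vec.tabulate f ∣ ≡ sumTo n (boolVal ∘ g)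
count-tabulate zero    f g h = refl
count-tabulate (suc n) f g h with f zero | h zero | count-tabulate n (f ∘ suc) (g ∘ suc) (h ∘ suc)
... | true  | e | ih = trans (cong suc ih) (trans (cong (λ b → boolVal b + sumTo n (boolVal ∘ g ∘ suc)) e) (sym (sumTo-front n (boolVal ∘ g))))
... | false | e | ih = trans ih (trans (cong (λ b → boolVal b + sumTo n (boolVal ∘ g ∘ suc)) e) (sym (sumTo-front n (boolVal ∘ g))))

-- The header fills the first `n` bits and its terminating false the next one, hence the offset
-- `n + suc`.
arcBit : Word → ℕ → ℕ → ℕ → Bool
arcBit x n u v = bitAt x (n + suc (u * n + v))

terminalBit : Word → ℕ → ℕ → Bool
terminalBit x n u = bitAt x (n + suc (n * n + u))

-- Being a code is expressed by conditions on bits that a bounded formula can check. The fields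
-- follow `encodesF` in order and in form, including the negated equations.
record Encodes (k : ℕ) (x : Word) (n : ℕ) : Set where
  field
    ones       : ∀ i → i < n → bitAt x i ≡ true
    stop       : ¬ bitAt x n ≡ true
    fullLength : length x ≡ n + suc (n * n + n)
    loopfree   : ∀ u → u < n → ¬ arcBit x n u u ≡ true
    count      : sumTo n (boolVal ∘ terminalBit x n) ≡ k

module _ {k : ℕ} (G : TerminalDigraph k) where
  open TerminalDigraph G
  private
    n = order
    w = encodeTerminalDigraph G
    matrix = List.concat (List.tabulate (λ u → List.tabulate (arc u)))
    header = List.replicate n true

    length-matrix : length matrix ≡ n * n
    length-matrix = length-rows {d = false} n _ (λ u → List.length-tabulate (arc u))

    afterHeader : ∀ i → bitAt w (n + i) ≡ bitAt (false ∷ matrix ++ Vec.toList terminals) i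
    afterHeader i = trans (cong (λ l → bitAt w (l + i)) (sym (List.length-replicate n))) (nth-++ʳ header i)

  encode-arc : ∀ u v → arcBit w n (toℕ u) (toℕ v) ≡ arc u v
  encode-arc u v = trans (afterHeader _)
    (trans (nth-++ˡ matrix (ℕ.≤-trans (pairing-< {n} (Fin.toℕ<n u) (Fin.toℕ<n v)) (ℕ.≤-reflexive (sym length-matrix))))
      (trans (nth-rows n _ (λ u → List.length-tabulate (arc u)) u (Fin.toℕ<n v)) (nth-tabulate (arc u) v)))

  encode-terminal : ∀ u → terminalBit w n (toℕ u) ≡ Vec.lookup terminals u
  encode-terminal u = trans (afterHeader _)
    (trans (cong (λ l → bitAt (matrix ++ Vec.toList terminals) (l + toℕ u)) (sym length-matrix))
      (trans (nth-++ʳ matrix (toℕ u)) (nth-toList terminals u)))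

  encode-encodes : Encodes k w n
  encode-encodes = record
    { ones       = λ i i<n → trans (nth-++ˡ header (ℕ.≤-trans i<n (ℕ.≤-reflexive (sym (List.length-replicate n))))) (nth-replicate n i<n)
    ; stop       = λ e → contradiction (trans (sym e) (trans (cong (bitAt w) (sym (ℕ.+-identityʳ n))) (afterHeader 0))) λ ()
    ; fullLength = trans (List.length-++ header) (cong₂ (λ a b → a + suc b) (List.length-replicate n)
                   (trans (List.length-++ matrix) (cong₂ _+_ length-matrix (Vec.length-toList terminals))))
    ; loopfree   = λ u u<n e → contradiction (trans (sym e) (trans
                   (cong₂ (arcBit w n) (sym (Fin.toℕ-fromℕ< u<n)) (sym (Fin.toℕ-fromℕ< u<n)))
                   (trans (encode-arc (fromℕ< u<n) (fromℕ< u<n)) (loopless (fromℕ< u<n))))) λ ()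
    ; count      = trans (sym (count-tabulate n (Vec.lookup terminals) (terminalBit w n) (sym ∘ encode-terminal)))
                   (trans (cong ∣_∣ (Vec.tabulate∘lookup terminals)) ∣terminals∣)
    }

-- The unary prefix ends at the first false.
encodes-order : ∀ {k k′ x n n′} → Encodes k x n → Encodes k′ x n′ → n ≡ n′
encodes-order {n = n} {n′} E E′ with ℕ.<-cmp n n′
... | tri< n<n′ _ _ = contradiction (Encodes.ones E′ n n<n′) (Encodes.stop E)
... | tri≈ _ e _    = e
... | tri> _ _ n′<n = contradiction (Encodes.ones E n′ n′<n) (Encodes.stop E′)

module _ {k x n} (E : Encodes k x n) where
  open Encodes E

  decoded : TerminalDigraph k
  decoded = record
    { digraph     = record
      { order    = n
      ; arc      = λ u v → arcBit x n (toℕ u) (toℕ v)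
      ; loopless = λ u → notTrue (loopfree (toℕ u) (Fin.toℕ<n u)) }
    ; terminals   = Vec.tabulate (λ u → terminalBit x n (toℕ u))
    ; ∣terminals∣ = trans (count-tabulate n _ (terminalBit x n) (λ _ → refl)) count }

  -- Membership in the language asks for an instance with exactly this code. Hence a word that
  -- passes the test has to be recovered bit by bit: header, separator, matrix and terminal vector.
  encode-decoded : encodeTerminalDigraph decoded ≡ x
  encode-decoded = nth-extensional _ x (trans (Encodes.fullLength E′) (sym fullLength)) λ {i} i< → same i (ℕ.≤-trans i< (ℕ.≤-reflexive (Encodes.fullLength E′)))
    where
    w = encodeTerminalDigraph decoded
    E′ = encode-encodes decoded
    agree : ∀ {b c : Bool} → ¬ b ≡ true → ¬ c ≡ true → b ≡ c
    agree {false} {false} _ _ = refl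
    agree {true}  p _ = contradiction refl p
    agree {false} {true} _ q = contradiction refl q
    below : ∀ {i} (i<n : i < n) → toℕ (fromℕ< i<n) ≡ i
    below i<n = Fin.toℕ-fromℕ< i<n
    same : ∀ i → i < n + suc (n * n + n) → bitAt w i ≡ bitAt x i
    same i i< with ℕ.<-cmp i n
    ... | tri< i<n _ _ = trans (Encodes.ones E′ i i<n) (sym (ones i i<n))
    ... | tri≈ _ refl _ = agree (Encodes.stop E′) stop
    ... | tri> _ _ n<i with <⇒gap n<i
    ...   | j , refl with j ℕ.<? n * n
    ...     | yes j< with pairing-surjective n j<
    ...       | u , v , u< , v< , refl = subst₂ (λ u v → arcBit w n u v ≡ arcBit x n u v) (below u<) (below v<)
                  (encode-arc decoded (fromℕ< u<) (fromℕ< v<))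
    same i i< | tri> _ _ n<i | j , refl | no j≮ with ℕ.m≤n⇒∃[o]m+o≡n (ℕ.≮⇒≥ j≮)
    ... | u , refl = subst (λ u → terminalBit w n u ≡ terminalBit x n u) (below u<)
                  (trans (encode-terminal decoded (fromℕ< u<)) (Vec.lookup∘tabulate _ (fromℕ< u<)))
      where
      u< : u < n
      u< = ℕ.+-cancelˡ-< (n * n) u n (s≤s⁻¹ (ℕ.+-cancelˡ-< n _ _ i<))

-- Packings as closed walks

∈-tabulate⁺ : ∀ {n} {f : Fin n → Bool} {u} → f u ≡ true → u ∈ₛ Vec.tabulate f
∈-tabulate⁺ {f = f} {u} e = Vec.lookup⇒[]= u _ (trans (Vec.lookup∘tabulate f u) e)

∈-tabulate⁻ : ∀ {n} {f : Fin n → Bool} {u} → u ∈ₛ Vec.tabulate f → f u ≡ true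
∈-tabulate⁻ {f = f} {u} u∈ = trans (sym (Vec.lookup∘tabulate f u)) (Vec.[]=⇒lookup u∈)

T⇒true : ∀ {b} → T b → b ≡ true
T⇒true {true} _ = refl

true⇒T : ∀ {b} → b ≡ true → T b
true⇒T refl = tt

module _ (D : Digraph) where
  open Digraph D

  -- at i visits the vertices of the i-th member in cyclic order, and may pause.
  record Tours (S : Subset order) (m L : ℕ) : Set where
    field
      at       : Fin m → ℕ → Vertex
      moves    : ∀ i {j} → j < L → at i j ≡ at i (suc j) ⊎ T (arc (at i j) (at i (suc j)))
      closed   : ∀ i → at i 0 ≡ at i L
      covers   : ∀ i {u} → u ∈ₛ S → ∃[ j ] (j ≤ L × at i j ≡ u)
      -- Two tours may pause together at a shared vertex; a common step that moves would be a common
      -- arc.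
      separate : ∀ {i i′} → i ≢ i′ → ∀ {j j′} → j < L → j′ < L →
                 at i j ≡ at i′ j′ → at i (suc j) ≡ at i′ (suc j′) → at i j ≡ at i (suc j)

  module _ {S m L} (W : Tours S m L) where
    open Tours W

    private
      Visits : Fin m → Vertex → Set
      Visits i u = ∃[ j ] (j < suc L × at i j ≡ u)

      visits? : ∀ i u → Dec (Visits i u)
      visits? i u = ℕ.anyUpTo? (λ j → at i j Fin.≟ u) (suc L)

      Uses : Fin m → Vertex → Vertex → Set
      Uses i u v = ∃[ j ] (j < L × at i j ≡ u × at i (suc j) ≡ v × u ≢ v)

      uses? : ∀ i u v → Dec (Uses i u v)
      uses? i u v = ℕ.anyUpTo? (λ j → (at i j Fin.≟ u) ×-dec (at i (suc j) Fin.≟ v) ×-dec ¬? (u Fin.≟ v)) L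

    tourGraph : Fin m → Subgraph D
    tourGraph i = record
      { vertices = Vec.tabulate (λ u → ⌊ visits? i u ⌋)
      ; arcs     = λ u v → ⌊ uses? i u v ⌋
      ; arcs⊆    = λ t → arcs⊆′ (toWitness t)
      ; tail∈    = λ t → let (j , j< , e , _) = toWitness t in ∈-tabulate⁺ (T⇒true (fromWitness (j , ℕ.m<n⇒m<1+n j< , e)))
      ; head∈    = λ t → let (j , j< , _ , e , _) = toWitness t in ∈-tabulate⁺ (T⇒true (fromWitness (suc j , s≤s j< , e)))
      }
      where
      arcs⊆′ : ∀ {u v} → Uses i u v → T (arc u v)
      arcs⊆′ (j , j< , refl , refl , ne) with moves i j<
      ... | inj₁ e = contradiction e ne
      ... | inj₂ t = t

    tours⇒packing : Packing D S m
    tours⇒packing = record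
      { member   = tourGraph
      ; strong   = λ i u∈ v∈ → strong′ i (toWitness (true⇒T (∈-tabulate⁻ u∈))) (toWitness (true⇒T (∈-tabulate⁻ v∈)))
      ; contains = λ i u∈ → let (j , j≤ , e) = covers i u∈ in ∈-tabulate⁺ (T⇒true (fromWitness (j , s≤s j≤ , e)))
      ; disjoint = λ i≢ u v (s , t) → disjoint′ i≢ (toWitness s) (toWitness t)
      }
      where
      module _ (i : Fin m) where
        open Subgraph (tourGraph i) using (Reaches)

        along : ∀ {j} d → j + d ≤ L → Reaches (at i j) (at i (j + d))
        along {j} zero    _  = subst (λ x → Reaches (at i j) (at i x)) (sym (ℕ.+-identityʳ j)) ε
        along {j} (suc d) le with at i j Fin.≟ at i (suc j)
        ... | yes e = subst (λ x → Reaches x (at i (j + suc d))) (sym e)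
                        (subst (λ x → Reaches (at i (suc j)) (at i x)) (sym (ℕ.+-suc j d)) (along d (subst (_≤ L) (ℕ.+-suc j d) le)))
        ... | no ne = fromWitness (j , ℕ.≤-trans (s≤s (ℕ.m≤m+n j d)) (subst (_≤ L) (ℕ.+-suc j d) le) , refl , refl , ne) ◅
                        subst (λ x → Reaches (at i (suc j)) (at i x)) (sym (ℕ.+-suc j d)) (along d (subst (_≤ L) (ℕ.+-suc j d) le))

        toEnd : ∀ {j} → j ≤ L → Reaches (at i j) (at i L)
        toEnd {j} j≤ with ℕ.m≤n⇒∃[o]m+o≡n j≤
        ... | d , e = subst (λ x → Reaches (at i j) (at i x)) e (along d (ℕ.≤-reflexive e))

        strong′ : ∀ {u v} → Visits i u → Visits i v → Reaches u v
        strong′ (j , j< , refl) (j′ , j′< , refl) =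
          toEnd (s≤s⁻¹ j<) ◅◅ subst (λ x → Reaches x (at i j′)) (closed i) (along j′ (s≤s⁻¹ j′<))

      disjoint′ : ∀ {i i′} → i ≢ i′ → ∀ {u v} → Uses i u v → Uses i′ u v → ⊥
      disjoint′ i≢ (j , j< , e₁ , e₂ , ne) (j′ , j′< , e₃ , e₄ , _) =
        ne (trans (sym e₁) (trans (separate i≢ j< j′< (trans e₁ (sym e₃)) (trans e₂ (sym e₄))) e₂))

module _ {n : ℕ} (E : Fin n → Fin n → Set) where

  data Chain : Fin n → Fin n → List (Fin n) → Set where
    [_] : ∀ u → Chain u u (u ∷ [])
    _∷_ : ∀ {u v w vs} → E u v → Chain v w vs → Chain u w (u ∷ vs)

  -- The index is the duration, pauses included.
  data Walk : ℕ → Fin n → Fin n → Set where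
    done  : ∀ {u} → Walk 0 u u
    pause : ∀ {l u v} → Walk l u v → Walk (suc l) u v
    go    : ∀ {l u v w} → E u v → Walk l v w → Walk (suc l) u w

  private
    cutTo : ∀ {u v w vs} → u ∈ vs → Unique vs → Chain v w vs → ∃[ us ] (Chain u w us × Unique us)
    cutTo (here refl) U       (c@([ u ]))   = _ , c , U
    cutTo (here refl) U       (c@(_ ∷ _))   = _ , c , U
    cutTo (there u∈)  (_ ∷ U) (_ ∷ c)       = cutTo u∈ U c

  -- If the new first vertex already lies on the chain, the chain is cut down to start at that
  -- occurrence. Without repetitions its length is at most `n`.
  simple : ∀ {u v} → Star E u v → ∃[ vs ] (Chain u v vs × Unique vs)
  simple {u} ε = u ∷ [] , [ u ] , [] ∷ []
  simple {u} (e ◅ s) with simple s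
  ... | vs , c , U with Any.any? (u Fin.≟_) vs
  ...   | yes u∈ = cutTo u∈ U c
  ...   | no u∉  = u ∷ vs , e ∷ c , All.tabulate (λ { x∈ refl → u∉ x∈ }) ∷ U

  unique-length : ∀ {vs : List (Fin n)} → Unique vs → length vs ≤ n
  unique-length {vs} U = Fin.injective⇒≤ {f = List.lookup vs} (lookup-injective U)
    where
    lookup-injective : ∀ {vs : List (Fin n)} → Unique vs → ∀ {i j} → List.lookup vs i ≡ List.lookup vs j → i ≡ j
    lookup-injective (_ ∷ _)  {zero}  {zero}  _ = refl
    lookup-injective (ne ∷ _) {zero}  {suc j} e = contradiction e (All.lookup ne (∈-lookup j))
    lookup-injective (ne ∷ _) {suc i} {zero}  e = contradiction (sym e) (All.lookup ne (∈-lookup i))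
    lookup-injective (_ ∷ U)  {suc i} {suc j} e = cong suc (lookup-injective U e)

  pauses : ∀ d {l u v} → Walk l u v → Walk (d + l) u v
  pauses zero    w = w
  pauses (suc d) w = pause (pauses d w)

  -- A simple chain of `m` vertices has fewer than `m` arcs and becomes a walk of duration `m` by a
  -- final pause. Further pauses bring every walk to the same duration `n`, so certificates have a
  -- fixed format.
  walkOf : ∀ {u v} → Star E u v → Walk n u v
  walkOf {u} {v} s with simple s
  ... | vs , c , U = fill c (unique-length U)
    where
    chainWalk : ∀ {u v vs} → Chain u v vs → Walk (length vs) u v
    chainWalk [ u ]   = pause done
    chainWalk (e ∷ c) = go e (chainWalk c)
    fill : ∀ {vs} → Chain u v vs → length vs ≤ n → Walk n u v
    fill {vs} c le = subst (λ l → Walk l u v) (ℕ.m∸n+n≡m le) (pauses (n ∸ length vs) (chainWalk c))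

  joinWalks : ∀ {l l′ u v w} → Walk l u v → Walk l′ v w → Walk (l + l′) u w
  joinWalks done      q = q
  joinWalks (pause p) q = pause (joinWalks p q)
  joinWalks (go e p)  q = go e (joinWalks p q)

  at : ∀ {l u v} → Walk l u v → ℕ → Fin n
  at (done {u})          j       = u
  at {u = u} (pause w)   zero    = u
  at (pause w)           (suc j) = at w j
  at {u = u} (go e w)    zero    = u
  at (go e w)            (suc j) = at w j

  at-start : ∀ {l u v} (w : Walk l u v) → at w 0 ≡ u
  at-start done      = refl
  at-start (pause w) = refl
  at-start (go e w)  = refl

  at-end : ∀ {l u v} (w : Walk l u v) → at w l ≡ v
  at-end done      = refl
  at-end (pause w) = at-end w
  at-end (go e w)  = at-end w

  at-step : ∀ {l u v} (w : Walk l u v) {j} → j < l → at w j ≡ at w (suc j) ⊎ E (at w j) (at w (suc j))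
  at-step (pause w) {zero}  _        = inj₁ (sym (at-start w))
  at-step (pause w) {suc j} (s≤s j<) = at-step w j<
  at-step (go e w)  {zero}  _        = inj₂ (subst (E _) (sym (at-start w)) e)
  at-step (go e w)  {suc j} (s≤s j<) = at-step w j<

  Passes : ∀ {l u v} → Walk l u v → Fin n → Set
  Passes {l} w x = ∃[ j ] (j ≤ l × at w j ≡ x)

  passes-start : ∀ {l u v} (w : Walk l u v) → Passes w u
  passes-start w = 0 , z≤n , at-start w

  passesˡ : ∀ {l l′ u v w x} (p : Walk l u v) (q : Walk l′ v w) → Passes p x → Passes (joinWalks p q) x
  passesˡ done q (j , z≤n , e)               = 0 , z≤n , trans (at-start q) e
  passesˡ (pause p) q (zero , _ , e)         = 0 , z≤n , e
  passesˡ (go _ p)  q (zero , _ , e)         = 0 , z≤n , e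
  passesˡ (pause p) q (suc j , s≤s j≤ , e) with passesˡ p q (j , j≤ , e)
  ... | j′ , j′≤ , e′ = suc j′ , s≤s j′≤ , e′
  passesˡ (go _ p) q (suc j , s≤s j≤ , e) with passesˡ p q (j , j≤ , e)
  ... | j′ , j′≤ , e′ = suc j′ , s≤s j′≤ , e′

  passesʳ : ∀ {l l′ u v w x} (p : Walk l u v) (q : Walk l′ v w) → Passes q x → Passes (joinWalks p q) x
  passesʳ done q h = h
  passesʳ (pause p) q h with passesʳ p q h
  ... | j , j≤ , e = suc j , s≤s j≤ , e
  passesʳ (go _ p) q h with passesʳ p q h
  ... | j , j≤ , e = suc j , s≤s j≤ , e

  -- From a to b and back, for every b in bs that is mutually reachable with a.
  excursions : ∀ a (bs : List (Fin n)) → (∀ b → Dec (Star E a b × Star E b a)) →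
               Σ[ w ∈ Walk (length bs * (n + n)) a a ] (∀ {b} → b ∈ bs → Star E a b → Star E b a → Passes w b)
  excursions a []       reach? = done , λ ()
  excursions a (b ∷ bs) reach? with excursions a bs reach? | reach? b
  ... | w , h | yes (there′ , back) = joinWalks trip w , λ
      { (here refl) _ _ → passesˡ trip w (passesʳ (walkOf there′) (walkOf back) (passes-start (walkOf back)))
      ; (there b∈) p q  → passesʳ trip w (h b∈ p q) }
    where trip = joinWalks (walkOf there′) (walkOf back)
  ... | w , h | no ¬reach = joinWalks idle w , λ
      { (here refl) p q → contradiction (p , q) ¬reach
      ; (there b∈) p q  → passesʳ idle w (h b∈ p q) }
    where
    idle : Walk (n + n) a a
    idle = subst (λ l → Walk l a a) (ℕ.+-identityʳ (n + n)) (pauses (n + n) done)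

module _ {D : Digraph} {S : Subset (Digraph.order D)} {m} (P : Packing D S m) where
  open Digraph D
  open Packing P

  -- The tour of a member starts at the terminal `a` and makes one trip out and one back, of
  -- duration `order` each, for every vertex of the digraph; trips to vertices outside the member
  -- are spent waiting.
  packing⇒tours : ∀ {a} → a ∈ₛ S → Tours D S m (order * (order + order))
  packing⇒tours {a} a∈S = record
    { at       = λ i → at (Arc i) (walk i)
    ; moves    = λ i j< → Sum.map id (Subgraph.arcs⊆ (member i)) (at-step (Arc i) (walk i) j<)
    ; closed   = λ i → trans (at-start (Arc i) (walk i)) (sym (at-end (Arc i) (walk i)))
    ; covers   = λ i {u} u∈ → passes i (contains i u∈)
    ; separate = λ {i} {i′} i≢ {j} {j′} j< j′< e₁ e₂ → separate′ i≢ (at-step (Arc i) (walk i) j<) (at-step (Arc i′) (walk i′) j′<) e₁ e₂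
    }
    where
    Arc : Fin m → Vertex → Vertex → Set
    Arc i u v = T (Subgraph.arcs (member i) u v)
    -- In a strong member, mutual reachability with `a` amounts to being one of its vertices, which
    -- is decidable.
    reach? : ∀ i b → Dec (Star (Arc i) a b × Star (Arc i) b a)
    reach? i b with b ∈ₛ? Subgraph.vertices (member i)
    ... | yes b∈ = yes (strong i (contains i a∈S) b∈ , strong i b∈ (contains i a∈S))
    ... | no b∉  = no λ (s , _) → b∉ (stays s (contains i a∈S))
      where
      stays : ∀ {u v} → Star (Arc i) u v → u ∈ₛ Subgraph.vertices (member i) → v ∈ₛ Subgraph.vertices (member i)
      stays ε       u∈ = u∈
      stays (e ◅ s) u∈ = stays s (Subgraph.head∈ (member i) e)
    tour : ∀ i → Σ[ w ∈ Walk (Arc i) (length (List.allFin order) * (order + order)) a a ]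
                   (∀ {b} → b ∈ List.allFin order → Star (Arc i) a b → Star (Arc i) b a → Passes (Arc i) w b)
    tour i = excursions (Arc i) a (List.allFin order) (reach? i)
    walk : ∀ i → Walk (Arc i) (order * (order + order)) a a
    walk i = subst (λ l → Walk (Arc i) (l * (order + order)) a a) (List.length-tabulate {n = order} id) (proj₁ (tour i))
    passes : ∀ i {u} → u ∈ₛ Subgraph.vertices (member i) → Passes (Arc i) (walk i) u
    passes i {u} u∈ = transport (List.length-tabulate {n = order} id) (proj₁ (tour i))
      (proj₂ (tour i) (∈-allFin u) (strong i (contains i a∈S) u∈) (strong i u∈ (contains i a∈S)))
      where
      transport : ∀ {l l′} (e : l ≡ l′) (w : Walk (Arc i) (l * (order + order)) a a) → Passes (Arc i) w u →
                  Passes (Arc i) (subst (λ l → Walk (Arc i) (l * (order + order)) a a) e w) u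
      transport refl w p = p
    separate′ : ∀ {i i′} → i ≢ i′ → ∀ {u v u′ v′} → u ≡ v ⊎ Arc i u v → u′ ≡ v′ ⊎ Arc i′ u′ v′ → u ≡ u′ → v ≡ v′ → u ≡ v
    separate′ i≢ (inj₁ e) _        _    _    = e
    separate′ i≢ (inj₂ _) (inj₁ e) p    q    = trans p (trans e (sym q))
    separate′ i≢ (inj₂ s) (inj₂ t) refl refl = contradiction (s , t) (disjoint i≢ _ _)

-- Membership in NP

tourLength : ℕ → ℕ
tourLength n = n * (n + n)

-- Position j of tour i is the number of ones in its block of the certificate.
position : Word → ℕ → ℕ → ℕ → ℕ
position y n i j = sumTo n (λ v → boolVal (bitAt y ((i * (tourLength n + 1) + j) * n + v)))

private
  v₀ : ∀ {c} → Expr 2 (suc c)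
  v₀ = var zero

  v₁ : ∀ {c} → Expr 2 (suc (suc c))
  v₁ = var (suc zero)

  tourLengthE : ∀ {c} → Fin c → Expr 2 c
  tourLengthE n = var n ⊠ (var n ∔ var n)

  -- `j` is read inside the sum and therefore has one variable more than the result; callers pass it
  -- shifted by one.
  positionE : ∀ {c} → Fin c → Fin c → Expr 2 (suc c) → Expr 2 c
  positionE n i j = sumOf (var n)
    (bitOf (suc zero) ((var (suc i) ⊠ (tourLengthE (suc n) ∔ num 1) ∔ j) ⊠ var (suc n) ∔ v₀))

  adjacentF : ∀ {c} → Fin c → Expr 2 c → Expr 2 c → Form 2 c
  adjacentF n u v = bitF zero (var n ∔ (num 1 ∔ (u ⊠ var n ∔ v)))

  terminalE : ∀ {c} → Fin c → Expr 2 c → Expr 2 c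
  terminalE n u = var n ∔ (num 1 ∔ (var n ⊠ var n ∔ u))

  encodesF : ℕ → Form 2 3
  encodesF k =
    (∀ᶠ v₀ (bitF zero v₀)) ∧ᶠ
    (¬ᶠ bitF zero v₀) ∧ᶠ
    (v₁ ≐ v₀ ∔ (num 1 ∔ (v₀ ⊠ v₀ ∔ v₀))) ∧ᶠ
    (∀ᶠ v₀ (¬ᶠ adjacentF (suc zero) v₀ v₀)) ∧ᶠ
    (sumOf v₀ (bitOf zero (terminalE (suc zero) v₀)) ≐ num k)

  insideF movesF closedF coversF separateF : ℕ → Form 2 3
  insideF m = ∀ᶠ (num m) (∀ᶠ (tourLengthE (suc zero) ∔ num 1) (positionE (suc (suc zero)) (suc zero) v₁ ⋖ var (suc (suc zero))))
  movesF m = ∀ᶠ (num m) (∀ᶠ (tourLengthE (suc zero))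
    (positionE n i v₁ ≐ positionE n i (num 1 ∔ v₁) ∨ᶠ adjacentF n (positionE n i v₁) (positionE n i (num 1 ∔ v₁))))
    where
    n = suc (suc zero)
    i = suc zero
  closedF m = ∀ᶠ (num m) (positionE (suc zero) zero (num 0) ≐ positionE (suc zero) zero (tourLengthE (suc (suc zero))))
  coversF m = ∀ᶠ (num m) (∀ᶠ v₁ (bitF zero (terminalE (suc (suc zero)) v₀) ⇒ᶠ
    ∃ᶠ (tourLengthE (suc (suc zero)) ∔ num 1) (positionE (suc (suc (suc zero))) (suc (suc zero)) v₁ ≐ v₁)))
  separateF m = ∀ᶠ (num m) (∀ᶠ (num m) (∀ᶠ (tourLengthE (suc (suc zero))) (∀ᶠ (tourLengthE (suc (suc (suc zero))))
    (var i ≐ var i′ ∨ᶠ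
     positionE n i j ≐ positionE n i (num 1 ∔ j) ∨ᶠ
     (¬ᶠ (positionE n i j ≐ positionE n i′ j′ ∧ᶠ positionE n i (num 1 ∔ j) ≐ positionE n i′ (num 1 ∔ j′)))))))
    where
    n i i′ : Fin 7
    n  = suc (suc (suc (suc zero)))
    i  = suc (suc (suc zero))
    i′ = suc (suc zero)
    j j′ : Expr 2 8
    j  = var (suc (suc zero))
    j′ = v₁

-- The order is found by a search below the length of the input, which exceeds it in every valid
-- code.
verify : ℕ → ℕ → Form 2 2
verify k m = ∃ᶠ v₀ (encodesF k ∧ᶠ insideF m ∧ᶠ movesF m ∧ᶠ closedF m ∧ᶠ coversF m ∧ᶠ separateF m)

Accepts : ℕ → ℕ → Word → Word → Set
Accepts k m x y = Holds (verify k m) (x ∷ y ∷ []) (length x ∷ length y ∷ [])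

accepted : ℕ → ℕ → Word → Word → Bool
accepted k m x y = check (verify k m) (x ∷ y ∷ []) (length x ∷ length y ∷ [])

accepted⁺ : ∀ k m x y → Accepts k m x y → accepted k m x y ≡ true
accepted⁺ k m x y = check⁺ (verify k m) {x ∷ y ∷ []} {length x ∷ length y ∷ []}

accepted⁻ : ∀ k m x y → accepted k m x y ≡ true → Accepts k m x y
accepted⁻ k m x y = check⁻ (verify k m) {x ∷ y ∷ []} {length x ∷ length y ∷ []}

accepts⇒encodes : ∀ {k m x y} → Accepts k m x y → ∃[ n ] Encodes k x n
accepts⇒encodes (n , _ , (o , st , sz , lf , ct) , _) =
  n , record { ones = o ; stop = st ; fullLength = sz ; loopfree = lf ; count = ct }

∃-inside : ∀ {n} (p : Subset n) → 1 ≤ ∣ p ∣ → ∃[ u ] (u ∈ₛ p)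
∃-inside (true  ∷ p) h = zero , Vec.here
∃-inside (false ∷ p) h with ∃-inside p h
... | u , u∈ = suc u , Vec.there u∈

∃₂-inside : ∀ {n} (p : Subset n) → 2 ≤ ∣ p ∣ → ∃[ u ] ∃[ v ] (u ∈ₛ p × v ∈ₛ p × u ≢ v)
∃₂-inside (true  ∷ p) (s≤s h) with ∃-inside p h
... | v , v∈ = zero , suc v , Vec.here , Vec.there v∈ , λ ()
∃₂-inside (false ∷ p) h with ∃₂-inside p h
... | u , v , u∈ , v∈ , ne = suc u , suc v , Vec.there u∈ , Vec.there v∈ , ne ∘ Fin.suc-injective

sumTo-cong : ∀ n {g h} → (∀ {i} → i < n → g i ≡ h i) → sumTo n g ≡ sumTo n h
sumTo-cong zero    e = refl
sumTo-cong (suc n) e = cong₂ _+_ (sumTo-cong n (e ∘ ℕ.m<n⇒m<1+n)) (e ℕ.≤-refl)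

sumTo-below : ∀ {n a} → a ≤ n → sumTo n (λ v → boolVal (v <ᵇ a)) ≡ a
sumTo-below {zero}  z≤n = refl
sumTo-below {suc n} {zero}  z≤n     = trans (sumTo-front n _) (sumTo-below {n} z≤n)
sumTo-below {suc n} {suc a} (s≤s h) = trans (sumTo-front n _) (cong suc (sumTo-below h))

module _ {k : ℕ} (G : TerminalDigraph k) where
  open TerminalDigraph G
  private
    L = tourLength order

  accepts⇒tours : ∀ {a m y} → a ∈ₛ terminals → Accepts k m (encodeTerminalDigraph G) y → Tours digraph terminals m L
  accepts⇒tours {a} {m} {y} a∈ acc@(n , _ , _ , inside , moves , closed , covers , separate)
    with encodes-order (proj₂ (accepts⇒encodes {m = m} {y = y} acc)) (encode-encodes G)
  ... | refl = build order a refl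
    where
    -- The terminal `a` shows that the order is positive, so that positions can be clamped to
    -- vertices. For `j ≤ L` the formula `insideF` ensures that clamping changes nothing.
    build : ∀ n → Fin n → n ≡ order → Tours digraph terminals m L
    build (suc n′) _ e = record
      { at       = vertex
      ; moves    = λ i {j} j< → moves′ i j< (moves (toℕ i) (Fin.toℕ<n i) j j<)
      ; closed   = λ i → Fin.toℕ-injective (trans (value i z≤n) (trans (closed (toℕ i) (Fin.toℕ<n i)) (sym (value i ℕ.≤-refl))))
      ; covers   = λ i {u} u∈ → covers′ i (covers (toℕ i) (Fin.toℕ<n i) (toℕ u) (Fin.toℕ<n u)
                     (trans (encode-terminal G u) (Vec.[]=⇒lookup u∈)))
      ; separate = λ {i} {i′} i≢ {j} {j′} j< j′< e₁ e₂ → separate′ i≢ j< j′< e₁ e₂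
                     (separate (toℕ i) (Fin.toℕ<n i) (toℕ i′) (Fin.toℕ<n i′) j j< j′ j′<)
      }
      where
      vertex : Fin m → ℕ → Fin order
      vertex i j = subst Fin e (clamp n′ (position y order (toℕ i) j))
      toℕ-subst : ∀ {p q} (e : p ≡ q) (u : Fin p) → toℕ (subst Fin e u) ≡ toℕ u
      toℕ-subst refl u = refl
      value : ∀ i {j} → j ≤ L → toℕ (vertex i j) ≡ position y order (toℕ i) j
      value i {j} j≤ = trans (toℕ-subst e (clamp n′ _))
        (toℕ-clamp n′ (s≤s⁻¹ (ℕ.≤-trans (inside (toℕ i) (Fin.toℕ<n i) j (ℕ.≤-trans (s≤s j≤) (ℕ.≤-reflexive (sym (ℕ.+-comm L 1)))))
                                        (ℕ.≤-reflexive (sym e)))))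
      moves′ : ∀ i {j} → j < L → _ ⊎ _ → vertex i j ≡ vertex i (suc j) ⊎ T (arc (vertex i j) (vertex i (suc j)))
      moves′ i j< (inj₁ p) = inj₁ (Fin.toℕ-injective (trans (value i (ℕ.<⇒≤ j<)) (trans p (sym (value i j<)))))
      moves′ i j< (inj₂ p) = inj₂ (true⇒T (trans (sym (encode-arc G _ _))
        (trans (cong₂ (arcBit (encodeTerminalDigraph G) order) (value i (ℕ.<⇒≤ j<)) (value i j<)) p)))
      covers′ : ∀ i {u} → ∃[ j ] (j < L + 1 × position y order (toℕ i) j ≡ toℕ u) → ∃[ j ] (j ≤ L × vertex i j ≡ u)
      covers′ i (j , j< , p) = j , j≤ , Fin.toℕ-injective (trans (value i j≤) p)
        where
        j≤ : j ≤ L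
        j≤ = s≤s⁻¹ (ℕ.≤-trans j< (ℕ.≤-reflexive (ℕ.+-comm L 1)))
      separate′ : ∀ {i i′} → i ≢ i′ → ∀ {j j′} → j < L → j′ < L → vertex i j ≡ vertex i′ j′ → vertex i (suc j) ≡ vertex i′ (suc j′) →
                  toℕ i ≡ toℕ i′ ⊎ position y order (toℕ i) j ≡ position y order (toℕ i) (suc j) ⊎ ¬ (_ × _) →
                  vertex i j ≡ vertex i (suc j)
      separate′ i≢ j< j′< e₁ e₂ (inj₁ p) = contradiction (Fin.toℕ-injective p) i≢
      separate′ {i} i≢ j< j′< e₁ e₂ (inj₂ (inj₁ p)) = Fin.toℕ-injective (trans (value i (ℕ.<⇒≤ j<)) (trans p (sym (value i j<))))
      separate′ {i} {i′} i≢ j< j′< e₁ e₂ (inj₂ (inj₂ q)) = contradiction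
        ( trans (sym (value i (ℕ.<⇒≤ j<))) (trans (cong toℕ e₁) (value i′ (ℕ.<⇒≤ j′<)))
        , trans (sym (value i j<)) (trans (cong toℕ e₂) (value i′ j′<)) ) q

  certificateLength : ℕ → ℕ
  certificateLength m = m * ((L + 1) * order)

  module _ {m} (W : Tours digraph terminals m L) where
    open Tours W using (moves; closed; covers; separate) renaming (at to vertex)
    private
      block : Fin m → Fin (L + 1) → Word
      block i j = List.tabulate {n = order} (λ v → toℕ v <ᵇ toℕ (vertex i (toℕ j)))
      row : Fin m → Word
      row i = List.concat (List.tabulate (block i))
      length-row : ∀ i → length (row i) ≡ (L + 1) * order
      length-row i = length-rows {d = false} (L + 1) (block i) (λ j → List.length-tabulate _)

    -- Every block writes a vertex number in unary, padded to `order` bits, so that the blocks have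
    -- computable addresses.
    certificate : Word
    certificate = List.concat (List.tabulate row)

    length-certificate : length certificate ≡ certificateLength m
    length-certificate = length-rows {d = false} m row length-row

    position-certificate : ∀ i {j} → j ≤ L → position certificate order (toℕ i) j ≡ toℕ (vertex i j)
    position-certificate i {j} j≤ = trans (sumTo-cong order λ v< → cong boolVal (bits v<))
                                          (sumTo-below (ℕ.<⇒≤ (Fin.toℕ<n (vertex i j))))
      where
      j<L+1 : j < L + 1
      j<L+1 = ℕ.≤-trans (s≤s j≤) (ℕ.≤-reflexive (sym (ℕ.+-comm L 1)))
      j′ = fromℕ< j<L+1
      j≡ : toℕ j′ ≡ j
      j≡ = Fin.toℕ-fromℕ< j<L+1
      index : ∀ v → (toℕ i * (L + 1) + j) * order + v ≡ toℕ i * ((L + 1) * order) + (toℕ j′ * order + v)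
      index v = trans (cong (_+ v) (trans (ℕ.*-distribʳ-+ order (toℕ i * (L + 1)) j)
                                          (cong₂ _+_ (ℕ.*-assoc (toℕ i) (L + 1) order) (cong (_* order) (sym j≡)))))
                      (ℕ.+-assoc (toℕ i * ((L + 1) * order)) (toℕ j′ * order) v)
      bits : ∀ {v} → v < order → bitAt certificate ((toℕ i * (L + 1) + j) * order + v) ≡ (v <ᵇ toℕ (vertex i j))
      bits {v} v< = trans (cong (bitAt certificate) (index v))
        (trans (nth-rows m row length-row i (pairing-< (Fin.toℕ<n j′) v<))
        (trans (nth-rows (L + 1) (block i) (λ j → List.length-tabulate _) j′ v<)
        (trans (cong (bitAt (block i j′)) (sym (Fin.toℕ-fromℕ< v<)))
        (trans (nth-tabulate _ (fromℕ< v<))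
          (cong₂ (λ a b → a <ᵇ toℕ (vertex i b)) (Fin.toℕ-fromℕ< v<) j≡)))))

    tours⇒accepts : Accepts k m (encodeTerminalDigraph G) certificate
    tours⇒accepts = order , order< , (ones , stop , fullLength , loopfree , count) ,
      (λ i i< j j< → subst (_< order) (sym (value i< (below j<))) (Fin.toℕ<n _)) ,
      (λ i i< j j< → moves′ i< j< (moves (fromℕ< i<) j<)) ,
      (λ i i< → trans (value i< z≤n) (trans (cong toℕ (closed (fromℕ< i<))) (sym (value i< ℕ.≤-refl)))) ,
      (λ i i< u u< t → let (j , j≤ , e) = covers (fromℕ< i<) {fromℕ< u<} (Vec.lookup⇒[]= _ _ (trans (sym (encode-terminal G (fromℕ< u<)))
                             (trans (cong (terminalBit (encodeTerminalDigraph G) order) (Fin.toℕ-fromℕ< u<)) t)))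
        in j , ℕ.≤-trans (s≤s j≤) (ℕ.≤-reflexive (sym (ℕ.+-comm L 1))) , trans (value i< j≤) (trans (cong toℕ e) (Fin.toℕ-fromℕ< u<))) ,
      (λ i i< i′ i′< j j< j′ j′< → separate′ i< i′< j< j′<)
      where
      open Encodes (encode-encodes G)
      order< : order < length (encodeTerminalDigraph G)
      order< = ℕ.≤-trans (ℕ.≤-trans (s≤s (ℕ.m≤m+n order _)) (ℕ.≤-reflexive (sym (ℕ.+-suc order _)))) (ℕ.≤-reflexive (sym fullLength))
      below : ∀ {j} → j < L + 1 → j ≤ L
      below j< = s≤s⁻¹ (ℕ.≤-trans j< (ℕ.≤-reflexive (ℕ.+-comm L 1)))
      value : ∀ {i} (i< : i < m) {j} → j ≤ L → position certificate order i j ≡ toℕ (vertex (fromℕ< i<) j)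
      value i< {j} j≤ = trans (cong (λ i → position certificate order i j) (sym (Fin.toℕ-fromℕ< i<))) (position-certificate (fromℕ< i<) j≤)
      moves′ : ∀ {i} (i< : i < m) {j} → j < L → vertex (fromℕ< i<) j ≡ vertex (fromℕ< i<) (suc j) ⊎ T (arc (vertex (fromℕ< i<) j) (vertex (fromℕ< i<) (suc j))) →
               position certificate order i j ≡ position certificate order i (suc j) ⊎
               arcBit (encodeTerminalDigraph G) order (position certificate order i j) (position certificate order i (suc j)) ≡ true
      moves′ i< j< (inj₁ e) = inj₁ (trans (value i< (ℕ.<⇒≤ j<)) (trans (cong toℕ e) (sym (value i< j<))))
      moves′ i< j< (inj₂ t) = inj₂ (trans (cong₂ (arcBit (encodeTerminalDigraph G) order) (value i< (ℕ.<⇒≤ j<)) (value i< j<)) (trans (encode-arc G _ _) (T⇒true t)))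
      separate′ : ∀ {i i′} (i< : i < m) (i′< : i′ < m) {j j′} → j < L → j′ < L →
                  i ≡ i′ ⊎ position certificate order i j ≡ position certificate order i (suc j) ⊎
                  ¬ (position certificate order i j ≡ position certificate order i′ j′ ×
                     position certificate order i (suc j) ≡ position certificate order i′ (suc j′))
      separate′ {i} {i′} i< i′< {j} {j′} j< j′< with i ℕ.≟ i′ | position certificate order i j ℕ.≟ position certificate order i (suc j)
      ... | yes e | _     = inj₁ e
      ... | no _  | yes e = inj₂ (inj₁ e)
      ... | no ne | no ne′ = inj₂ (inj₂ λ (e₁ , e₂) → ne′ (trans (value i< (ℕ.<⇒≤ j<)) (trans (cong toℕ
          (separate (λ e → ne (trans (sym (Fin.toℕ-fromℕ< i<)) (trans (cong toℕ e) (Fin.toℕ-fromℕ< i′<)))) j< j′<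
            (Fin.toℕ-injective (trans (sym (value i< (ℕ.<⇒≤ j<))) (trans e₁ (value i′< (ℕ.<⇒≤ j′<)))))
            (Fin.toℕ-injective (trans (sym (value i< j<)) (trans e₂ (value i′< j′<))))))
          (sym (value i< j<)))))

allWords : ℕ → List Word
allWords zero    = [] ∷ []
allWords (suc n) = List.map (true ∷_) (allWords n) ++ List.map (false ∷_) (allWords n)

∈-allWords : ∀ w → w ∈ allWords (length w)
∈-allWords []          = here refl
∈-allWords (true ∷ w)  = ∈-++⁺ˡ (∈-map⁺ (true ∷_) (∈-allWords w))
∈-allWords (false ∷ w) = ∈-++⁺ʳ _ (∈-map⁺ (false ∷_) (∈-allWords w))

-- A downward search from the bound `B`: as long as `P B` fails, `B` can be lowered by one, and it
-- cannot drop below `l`.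
maximum : ∀ {P : ℕ → Set} → (∀ m → Dec (P m)) → ∀ {l} → P l → ∀ B → (∀ m → P m → m ≤ B) →
          ∃[ m ] (P m × (∀ m′ → P m′ → m′ ≤ m) × l ≤ m)
maximum P? {l} Pl B bound with P? B
... | yes PB = B , PB , bound , bound l Pl
maximum P? {l} Pl zero    bound | no ¬PB with bound l Pl
... | z≤n = contradiction Pl ¬PB
maximum P? {l} Pl (suc B) bound | no ¬PB = maximum P? Pl B
  λ m Pm → s≤s⁻¹ (ℕ.≤∧≢⇒< (bound m Pm) λ { refl → ¬PB Pm })

module _ {k : ℕ} (2≤k : 2 ≤ k) (G : TerminalDigraph k) where
  open TerminalDigraph G
  private
    twoTerminals : ∃[ a ] ∃[ b ] (a ∈ₛ terminals × b ∈ₛ terminals × a ≢ b)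
    twoTerminals = ∃₂-inside terminals (subst (2 ≤_) (sym ∣terminals∣) 2≤k)
    a = proj₁ twoTerminals
    a∈ = proj₁ (proj₂ (proj₂ twoTerminals))

  packing? : ∀ m → Dec (Packing digraph terminals m)
  packing? m with Any.any? (λ y → accepted k m (encodeTerminalDigraph G) y ≟ᵇ true) (allWords (certificateLength G m))
  ... | yes found = yes (tours⇒packing digraph (accepts⇒tours G {m = m} {y = proj₁ (Any.satisfied found)} a∈
                          (accepted⁻ k m (encodeTerminalDigraph G) (proj₁ (Any.satisfied found)) (proj₂ (Any.satisfied found)))))
  ... | no ¬found = no λ P → let W = packing⇒tours P a∈ in
      ¬found (Any-lose (subst (λ n → certificate G W ∈ allWords n) (length-certificate G W) (∈-allWords (certificate G W)))
                       (accepted⁺ k m (encodeTerminalDigraph G) (certificate G W) (tours⇒accepts G W)))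
    where
    Any-lose : ∀ {P : Word → Set} {w ws} → w ∈ ws → P w → Any P ws
    Any-lose (here refl) p = here p
    Any-lose (there w∈)  p = there (Any-lose w∈ p)

  -- Distinct members leave the terminal a along distinct arcs.
  packing-≤ : ∀ m → Packing digraph terminals m → m ≤ order
  packing-≤ m P = Fin.injective⇒≤ {f = λ i → proj₁ (exit i)} injective
    where
    open Packing P
    firstArc : ∀ {i u v} → Star (λ u v → T (Subgraph.arcs (member i) u v)) u v → u ≢ v → ∃[ w ] T (Subgraph.arcs (member i) u w)
    firstArc ε       ne = contradiction refl ne
    firstArc (e ◅ _) ne = _ , e
    exit : ∀ i → ∃[ w ] T (Subgraph.arcs (member i) a w)
    exit i with twoTerminals
    ... | a , b , a∈ , b∈ , a≢b = firstArc {i} (strong i (contains i a∈) (contains i b∈)) a≢b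
    injective : ∀ {i j} → proj₁ (exit i) ≡ proj₁ (exit j) → i ≡ j
    injective {i} {j} e with i Fin.≟ j
    ... | yes i≡j = i≡j
    ... | no i≢j  = contradiction (proj₂ (exit i) , subst (λ w → T (Subgraph.arcs (member j) a w)) (sym e) (proj₂ (exit j))) (disjoint i≢j _ _)

  packing⇒lambda≥ : ∀ {ℓ} → Packing digraph terminals ℓ → Lambda≥ digraph terminals ℓ
  packing⇒lambda≥ P with maximum packing? P order packing-≤
  ... | m , Pm , max , ℓ≤m = m , (Pm , max) , ℓ≤m

  lambda≥⇒packing : ∀ {ℓ} → Lambda≥ digraph terminals ℓ → Packing digraph terminals ℓ
  lambda≥⇒packing (m , (P , _) , ℓ≤m) = record
    { member   = λ i → member (Fin.inject≤ i ℓ≤m)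
    ; strong   = λ i → strong (Fin.inject≤ i ℓ≤m)
    ; contains = λ i → contains (Fin.inject≤ i ℓ≤m)
    ; disjoint = λ i≢j → disjoint (i≢j ∘ Fin.inject≤-injective _ _ _ _)
    }
    where open Packing P

  lambda≥⇒accepts : ∀ {ℓ} → Lambda≥ digraph terminals ℓ →
    ∃[ y ] (length y ≡ certificateLength G ℓ × Accepts k ℓ (encodeTerminalDigraph G) y)
  lambda≥⇒accepts Λ = certificate G W , length-certificate G W , tours⇒accepts G W
    where W = packing⇒tours (lambda≥⇒packing Λ) a∈

  accepts⇒lambda≥ : ∀ {ℓ y} → Accepts k ℓ (encodeTerminalDigraph G) y → Lambda≥ digraph terminals ℓ
  accepts⇒lambda≥ {ℓ} {y} acc = packing⇒lambda≥ (tours⇒packing digraph (accepts⇒tours G {m = ℓ} {y = y} a∈ acc))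

packing∈NP : ∀ {k ℓ} → 2 ≤ k → NP (DecisionProblem.language (StrongSubgraphPacking k ℓ))
packing∈NP {k} {ℓ} 2≤k =
  accepted k ℓ ,
  -- This is `certificateLength` with the order replaced by the length of the word, which is at
  -- least as large.
  con ℓ ⊗ ((X ⊗ (X ⊕ X) ⊕ con 1) ⊗ X) ,
  polyTime-outWord (emit (toExpr (verify k ℓ))) _ (λ { (x ∷ y ∷ []) → cong (_∷ []) (check-value (verify k ℓ) (x ∷ y ∷ []) (length x ∷ length y ∷ [])) }) ,
  λ x → mk⇔ (λ { (G , refl , Λ) → complete G Λ }) (λ (y , _ , e) → sound y (accepted⁻ k ℓ x y e))
  where
  complete : ∀ G → Lambda≥ (TerminalDigraph.digraph G) (TerminalDigraph.terminals G) ℓ → _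
  complete G Λ with lambda≥⇒accepts 2≤k G Λ
  ... | y , le , acc = y , ℕ.≤-trans (ℕ.≤-reflexive le) (ℕ.*-monoʳ-≤ ℓ (ℕ.*-mono-≤ (ℕ.+-monoˡ-≤ 1 (ℕ.*-mono-≤ n≤ (ℕ.+-mono-≤ n≤ n≤))) n≤)) ,
      accepted⁺ k ℓ (encodeTerminalDigraph G) y acc
    where
    n≤ : TerminalDigraph.order G ≤ length (encodeTerminalDigraph G)
    n≤ = ℕ.≤-trans (ℕ.m≤m+n _ _) (ℕ.≤-reflexive (sym (Encodes.fullLength (encode-encodes G))))
  sound : ∀ {x} y → Accepts k ℓ x y → DecisionProblem.language (StrongSubgraphPacking k ℓ) x
  sound {x} y acc with accepts⇒encodes {k} {ℓ} {x} {y} acc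
  ... | n , E = decoded E , encode-decoded E ,
    accepts⇒lambda≥ 2≤k (decoded E) {ℓ} {y} (subst (λ x → Accepts k ℓ x y) (sym (encode-decoded E)) acc)

-- The switch graph

lit : ℕ → Bool → ℕ
lit v b = v * 2 + boolVal b

lit-surjective : ∀ {V y} → y < V * 2 → ∃[ v ] ∃[ b ] (v < V × y ≡ lit v b)
lit-surjective {V} y< with pairing-surjective V y<
... | v , zero  , v< , _ , refl = v , false , v< , refl
... | v , suc zero , v< , _ , refl = v , true , v< , refl
... | v , suc (suc _) , _ , s≤s (s≤s ()) , _

lit-< : ∀ {V v} b → v < V → lit v b < V * 2
lit-< b v< = pairing-< v< (boolVal<2 b)
  where
  boolVal<2 : ∀ b → boolVal b < 2
  boolVal<2 b = s≤s (boolVal-≤ b)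

Satisfiable : ℕ → ℕ → (ℕ → ℕ → Set) → Set
Satisfiable V C Occ = Σ[ α ∈ (ℕ → Bool) ] (∀ c → c < C → ∃[ v ] (v < V × Occ (lit v (α v)) c))

-- A node κ j stands for an arc that all paths through it share.  Literal y and clause c meet in switch y * C + c;
-- its side false lies on the route of y, and its side true lies between Y c and Y (suc c).
data Kind : Set where
  core P Q X Y : Kind
  α ι o        : Bool → Kind

data Node : Set where
  term : ℕ → Node
  node : Kind → ℕ → Node

module Graph (k ℓ V C : ℕ) (Occ : ℕ → ℕ → Set) where

  J : ℕ
  J = V * 2 * C

  -- Three arcs between the terminals 0, 1 and the nodes `core` are withheld. Without `term 1` to
  -- `core 1`, B must leave terminal 1 through `Q 0`; without `core 0` to `term 1`, A must enter
  -- terminal 1 from `P 0`; without `core 1` to `term 0`, B must enter terminal 0 from `Y C`. The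
  -- chain `P` is entered at its upper end `J` and the chain `Q` at its lower end. Indices are fixed
  -- by equations among the arguments, so that the arcs at a node with a variable index can be
  -- analysed by cases.
  data Edge : Node → Node → Set where
    term→core : ∀ {i c} → i < k → c < ℓ → ¬ (i ≡ 1 × c ≡ 1) → Edge (term i) (node core c)
    core→term : ∀ {i c} → i < k → c < ℓ → ¬ (i ≡ 0 × c ≡ 1) → ¬ (i ≡ 1 × c ≡ 0) → Edge (node core c) (term i)
    core→P    : ∀ {c j} → c ≡ 0 → j ≡ J → Edge (node core c) (node P j)
    P→term    : ∀ {j i} → j ≡ 0 → i ≡ 1 → Edge (node P j) (term i)
    term→Q    : ∀ {i j} → i ≡ 1 → j ≡ 0 → Edge (term i) (node Q j)
    Q→core    : ∀ {j c} → j ≡ J → c ≡ 1 → Edge (node Q j) (node core c)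
    core→X    : ∀ {c v} → c ≡ 1 → v ≡ 0 → Edge (node core c) (node X v)
    Q→α       : ∀ {j} h → j < J → Edge (node Q j) (node (α h) j)
    α→P       : ∀ {j} h → j < J → Edge (node (α h) j) (node P j)
    α→ι       : ∀ {j h′} h → h′ ≡ not h → j < J → Edge (node (α h′) j) (node (ι h) j)
    ι→o       : ∀ {j} h → j < J → Edge (node (ι h) j) (node (o h) j)
    ι→Q       : ∀ {j} h → j < J → Edge (node (ι h) j) (node Q (suc j))
    P→o       : ∀ {j} h → j < J → Edge (node P (suc j)) (node (o h) j)
    o→α       : ∀ {j} h → j < J → Edge (node (o h) j) (node (α h) j)
    X→ι       : ∀ {v j} b → v < V → j ≡ lit v b * C → Edge (node X v) (node (ι false) j)
    o→ι       : ∀ {i j} y c → y < V * 2 → suc c < C → i ≡ y * C + c → j ≡ y * C + suc c →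
                Edge (node (o false) i) (node (ι false) j)
    o→X       : ∀ {v j} b → v < V → suc j ≡ lit v b * C + C → Edge (node (o false) j) (node X (suc v))
    X→Y       : ∀ {v c} → v ≡ V → c ≡ 0 → Edge (node X v) (node Y c)
    Y→ι       : ∀ {j} y c → y < V * 2 → c < C → Occ y c → j ≡ y * C + c → Edge (node Y c) (node (ι true) j)
    o→Y       : ∀ {j} y c → y < V * 2 → c < C → j ≡ y * C + c → Edge (node (o true) j) (node Y (suc c))
    Y→term    : ∀ {c i} → c ≡ C → i ≡ 0 → Edge (node Y c) (term i)

  Meets : (Kind → ℕ → Set) → Node → Set
  Meets Used (term _)   = ⊤
  Meets Used (node κ j) = Used κ j

  -- What is left of a packing of m strong subgraphs when only the nodes they use are recorded.
  record NodePacking (m : ℕ) : Set₁ where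
    field
      Uses : Fin m → Kind → ℕ → Set

      exclusive : ∀ {i i′ κ j} → Uses i κ j → Uses i′ κ j → i ≡ i′
      forward   : ∀ {i κ j} → Uses i κ j → ∃[ b ] (Edge (node κ j) b × Meets (Uses i) b)
      backward  : ∀ {i κ j} → Uses i κ j → ∃[ a ] (Edge a (node κ j) × Meets (Uses i) a)
      leaving   : ∀ i {t} → t < k → ∃[ b ] (Edge (term t) b × Meets (Uses i) b)
      entering  : ∀ i {t} → t < k → ∃[ a ] (Edge a (term t) × Meets (Uses i) a)

-- A missed value could be punched out, which would leave an injection into a smaller set.
injective⇒surjective : ∀ {n} (f : Fin n → Fin n) → (∀ {i j} → f i ≡ f j → i ≡ j) → ∀ c → ∃[ i ] (f i ≡ c)
injective⇒surjective {suc n} f inj c with Fin.any? (λ i → f i Fin.≟ c)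
... | yes found = found
... | no ¬found = contradiction (Fin.injective⇒≤ {f = λ i → Fin.punchOut (λ e → ¬found (i , sym e))}
                    (λ {x} {y} e → inj (Fin.punchOut-injective (λ q → ¬found (x , sym q)) (λ q → ¬found (y , sym q)) e))) ℕ.1+n≰n

module FromPacking (k′ ℓ′ V C : ℕ) (Occ : ℕ → ℕ → Set)
                   (𝓟 : Graph.NodePacking (2 + k′) (2 + ℓ′) V C Occ (2 + ℓ′)) (C≥1 : 1 ≤ C) where
  open Graph (2 + k′) (2 + ℓ′) V C Occ
  open NodePacking 𝓟

  private
    -- All arcs leaving terminal 0 lead to one of the ℓ nodes `core`, and each of these serves at
    -- most one subgraph. With ℓ subgraphs this is a bijection; A and B are the subgraphs owning the
    -- first two.
    chosenCore : ∀ i → ∃[ c ] Uses i core (toℕ {2 + ℓ′} c)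
    chosenCore i with leaving i {0} (s≤s z≤n)
    ... | _ , term→core _ c< _ , u = fromℕ< c< , subst (Uses i core) (sym (Fin.toℕ-fromℕ< c<)) u

    chosenCore-injective : ∀ {i j} → proj₁ (chosenCore i) ≡ proj₁ (chosenCore j) → i ≡ j
    chosenCore-injective {i} {j} e = exclusive (subst (Uses i core ∘ toℕ) e (proj₂ (chosenCore i))) (proj₂ (chosenCore j))

    owner : ∀ c → ∃[ i ] (proj₁ (chosenCore i) ≡ c)
    owner = injective⇒surjective (λ i → proj₁ (chosenCore i)) chosenCore-injective

    A B : Fin (2 + ℓ′)
    A = proj₁ (owner zero)
    B = proj₁ (owner (suc zero))

    -- Any other node `core` has an owner already, and by exclusivity this owner would be the same
    -- subgraph, whose chosen node is `c₀`.
    uses-only : ∀ {c₀ c} → c < 2 + ℓ′ → Uses (proj₁ (owner c₀)) core c → c ≡ toℕ c₀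
    uses-only {c₀} {c} c< u = trans (sym (Fin.toℕ-fromℕ< c<)) (cong toℕ (trans (sym (proj₂ (owner (fromℕ< c<))))
      (trans (cong (λ i → proj₁ (chosenCore i)) (exclusive
        (subst (Uses _ core) (trans (cong toℕ (proj₂ (owner (fromℕ< c<)))) (Fin.toℕ-fromℕ< c<)) (proj₂ (chosenCore (proj₁ (owner (fromℕ< c<))))))
        u)) (proj₂ (owner c₀)))))

    A≢B : A ≢ B
    A≢B e with trans (sym (proj₂ (owner zero))) (trans (cong (λ i → proj₁ (chosenCore i)) e) (proj₂ (owner (suc zero))))
    ... | ()

    conflict : ∀ {κ j} {W : Set} → Uses A κ j → Uses B κ j → W
    conflict p q = ⊥-elim (A≢B (exclusive p q))

    startQ : Uses B Q 0
    startQ with leaving B {1} (s≤s (s≤s z≤n))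
    ... | _ , term→core _ c< ne , u = contradiction (refl , uses-only c< u) ne
    ... | _ , term→Q _ refl , u = u

    startP : Uses A P 0
    startP with entering A {1} (s≤s (s≤s z≤n))
    ... | _ , core→term _ c< _ ne , u = contradiction (refl , uses-only c< u) ne
    ... | _ , P→term refl _ , u = u

    endY : Uses B Y C
    endY with entering B {0} (s≤s z≤n)
    ... | _ , core→term _ c< ne _ , u = contradiction (refl , uses-only c< u) ne
    ... | _ , Y→term refl _ , u = u

    -- The side h is left free by the two strands that cross the switch.
    record Crossed (j : ℕ) (h : Bool) : Set where
      field
        αA  : Uses A (α (not h)) j
        oA  : Uses A (o (not h)) j

    module _ {j} (j< : j < J) (p : Uses A P j) (q : Uses B Q j) where

      otherSide : ∀ {h h′} → Uses B (α h) j → Uses A (α h′) j → h′ ≡ not h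
      otherSide {false} {true}  _ _ = refl
      otherSide {true}  {false} _ _ = refl
      otherSide {false} {false} u u′ = conflict u′ u
      otherSide {true}  {true}  u u′ = conflict u′ u

      -- Since `j < J`, the arcs at the upper ends of the chains are out of reach. So B leaves `Q j`
      -- to some `α`, A arrives at `P j` from some `α`, and the two cannot be the same node.
      sides : ∃[ h ] (Uses B (α h) j × Uses A (α (not h)) j)
      sides with forward q
      ... | _ , Q→core refl _ , _ = ⊥-elim (ℕ.<-irrefl refl j<)
      ... | _ , Q→α h _ , u with backward p
      ...   | _ , core→P _ refl , _ = ⊥-elim (ℕ.<-irrefl refl j<)
      ...   | _ , α→P h′ _ , u′ = h , u , subst (λ h → Uses A (α h) j) (otherSide u u′) u′

      -- Each step excludes one of two neighbours. The `α` of A cannot be entered from `Q j`, which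
      -- is held by B, so A uses `o` on that side. The `α` of B cannot lead to `P j`, which is held
      -- by A, so B goes over to `ι` on A's side. From there `o` is taken by A, so B continues to
      -- `Q (suc j)`. Finally `o` of A cannot come from this `ι`, so A comes from `P (suc j)`.
      cross : (∃[ h ] Crossed j h) × Uses A P (suc j) × Uses B Q (suc j)
      cross with sides
      ... | h , αB , αA = (h , record { αA = αA ; oA = oA }) , P′ , Q′
        where
        oA : Uses A (o (not h)) j
        oA with backward αA
        ... | _ , Q→α _ _ , u = conflict u q
        ... | _ , o→α _ _ , u = u
        ιB : Uses B (ι (not h)) j
        ιB with forward αB
        ... | _ , α→P _ _ , u        = conflict p u
        ... | _ , α→ι h₂ refl _ , u = subst (λ h → Uses B (ι h) j) (sym (not-involutive h₂)) u
        Q′ : Uses B Q (suc j)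
        Q′ with forward ιB
        ... | _ , ι→o _ _ , u = conflict oA u
        ... | _ , ι→Q _ _ , u = u
        P′ : Uses A P (suc j)
        P′ with backward oA
        ... | _ , ι→o _ _ , u = conflict u ιB
        ... | _ , P→o _ _ , u = u

    chain : ∀ {j} → j ≤ J → Uses A P j × Uses B Q j
    chain {zero}  _  = startP , startQ
    chain {suc j} j< with chain (ℕ.<⇒≤ j<)
    ... | p , q = proj₂ (cross j< p q)

    crossed : ∀ {j} → j < J → ∃[ h ] Crossed j h
    crossed j< with chain (ℕ.<⇒≤ j<)
    ... | p , q = proj₁ (cross j< p q)

    freeSide : ∀ {j h h′} → Crossed j h → Uses B (o h′) j → h′ ≡ h
    freeSide {h = false} {false} _ _ = refl
    freeSide {h = true}  {true}  _ _ = refl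
    freeSide {h = false} {true}  K u = conflict (Crossed.oA K) u
    freeSide {h = true}  {false} K u = conflict (Crossed.oA K) u

    -- The other predecessor, `P (suc j)`, belongs to A.
    o⇒ι : ∀ {j h} → j < J → Uses B (o h) j → Uses B (ι h) j
    o⇒ι j< u with backward u
    ... | _ , ι→o _ _ , u′ = u′
    ... | _ , P→o _ _ , u′ = conflict (proj₁ (chain j<)) u′

    -- Behind a free side there is only the track.
    ¬α→ι : ∀ {j h} → j < J → Uses B (o h) j → ¬ Uses B (α (not h)) j
    ¬α→ι j< u u′ with crossed j<
    ... | h , K with freeSide K u
    ...   | refl = conflict (Crossed.αA K) u′

    j<J : ∀ {y c} → y < V * 2 → c < C → y * C + c < J
    j<J = pairing-<

    -- Traced backwards from `Y (suc c)`: B comes from the side true of some switch, and the `ι`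
    -- there can only have been entered from a node `Y`. Uniqueness of the address of the switch
    -- shows that this is `Y c` and that the literal occurs in `c`.
    clause : ∀ {c} → c < C → Uses B Y (suc c) →
             (∃[ y ] (y < V * 2 × Occ y c × Uses B (o true) (y * C + c))) × Uses B Y c
    clause {c} c< u with backward u
    ... | _ , o→Y y .c y< _ refl , u₁ with backward (o⇒ι (j<J y< c<) u₁)
    ...   | _ , α→ι _ refl _ , u₂ = ⊥-elim (¬α→ι (j<J y< c<) u₁ u₂)
    ...   | _ , Y→ι y′ c′ y′< c′< occ e , u₂ with pairing-injective y y′ c< c′< e
    ...     | refl , refl = (y , y< , occ , u₁) , u₂

    -- Also traced backwards: from the last switch of a literal, `back` descends to its first one,
    -- where B must have come from `X v`. The literals own disjoint blocks of `C` consecutive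
    -- switches, so the route cannot change to another literal on the way. A last switch exists
    -- because `C ≥ 1`.
    route : ∀ {v} → v < V → Uses B X (suc v) →
            (∃[ b ] (∀ c → c < C → Uses B (o false) (lit v b * C + c))) × Uses B X v
    route {v} v< u with backward u
    ... | _ , o→X {j = j} b _ e , u₁ = (b , all) , start
      where
      y = lit v b
      y< = lit-< {V} b v<
      last : ∃[ d ] (suc d ≡ C)
      last = C ∸ 1 , ℕ.m+[n∸m]≡n C≥1
      back : ∀ c → c < C → Uses B (o false) (y * C + c) →
             (∀ c′ → c′ ≤ c → Uses B (o false) (y * C + c′)) × Uses B X v
      back zero c< u with backward (o⇒ι (j<J y< c<) u)
      ... | _ , α→ι _ refl _ , u₂ = ⊥-elim (¬α→ι (j<J y< c<) u u₂)
      ... | _ , X→ι {v′} b′ v′< e′ , u₂ with pairing-injective (lit v b) (lit v′ b′) C≥1 C≥1 (trans e′ (sym (ℕ.+-identityʳ _)))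
      ...   | e″ , _ with pairing-injective v v′ (s≤s (boolVal-≤ b)) (s≤s (boolVal-≤ b′)) e″
      ...     | refl , _ = (λ { .zero z≤n → u }) , u₂
      back zero c< u | _ , o→ι y′ c′ y′< c′< _ e′ , u₂ with pairing-injective y y′ c< c′< e′
      ... | _ , ()
      back (suc c) c< u with backward (o⇒ι (j<J y< c<) u)
      ... | _ , α→ι _ refl _ , u₂ = ⊥-elim (¬α→ι (j<J y< c<) u u₂)
      ... | _ , X→ι {v′} b′ v′< e′ , u₂ with pairing-injective y (lit v′ b′) c< C≥1 (trans e′ (sym (ℕ.+-identityʳ _)))
      ...   | _ , ()
      back (suc c) c< u | _ , o→ι y′ c′ y′< c′< refl e′ , u₂ with pairing-injective y y′ c< c′< e′
      ... | refl , refl with back c (ℕ.<⇒≤ c<) u₂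
      ...   | below , x = (λ c″ le → upTo c″ le) , x
        where
        upTo : ∀ c″ → c″ ≤ suc c → Uses B (o false) (y * C + c″)
        upTo c″ le with ℕ.m≤n⇒m<n∨m≡n le
        ... | inj₁ lt   = below c″ (s≤s⁻¹ lt)
        ... | inj₂ refl = u
      whole : (∀ c → c < C → Uses B (o false) (y * C + c)) × Uses B X v
      whole with last
      ... | d , 1+d≡C with back d (ℕ.≤-reflexive 1+d≡C) (subst (Uses B (o false))
                             (ℕ.suc-injective (trans e (trans (cong (y * C +_) (sym 1+d≡C)) (ℕ.+-suc (y * C) d)))) u₁)
      ...   | upTo , x = (λ c c< → upTo c (s≤s⁻¹ (ℕ.≤-trans c< (ℕ.≤-reflexive (sym 1+d≡C))))) , x
      all = proj₁ whole
      start = proj₂ whole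

    -- Only the end `Y C` is known at first, and the tracing goes backwards; hence the induction on
    -- the distance `d` from the end.
    usesY : ∀ d {c} → c + d ≡ C → Uses B Y c
    usesY zero    {c} e = subst (Uses B Y) (sym (trans (sym (ℕ.+-identityʳ c)) e)) endY
    usesY (suc d) {c} e = proj₂ (clause (ℕ.m+n≤o⇒m≤o (suc c) (ℕ.≤-reflexive e′)) (usesY d e′))
      where
      e′ : suc c + d ≡ C
      e′ = trans (sym (ℕ.+-suc c d)) e

    usesX : ∀ d {v} → v + d ≡ V → Uses B X v
    usesX zero {v} e with backward (usesY C refl)
    ... | _ , X→Y refl _ , u = subst (Uses B X) (sym (trans (sym (ℕ.+-identityʳ v)) e)) u
    usesX (suc d) {v} e = proj₂ (route (ℕ.m+n≤o⇒m≤o (suc v) (ℕ.≤-reflexive e′)) (usesX d e′))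
      where
      e′ : suc v + d ≡ V
      e′ = trans (sym (ℕ.+-suc v d)) e

    routeOf : ∀ {v} → v < V → ∃[ b ] (∀ c → c < C → Uses B (o false) (lit v b * C + c))
    routeOf v< = proj₁ (route v< (usesX (V ∸ suc _) (ℕ.m+[n∸m]≡n v<)))

    clauseOf : ∀ {c} → c < C → ∃[ y ] (y < V * 2 × Occ y c × Uses B (o true) (y * C + c))
    clauseOf c< = proj₁ (clause c< (usesY (C ∸ suc _) (ℕ.m+[n∸m]≡n c<)))

    -- The route of B uses the sides false of a literal, so at these switches the side true is
    -- blocked and no clause can rely on that literal. The opposite literal is made true; numbers
    -- that are no variables get a default.
    assignment : ℕ → Bool
    assignment v with v ℕ.<? V
    ... | yes v< = not (proj₁ (routeOf v<))
    ... | no _   = false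

  satisfiable : Satisfiable V C Occ
  satisfiable = assignment , satisfied
    where
    satisfied : ∀ c → c < C → ∃[ v ] (v < V × Occ (lit v (assignment v)) c)
    satisfied c c< with clauseOf c<
    ... | y , y< , occ , u with lit-surjective {V} y<
    ...   | v , b , v< , refl = v , v< , subst (λ b → Occ (lit v b) c) agrees occ
      where
      agrees : b ≡ assignment v
      agrees with v ℕ.<? V
      ... | no v≮ = contradiction v< v≮
      ... | yes v<′ with routeOf v<′
      -- If the literal used for the clause were the one on the route, B would pass both sides of
      -- their common switch, but only one side is free.
      ...   | b′ , r = opposite b b′ λ { refl → clash (r c c<) }
        where
        opposite : ∀ b b′ → b ≢ b′ → b ≡ not b′
        opposite false false ne = contradiction refl ne
        opposite false true  ne = refl
        opposite true  false ne = refl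
        opposite true  true  ne = contradiction refl ne
        clash : Uses B (o false) (lit v b * C + c) → ⊥
        clash u′ with crossed (j<J y< c<)
        ... | h , K with trans (freeSide K u′) (sym (freeSide K u))
        ...   | ()

-- Numbering the vertices

data Vtx : Set where
  terminal : ℕ → Vtx
  port     : Bool → Kind → ℕ → Vtx

-- A node enters at its port false and leaves at its port true.
tail head : Node → Vtx
tail (term t)   = terminal t
tail (node κ j) = port true κ j
head (term t)   = terminal t
head (node κ j) = port false κ j

kindCode : Kind → Fin 11
kindCode core      = # 0
kindCode P         = # 1
kindCode Q         = # 2
kindCode X         = # 3
kindCode Y         = # 4
kindCode (α false) = # 5
kindCode (α true)  = # 6
kindCode (ι false) = # 7
kindCode (ι true)  = # 8
kindCode (o false) = # 9
kindCode (o true)  = # 10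

allKinds : Vec Kind 11
allKinds = core ∷ P ∷ Q ∷ X ∷ Y ∷ α false ∷ α true ∷ ι false ∷ ι true ∷ o false ∷ o true ∷ []

lookup-kindCode : ∀ κ → Vec.lookup allKinds (kindCode κ) ≡ κ
lookup-kindCode core      = refl
lookup-kindCode P         = refl
lookup-kindCode Q         = refl
lookup-kindCode X         = refl
lookup-kindCode Y         = refl
lookup-kindCode (α false) = refl
lookup-kindCode (α true)  = refl
lookup-kindCode (ι false) = refl
lookup-kindCode (ι true)  = refl
lookup-kindCode (o false) = refl
lookup-kindCode (o true)  = refl

kindCode-lookup : ∀ s → kindCode (Vec.lookup allKinds s) ≡ s
kindCode-lookup = toWitness {a? = Fin.all? (λ s → kindCode (Vec.lookup allKinds s) Fin.≟ s)} tt

fromBool : Bool → Fin 2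
fromBool false = zero
fromBool true  = suc zero

toBool : Fin 2 → Bool
toBool zero       = false
toBool (suc zero) = true

module Layout (k I : ℕ) where

  -- Every index below `I` receives 22 vertices, two ports for each of the eleven kinds, whether or
  -- not such a node has neighbours. The common range makes the number of a vertex linear in its
  -- index, which keeps the drawing formula simple.
  N : ℕ
  N = k + I * 22

  code : Vtx → ℕ
  code (terminal t) = t
  code (port d κ j) = k + (j * 22 + (11 * toℕ (fromBool d) + toℕ (kindCode κ)))

  decodeKind : ℕ → Fin 2 × Fin 11 → Vtx
  decodeKind j (d , κ) = port (toBool d) (Vec.lookup allKinds κ) j

  decodePort : Fin I × Fin 22 → Vtx
  decodePort (j , s) = decodeKind (toℕ j) (Fin.remQuot {2} 11 s)

  decodeSum : Fin k ⊎ Fin (I * 22) → Vtx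
  decodeSum (inj₁ t) = terminal (toℕ t)
  decodeSum (inj₂ q) = decodePort (Fin.remQuot {I} 22 q)

  decode : Fin N → Vtx
  decode u = decodeSum (splitAt k u)

  data Valid : Vtx → Set where
    terminal : ∀ {t} → t < k → Valid (terminal t)
    port     : ∀ {d κ j} → j < I → Valid (port d κ j)

  place : ∀ {a} → Valid a → Fin N
  place (terminal t<)          = fromℕ< t< ↑ˡ (I * 22)
  place (port {d} {κ} {j} j<)  = k ↑ʳ Fin.combine (fromℕ< j<) (Fin.combine (fromBool d) (kindCode κ))

  toℕ-place : ∀ {a} (v : Valid a) → toℕ (place v) ≡ code a
  toℕ-place (terminal t<) = trans (Fin.toℕ-↑ˡ (fromℕ< t<) (I * 22)) (Fin.toℕ-fromℕ< t<)
  toℕ-place (port {d} {κ} {j} j<) = trans (Fin.toℕ-↑ʳ k _) (cong (k +_)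
    (trans (Fin.toℕ-combine (fromℕ< j<) (Fin.combine (fromBool d) (kindCode κ)))
      (cong₂ _+_ (trans (ℕ.*-comm 22 (toℕ (fromℕ< j<))) (cong (_* 22) (Fin.toℕ-fromℕ< j<))) (Fin.toℕ-combine (fromBool d) (kindCode κ)))))

  decode-place : ∀ {a} (v : Valid a) → decode (place v) ≡ a
  decode-place (terminal t<) =
    trans (cong decodeSum (Fin.splitAt-↑ˡ k (fromℕ< t<) (I * 22))) (cong terminal (Fin.toℕ-fromℕ< t<))
  decode-place (port {d} {κ} {j} j<) =
    trans (cong decodeSum (Fin.splitAt-↑ʳ k (I * 22) (Fin.combine (fromℕ< j<) (Fin.combine (fromBool d) (kindCode κ)))))
    (trans (cong decodePort (Fin.remQuot-combine {I} {22} (fromℕ< j<) (Fin.combine (fromBool d) (kindCode κ))))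
    (trans (cong (decodeKind (toℕ (fromℕ< j<))) (Fin.remQuot-combine {2} {11} (fromBool d) (kindCode κ)))
    (trans (cong (λ κ → port _ κ _) (lookup-kindCode κ)) (cong₂ (λ d j → port d κ j) (back d) (Fin.toℕ-fromℕ< j<)))))
    where
    back : ∀ d → toBool (fromBool d) ≡ d
    back false = refl
    back true  = refl

  Placed : Fin N → Set
  Placed u = Σ[ v ∈ Valid (decode u) ] place v ≡ u

  placed : ∀ u → Placed u
  placed u = subst Placed (Fin.join-splitAt k (I * 22) u) (fromSum (splitAt k u))
    where
    via : ∀ {a} (v : Valid a) → Placed (place v)
    via v = subst (λ a → Σ[ w ∈ Valid a ] place w ≡ place v) (sym (decode-place v)) (v , refl)
    fromSum : ∀ x → Placed (Fin.join k (I * 22) x)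
    fromSum (inj₁ t) = subst Placed (cong (_↑ˡ (I * 22)) (Fin.fromℕ<-toℕ t (Fin.toℕ<n t))) (via (terminal (Fin.toℕ<n t)))
    fromSum (inj₂ q) = subst (λ q → Placed (k ↑ʳ q)) (Fin.combine-remQuot {I} 22 q) (fromPair (Fin.remQuot {I} 22 q))
      where
      back : ∀ d → fromBool (toBool d) ≡ d
      back zero       = refl
      back (suc zero) = refl
      fromPair : ∀ ((j , s) : Fin I × Fin 22) → Placed (k ↑ʳ Fin.combine j s)
      fromPair (j , s) = subst (λ s → Placed (k ↑ʳ Fin.combine j s)) (Fin.combine-remQuot {2} 11 s) (fromPair′ (Fin.remQuot {2} 11 s))
        where
        fromPair′ : ∀ ((d , κ) : Fin 2 × Fin 11) → Placed (k ↑ʳ Fin.combine j (Fin.combine d κ))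
        fromPair′ (d , κ) = subst₂ (λ j s → Placed (k ↑ʳ Fin.combine j s)) (Fin.fromℕ<-toℕ j (Fin.toℕ<n j))
          (cong₂ Fin.combine (back d) (kindCode-lookup κ))
          (via (port {toBool d} {Vec.lookup allKinds κ} (Fin.toℕ<n j)))

  code-decode : ∀ u → code (decode u) ≡ toℕ u
  code-decode u with placed u
  ... | v , e = trans (sym (toℕ-place v)) (cong toℕ e)

  decode-injective : ∀ {u v} → decode u ≡ decode v → u ≡ v
  decode-injective {u} {v} e = Fin.toℕ-injective (trans (sym (code-decode u)) (trans (cong code e) (code-decode v)))

  -- The hypothesis excludes `terminal t` with `t` at least `k`, whose code could be that of a port.
  -- For ports the bound on the index follows from the code being below `N`.
  decode-code : ∀ {a} u → (∀ {t} → a ≡ terminal t → t < k) → code a ≡ toℕ u → decode u ≡ a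
  decode-code {a} u h e = trans (cong decode (Fin.toℕ-injective (trans (sym e) (sym (toℕ-place v))))) (decode-place v)
    where
    valid : ∀ a → (∀ {t} → a ≡ terminal t → t < k) → code a ≡ toℕ u → Valid a
    valid (terminal t) h e = terminal (h refl)
    valid (port d κ j) h e = port (ℕ.≰⇒> λ I≤j → ℕ.<-irrefl refl (ℕ.≤-trans (Fin.toℕ<n u)
      (ℕ.≤-trans (ℕ.+-monoʳ-≤ k (ℕ.≤-trans (ℕ.*-monoˡ-≤ 22 I≤j) (ℕ.m≤m+n (j * 22) _)))
                 (ℕ.≤-reflexive e))))
    v = valid a h e

module Realisation (k′ ℓ′ V C I : ℕ) (Occ : ℕ → ℕ → Set) where
  open Graph (2 + k′) (2 + ℓ′) V C Occ public
  open Layout (2 + k′) I public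

  k ℓ : ℕ
  k = 2 + k′
  ℓ = 2 + ℓ′

  data Arc (x y : Vtx) : Set where
    through : ∀ κ j → j < I → x ≡ port false κ j → y ≡ port true κ j → Arc x y
    along   : ∀ {a b} → Edge a b → x ≡ tail a → y ≡ head b → Arc x y

  edge-term : ∀ {a b} → Edge a b → (∀ {t} → a ≡ term t → t < k) × (∀ {t} → b ≡ term t → t < k)
  edge-term (term→core i< _ _)   = (λ { refl → i< }) , λ ()
  edge-term (core→term i< _ _ _) = (λ ()) , λ { refl → i< }
  edge-term (core→P _ _)         = (λ ()) , λ ()
  edge-term (P→term _ refl)      = (λ ()) , λ { refl → s≤s (s≤s z≤n) }
  edge-term (term→Q refl _)      = (λ { refl → s≤s (s≤s z≤n) }) , λ ()
  edge-term (Q→core _ _)         = (λ ()) , λ ()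
  edge-term (core→X _ _)         = (λ ()) , λ ()
  edge-term (Q→α _ _)            = (λ ()) , λ ()
  edge-term (α→P _ _)            = (λ ()) , λ ()
  edge-term (α→ι _ _ _)          = (λ ()) , λ ()
  edge-term (ι→o _ _)            = (λ ()) , λ ()
  edge-term (ι→Q _ _)            = (λ ()) , λ ()
  edge-term (P→o _ _)            = (λ ()) , λ ()
  edge-term (o→α _ _)            = (λ ()) , λ ()
  edge-term (X→ι _ _ _)          = (λ ()) , λ ()
  edge-term (o→ι _ _ _ _ _ _)    = (λ ()) , λ ()
  edge-term (o→X _ _ _)          = (λ ()) , λ ()
  edge-term (X→Y _ _)            = (λ ()) , λ ()
  edge-term (Y→ι _ _ _ _ _ _)    = (λ ()) , λ ()
  edge-term (o→Y _ _ _ _ _)      = (λ ()) , λ ()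
  edge-term (Y→term _ refl)      = (λ ()) , λ { refl → s≤s z≤n }

  tail-terminal : ∀ {a t} → terminal t ≡ tail a → a ≡ term t
  tail-terminal {term t} refl = refl

  head-terminal : ∀ {a t} → terminal t ≡ head a → a ≡ term t
  head-terminal {term t} refl = refl

  tail-port : ∀ {a κ j} → port true κ j ≡ tail a → a ≡ node κ j
  tail-port {node κ j} refl = refl

  head-port : ∀ {a κ j} → port false κ j ≡ head a → a ≡ node κ j
  head-port {node κ j} refl = refl

  ¬tail-false : ∀ {a κ j} → port false κ j ≢ tail a
  ¬tail-false {term t} ()
  ¬tail-false {node κ j} ()

  ¬head-true : ∀ {a κ j} → port true κ j ≢ head a
  ¬head-true {term t} ()
  ¬head-true {node κ j} ()

  arc-terminal : ∀ {x y} → Arc x y → (∀ {t} → x ≡ terminal t → t < k) × (∀ {t} → y ≡ terminal t → t < k)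
  arc-terminal (through κ j _ refl refl) = (λ ()) , λ ()
  arc-terminal (along e refl refl) =
    (λ p → proj₁ (edge-term e) (tail-terminal (sym p))) , (λ p → proj₂ (edge-term e) (head-terminal (sym p)))

  -- Arcs are compared through the numbers of their ends, as these are all that a bounded formula
  -- sees. `complete` is restricted to distinct ends because the formula drawing the graph rules out
  -- loops explicitly.
  record Realises (arc : Fin N → Fin N → Bool) : Set where
    field
      sound    : ∀ {u v} → T (arc u v) → ∃[ x ] ∃[ y ] (Arc x y × code x ≡ toℕ u × code y ≡ toℕ v)
      complete : ∀ {u v x y} → u ≢ v → Arc x y → code x ≡ toℕ u → code y ≡ toℕ v → T (arc u v)

    decoded-arc : ∀ {u v} → T (arc u v) → Arc (decode u) (decode v)
    decoded-arc {u} {v} t with sound t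
    ... | x , y , A , eu , ev = subst₂ Arc (sym (decode-code u (proj₁ (arc-terminal A)) eu)) (sym (decode-code v (proj₂ (arc-terminal A)) ev)) A

    encoded-arc : ∀ {u v} → u ≢ v → Arc (decode u) (decode v) → T (arc u v)
    encoded-arc {u} {v} ne A = complete ne A (code-decode u) (code-decode v)

  module ToNodes (arc : Fin N → Fin N → Bool) (loopless : ∀ v → arc v v ≡ false) (R : Realises arc)
                 {S : Subset N} (S-terminals : ∀ u → toℕ u < k → u ∈ₛ S) {m : ℕ} where
    open Realises R

    D : Digraph
    D = record { order = N ; arc = arc ; loopless = loopless }

    module _ (𝓟 : Packing D S m) where
      open Packing 𝓟

      private
        t₀ t₁ : Fin N
        t₀ = place (terminal {0} (s≤s z≤n))
        t₁ = place (terminal {1} (s≤s (s≤s z≤n)))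

        _∈[_] : Fin N → Fin m → Set
        u ∈[ i ] = u ∈ₛ Subgraph.vertices (member i)

        terminal∈ : ∀ i {t} (t< : t < k) → place (terminal t<) ∈[ i ]
        terminal∈ i t< = contains i (S-terminals _ (subst (_< k) (sym (toℕ-place (terminal t<))) t<))

        -- Every member contains the first two terminals, so each of its vertices has a different
        -- vertex to reach and to be reached from. The first and the last arc of such paths are all
        -- that is kept of strong connectivity.
        another : ∀ i u → ∃[ w ] (w ∈[ i ] × u ≢ w)
        another i u with u Fin.≟ t₀
        ... | no ne    = t₀ , terminal∈ i (s≤s z≤n) , ne
        ... | yes refl = t₁ , terminal∈ i (s≤s (s≤s z≤n)) , λ e → contradiction (trans (sym (decode-place (terminal {0} (s≤s z≤n))))
                           (trans (cong decode e) (decode-place (terminal {1} (s≤s (s≤s z≤n)))))) λ ()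

        outArc : ∀ {i u} → u ∈[ i ] → ∃[ w ] T (Subgraph.arcs (member i) u w)
        outArc {i} {u} u∈ with another i u
        ... | w , w∈ , ne = first (strong i u∈ w∈) ne
          where
          first : ∀ {u w} → Subgraph.Reaches (member i) u w → u ≢ w → ∃[ x ] T (Subgraph.arcs (member i) u x)
          first ε       ne = contradiction refl ne
          first (e ◅ _) ne = _ , e

        inArc : ∀ {i u} → u ∈[ i ] → ∃[ w ] T (Subgraph.arcs (member i) w u)
        inArc {i} {u} u∈ with another i u
        ... | w , w∈ , ne = last (strong i w∈ u∈) (ne ∘ sym)
          where
          last : ∀ {w u} → Subgraph.Reaches (member i) w u → w ≢ u → ∃[ x ] T (Subgraph.arcs (member i) x u)
          last ε ne = contradiction refl ne
          last {u = u′} (_◅_ {j = x} e s) ne with x Fin.≟ u′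
          ... | yes refl = _ , e
          ... | no x≢u   = last s x≢u

        -- Usage is read off the port true. The only arc into it comes from the port false, so a
        -- subgraph using the node owns that arc, and arc-disjointness makes nodes exclusive.
        Used : Fin m → Kind → ℕ → Set
        Used i κ j = ∃[ u ] (decode u ≡ port true κ j × u ∈[ i ])

        inn⇒used : ∀ {i u κ j} → decode u ≡ port false κ j → u ∈[ i ] → Used i κ j
        inn⇒used {i} {u} e u∈ with outArc u∈
        ... | w , t with subst (λ x → Arc x (decode w)) e (decoded-arc (Subgraph.arcs⊆ (member i) t))
        ...   | through κ j _ refl e′ = w , e′ , Subgraph.head∈ (member i) t
        ...   | along {a} _ e′ _     = ⊥-elim (¬tail-false {a} e′)

        used⇒inn : ∀ {i κ j} ((u , _) : Used i κ j) → ∃[ w ] (decode w ≡ port false κ j × T (Subgraph.arcs (member i) w u))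
        used⇒inn {i} (u , e , u∈) with inArc u∈
        ... | w , t with subst (Arc (decode w)) e (decoded-arc (Subgraph.arcs⊆ (member i) t))
        ...   | through κ j _ e′ refl = w , e′ , t
        ...   | along {b = b} _ _ e′  = ⊥-elim (¬head-true {b} e′)

        met : ∀ {i w} b → decode w ≡ head b → w ∈[ i ] → Meets (Used i) b
        met (term _)   _ _  = tt
        met (node _ _) e w∈ = inn⇒used e w∈

        met′ : ∀ {i w} a → decode w ≡ tail a → w ∈[ i ] → Meets (Used i) a
        met′ (term _)   _ _  = tt
        met′ (node _ _) e w∈ = _ , e , w∈

      nodePacking : NodePacking m
      nodePacking = record
        { Uses      = Used
        ; exclusive = exclusive′
        ; forward   = forward′
        ; backward  = backward′
        ; leaving   = leaving′
        ; entering  = entering′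
        }
        where
        exclusive′ : ∀ {i i′ κ j} → Used i κ j → Used i′ κ j → i ≡ i′
        exclusive′ {i} {i′} U U′ with i Fin.≟ i′ | used⇒inn U | used⇒inn U′
        ... | yes e | _ | _ = e
        ... | no ne | w , e , t | w′ , e′ , t′ = contradiction
          (t , subst₂ (λ w u → T (Subgraph.arcs (member i′) w u)) (decode-injective (trans e′ (sym e)))
                      (decode-injective (trans (proj₁ (proj₂ U′)) (sym (proj₁ (proj₂ U))))) t′)
          (disjoint ne _ _)
        forward′ : ∀ {i κ j} → Used i κ j → ∃[ b ] (Edge (node κ j) b × Meets (Used i) b)
        forward′ {i} (u , e , u∈) with outArc u∈
        ... | w , t with subst (λ x → Arc x (decode w)) e (decoded-arc (Subgraph.arcs⊆ (member i) t))
        ...   | along {a} {b} E e₁ e₂ = b , subst (λ a → Edge a b) (tail-port e₁) E , met b e₂ (Subgraph.head∈ (member i) t)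
        backward′ : ∀ {i κ j} → Used i κ j → ∃[ a ] (Edge a (node κ j) × Meets (Used i) a)
        backward′ {i} U with used⇒inn U
        ... | w , e , t with inArc (Subgraph.tail∈ (member i) t)
        ...   | x , t′ with subst (Arc (decode x)) e (decoded-arc (Subgraph.arcs⊆ (member i) t′))
        ...     | along {a} {b} E e₁ e₂ = a , subst (Edge a) (head-port e₂) E , met′ a e₁ (Subgraph.tail∈ (member i) t′)
        leaving′ : ∀ i {t} → t < k → ∃[ b ] (Edge (term t) b × Meets (Used i) b)
        leaving′ i t< with outArc (terminal∈ i t<)
        ... | w , t with subst (λ x → Arc x (decode w)) (decode-place (terminal t<)) (decoded-arc (Subgraph.arcs⊆ (member i) t))
        ...   | along {a} {b} E e₁ e₂ = b , subst (λ a → Edge a b) (tail-terminal e₁) E , met b e₂ (Subgraph.head∈ (member i) t)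
        entering′ : ∀ i {t} → t < k → ∃[ a ] (Edge a (term t) × Meets (Used i) a)
        entering′ i t< with inArc (terminal∈ i t<)
        ... | w , t with subst (Arc (decode w)) (decode-place (terminal t<)) (decoded-arc (Subgraph.arcs⊆ (member i) t))
        ...   | along {a} {b} E e₁ e₂ = a , subst (Edge a) (head-terminal e₂) E , met′ a e₁ (Subgraph.tail∈ (member i) t)

-- From a satisfying assignment to a packing

choose : ∀ {A : Set} → Bool → Bool → A → A → A
choose false false x y = x
choose false true  x y = y
choose true  false x y = y
choose true  true  x y = x

choose-same : ∀ {A : Set} h {x y : A} → choose h h x y ≡ x
choose-same false = refl
choose-same true  = refl

choose-not : ∀ {A : Set} h {x y : A} → choose (not h) h x y ≡ y
choose-not false = refl
choose-not true  = refl

same⊎not : ∀ h h′ → h ≡ h′ ⊎ h ≡ not h′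
same⊎not false false = inj₁ refl
same⊎not false true  = inj₂ refl
same⊎not true  false = inj₂ refl
same⊎not true  true  = inj₁ refl

when : ∀ {P A : Set} → Dec P → Maybe A → Maybe A
when (yes _) x = x
when (no _)  x = nothing

when⁺ : ∀ {P A : Set} (d : Dec P) {x : Maybe A} → P → when d x ≡ x
when⁺ (yes _) p = refl
when⁺ (no ¬p) p = contradiction p ¬p

when⁻ : ∀ {P A : Set} (d : Dec P) {x : Maybe A} {a} → when d x ≡ just a → P × x ≡ just a
when⁻ (yes p) e = p , e

module FromAssignment (k′ ℓ′ V C I : ℕ) (Occ : ℕ → ℕ → Set) (C≥1 : 1 ≤ C)
                      (σ : ℕ → Bool) (w : ℕ → ℕ)
                      (satisfied : ∀ c → c < C → w c < V × Occ (lit (w c) (σ (w c))) c)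
                      (J<I : V * 2 * C < I) (V<I : V < I) (C<I : C < I) (ℓ<I : 2 + ℓ′ < I) where
  open Realisation k′ ℓ′ V C I Occ

  private
    TrueSwitch Chosen : ℕ → Set
    TrueSwitch j = ∃[ v ] (v < V × ∃[ c ] (c < C × j ≡ lit v (σ v) * C + c))
    Chosen j = ∃[ c ] (c < C × j ≡ lit (w c) (σ (w c)) * C + c)

    trueSwitch? : ∀ j → Dec (TrueSwitch j)
    trueSwitch? j = ℕ.anyUpTo? (λ v → ℕ.anyUpTo? (λ c → j ℕ.≟ lit v (σ v) * C + c) C) V

    chosen? : ∀ j → Dec (Chosen j)
    chosen? j = ℕ.anyUpTo? (λ c → j ℕ.≟ lit (w c) (σ (w c)) * C + c) C

    -- Switches of true literals keep the side true free for the clauses, those of false literals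
    -- keep the side false free for the routes of the variables.
    free : ℕ → Bool
    free j = ⌊ trueSwitch? j ⌋

    free-true : ∀ {v c} → v < V → c < C → free (lit v (σ v) * C + c) ≡ true
    free-true v< c< = T⇒true (fromWitness (_ , v< , _ , c< , refl))

    free-false : ∀ {v c} → v < V → c < C → free (lit v (not (σ v)) * C + c) ≡ false
    free-false {v} {c} v< c< with trueSwitch? (lit v (not (σ v)) * C + c)
    ... | no _ = refl
    ... | yes (v′ , _ , c′ , c′< , e) with pairing-injective (lit v (not (σ v))) (lit v′ (σ v′)) c< c′< e
    ...   | e′ , _ with pairing-injective v v′ (s≤s (boolVal-≤ (not (σ v)))) (s≤s (boolVal-≤ (σ v′))) e′
    ...     | refl , e″ = contradiction e″ (differ (σ v))
      where
      differ : ∀ b → boolVal (not b) ≢ boolVal b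
      differ false ()
      differ true  ()

    switch-of : ∀ {j} → j < J → ∃[ v ] ∃[ c ] (v < V × c < C ×
      ((free j ≡ true × j ≡ lit v (σ v) * C + c) ⊎ (free j ≡ false × j ≡ lit v (not (σ v)) * C + c)))
    switch-of j< with pairing-surjective (V * 2) j<
    ... | y , c , y< , c< , refl with lit-surjective {V} y<
    ...   | v , b , v< , refl with same⊎not b (σ v)
    ...     | inj₁ refl = v , c , v< , c< , inj₁ (free-true v< c< , refl)
    ...     | inj₂ refl = v , c , v< , c< , inj₂ (free-false v< c< , refl)

    c₀ c₁ : Fin ℓ
    c₀ = zero
    c₁ = suc zero

    -- A free side false lies on the route of a false literal, so B passes all of them. A free side
    -- true is passed only if a clause has chosen it; otherwise its nodes `ι` and `o` belong to no
    -- subgraph.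
    track : Bool → ℕ → Maybe (Fin ℓ)
    track false j = just c₁
    track true  j = when (chosen? j) (just c₁)

    trackColour : ∀ {j} h {i} → track h j ≡ just i → i ≡ c₁
    trackColour false refl = refl
    trackColour {j} true t with when⁻ (chosen? j) t
    ... | _ , refl = refl

    coreColour : ∀ {c} → Dec (c < ℓ) → Maybe (Fin ℓ)
    coreColour (yes c<) = just (fromℕ< c<)
    coreColour (no _)   = nothing

    -- The packing is a partial colouring of the nodes, so disjointness at nodes is automatic. In a
    -- switch, the blocked side gives `α` and `o` to A and `ι` to B; on the free side `α` belongs to
    -- B, and `ι` and `o` lie on the track.
    colour : Kind → ℕ → Maybe (Fin ℓ)
    colour core  c = coreColour (c ℕ.<? ℓ)
    colour P     j = when (j ℕ.≤? J) (just c₀)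
    colour Q     j = when (j ℕ.≤? J) (just c₁)
    colour X     v = when (v ℕ.≤? V) (just c₁)
    colour Y     c = when (c ℕ.≤? C) (just c₁)
    colour (α h) j = when (j ℕ.<? J) (choose h (free j) (just c₁) (just c₀))
    colour (ι h) j = when (j ℕ.<? J) (choose h (free j) (track h j) (just c₁))
    colour (o h) j = when (j ℕ.<? J) (choose h (free j) (track h j) (just c₀))

    core-colour : ∀ i → colour core (toℕ i) ≡ just i
    core-colour i with toℕ i ℕ.<? ℓ
    ... | yes p = cong just (Fin.fromℕ<-toℕ i p)
    ... | no ¬p = contradiction (Fin.toℕ<n i) ¬p

    core-colour⁻ : ∀ {c i} → colour core c ≡ just i → c ≡ toℕ i
    core-colour⁻ {c} e with c ℕ.<? ℓ
    core-colour⁻ refl | yes p = sym (Fin.toℕ-fromℕ< p)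

    colour-range : ∀ κ {j i} → colour κ j ≡ just i → j < I
    colour-range core {i = i} e = ℕ.≤-trans (s≤s (ℕ.<⇒≤ (subst (_< ℓ) (sym (core-colour⁻ e)) (Fin.toℕ<n i)))) ℓ<I
    colour-range P {j} e = ℕ.≤-trans (s≤s (proj₁ (when⁻ (j ℕ.≤? J) e))) J<I
    colour-range Q {j} e = ℕ.≤-trans (s≤s (proj₁ (when⁻ (j ℕ.≤? J) e))) J<I
    colour-range X {j} e = ℕ.≤-trans (s≤s (proj₁ (when⁻ (j ℕ.≤? V) e))) V<I
    colour-range Y {j} e = ℕ.≤-trans (s≤s (proj₁ (when⁻ (j ℕ.≤? C) e))) C<I
    colour-range (α h) {j} e = ℕ.<-trans (proj₁ (when⁻ (j ℕ.<? J) e)) J<I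
    colour-range (ι h) {j} e = ℕ.<-trans (proj₁ (when⁻ (j ℕ.<? J) e)) J<I
    colour-range (o h) {j} e = ℕ.<-trans (proj₁ (when⁻ (j ℕ.<? J) e)) J<I

    In : Fin ℓ → Node → Set
    In i (term t)   = t < k
    In i (node κ j) = colour κ j ≡ just i

    Step : Fin ℓ → Node → Node → Set
    Step i a b = Edge a b × In i a × In i b

    Reach : Fin ℓ → Node → Node → Set
    Reach i = Star (Step i)

    P∈ : ∀ {j} → j ≤ J → In c₀ (node P j)
    P∈ = when⁺ (_ ℕ.≤? J)

    Q∈ : ∀ {j} → j ≤ J → In c₁ (node Q j)
    Q∈ = when⁺ (_ ℕ.≤? J)

    X∈ : ∀ {v} → v ≤ V → In c₁ (node X v)
    X∈ = when⁺ (_ ℕ.≤? V)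

    Y∈ : ∀ {c} → c ≤ C → In c₁ (node Y c)
    Y∈ = when⁺ (_ ℕ.≤? C)

    module _ {j} (j< : j < J) where

      α∈₁ : In c₁ (node (α (free j)) j)
      α∈₁ = trans (when⁺ (j ℕ.<? J) j<) (choose-same (free j))

      α∈₀ : In c₀ (node (α (not (free j))) j)
      α∈₀ = trans (when⁺ (j ℕ.<? J) j<) (choose-not (free j))

      ι∈₁ : In c₁ (node (ι (not (free j))) j)
      ι∈₁ = trans (when⁺ (j ℕ.<? J) j<) (choose-not (free j))

      o∈₀ : In c₀ (node (o (not (free j))) j)
      o∈₀ = trans (when⁺ (j ℕ.<? J) j<) (choose-not (free j))

      ι-track : ∀ {h} → free j ≡ h → track h j ≡ just c₁ → In c₁ (node (ι h) j)
      ι-track refl e = trans (when⁺ (j ℕ.<? J) j<) (trans (choose-same (free j)) e)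

      o-track : ∀ {h} → free j ≡ h → track h j ≡ just c₁ → In c₁ (node (o h) j)
      o-track refl e = trans (when⁺ (j ℕ.<? J) j<) (trans (choose-same (free j)) e)

    hub : Fin ℓ → Node
    hub i = node core (toℕ i)

    hub∈ : ∀ i → In i (hub i)
    hub∈ = core-colour

    -- Strong connectivity of a colour class is reduced to paths from and to one hub, its node
    -- `core`.
    Linked : Fin ℓ → Node → Set
    Linked i a = Reach i (hub i) a × Reach i a (hub i)

    via : ∀ {i a b} → Edge a b → In i a → In i b → Reach i a b
    via e p q = (e , p , q) ◅ ε

    -- Colour 0 runs down the chain of nodes P.
    strandA : ∀ {j} (j< : j < J) →
      Reach c₀ (node P (suc j)) (node (o (not (free j))) j) ×
      Reach c₀ (node (o (not (free j))) j) (node (α (not (free j))) j) ×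
      Reach c₀ (node (α (not (free j))) j) (node P j)
    strandA j< = via (P→o _ j<) (P∈ j<) (o∈₀ j<) , via (o→α _ j<) (o∈₀ j<) (α∈₀ j<) , via (α→P _ j<) (α∈₀ j<) (P∈ (ℕ.<⇒≤ j<))

    down : ∀ {j} → j < J → Reach c₀ (node P (suc j)) (node P j)
    down j< = let (a , b , c) = strandA j< in a ◅◅ b ◅◅ c

    P-from : ∀ d {j} → j + d ≡ J → Reach c₀ (hub c₀) (node P j)
    P-from zero    {j} e = via (core→P refl (trans (sym (ℕ.+-identityʳ j)) e)) (hub∈ c₀) (P∈ (ℕ.≤-reflexive (trans (sym (ℕ.+-identityʳ j)) e)))
    P-from (suc d) {j} e = P-from d e′ ◅◅ down (ℕ.m+n≤o⇒m≤o (suc j) (ℕ.≤-reflexive e′))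
      where
      e′ : suc j + d ≡ J
      e′ = trans (sym (ℕ.+-suc j d)) e

    t₁→hub₀ : Reach c₀ (term 1) (hub c₀)
    t₁→hub₀ = via (term→core (s≤s (s≤s z≤n)) (s≤s z≤n) λ ()) (s≤s (s≤s z≤n)) (hub∈ c₀)

    P-to : ∀ {j} → j ≤ J → Reach c₀ (node P j) (hub c₀)
    P-to {zero}  _  = via (P→term refl refl) (P∈ z≤n) (s≤s (s≤s z≤n)) ◅◅ t₁→hub₀
    P-to {suc j} j< = down j< ◅◅ P-to (ℕ.<⇒≤ j<)

    P-linked : ∀ {j} → j ≤ J → Linked c₀ (node P j)
    P-linked {j} j≤ = P-from (J ∸ j) (ℕ.m+[n∸m]≡n j≤) , P-to j≤

    oA-linked : ∀ {j} → j < J → Linked c₀ (node (o (not (free j))) j)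
    oA-linked j< = let (a , b , c) = strandA j< in
      proj₁ (P-linked j<) ◅◅ a , b ◅◅ c ◅◅ proj₂ (P-linked (ℕ.<⇒≤ j<))

    αA-linked : ∀ {j} → j < J → Linked c₀ (node (α (not (free j))) j)
    αA-linked j< = let (a , b , c) = strandA j< in
      proj₁ (P-linked j<) ◅◅ a ◅◅ b , c ◅◅ proj₂ (P-linked (ℕ.<⇒≤ j<))

    -- Colour 1 runs up the chain of nodes Q and then along the track.
    strandB : ∀ {j} (j< : j < J) →
      Reach c₁ (node Q j) (node (α (free j)) j) ×
      Reach c₁ (node (α (free j)) j) (node (ι (not (free j))) j) ×
      Reach c₁ (node (ι (not (free j))) j) (node Q (suc j))
    strandB {j} j< = via (Q→α _ j<) (Q∈ (ℕ.<⇒≤ j<)) (α∈₁ j<) ,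
      via (α→ι _ (sym (not-involutive (free j))) j<) (α∈₁ j<) (ι∈₁ j<) , via (ι→Q _ j<) (ι∈₁ j<) (Q∈ j<)

    up : ∀ {j} → j < J → Reach c₁ (node Q j) (node Q (suc j))
    up j< = let (a , b , c) = strandB j< in a ◅◅ b ◅◅ c

    hub₁→t₁ : Reach c₁ (hub c₁) (term 1)
    hub₁→t₁ = via (core→term (s≤s (s≤s z≤n)) (s≤s (s≤s z≤n)) (λ ()) λ ()) (hub∈ c₁) (s≤s (s≤s z≤n))

    t₁→Q : Reach c₁ (term 1) (node Q 0)
    t₁→Q = via (term→Q refl refl) (s≤s (s≤s z≤n)) (Q∈ z≤n)

    Q-from : ∀ {j} → j ≤ J → Reach c₁ (hub c₁) (node Q j)
    Q-from {zero}  _  = hub₁→t₁ ◅◅ t₁→Q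
    Q-from {suc j} j< = Q-from (ℕ.<⇒≤ j<) ◅◅ up j<

    Q-to : ∀ d {j} → j + d ≡ J → Reach c₁ (node Q j) (hub c₁)
    Q-to zero    {j} e = via (Q→core (trans (sym (ℕ.+-identityʳ j)) e) refl) (Q∈ (ℕ.≤-reflexive (trans (sym (ℕ.+-identityʳ j)) e))) (hub∈ c₁)
    Q-to (suc d) {j} e = up (ℕ.m+n≤o⇒m≤o (suc j) (ℕ.≤-reflexive e′)) ◅◅ Q-to d e′
      where
      e′ : suc j + d ≡ J
      e′ = trans (sym (ℕ.+-suc j d)) e

    Q-linked : ∀ {j} → j ≤ J → Linked c₁ (node Q j)
    Q-linked {j} j≤ = Q-from j≤ , Q-to (J ∸ j) (ℕ.m+[n∸m]≡n j≤)

    αB-linked : ∀ {j} → j < J → Linked c₁ (node (α (free j)) j)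
    αB-linked j< = let (a , b , c) = strandB j< in
      proj₁ (Q-linked (ℕ.<⇒≤ j<)) ◅◅ a , b ◅◅ c ◅◅ proj₂ (Q-linked j<)

    ιB-linked : ∀ {j} → j < J → Linked c₁ (node (ι (not (free j))) j)
    ιB-linked j< = let (a , b , c) = strandB j< in
      proj₁ (Q-linked (ℕ.<⇒≤ j<)) ◅◅ a ◅◅ b , c ◅◅ proj₂ (Q-linked j<)

    module Route {v} (v< : v < V) where
      y : ℕ
      y = lit v (not (σ v))

      y< : y < V * 2
      y< = lit-< (not (σ v)) v<

      in-range : ∀ {c} → c < C → y * C + c < J
      in-range = pairing-< y<

      ι∈ : ∀ {c} → c < C → In c₁ (node (ι false) (y * C + c))
      ι∈ c< = ι-track (in-range c<) (free-false v< c<) refl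

      o∈ : ∀ {c} → c < C → In c₁ (node (o false) (y * C + c))
      o∈ c< = o-track (in-range c<) (free-false v< c<) refl

      line : ∀ {c} → c < C → Reach c₁ (node (ι false) (y * C + c)) (node (o false) (y * C + c))
      line c< = via (ι→o _ (in-range c<)) (ι∈ c<) (o∈ c<)

      hop : ∀ {c} → suc c < C → Reach c₁ (node (o false) (y * C + c)) (node (ι false) (y * C + suc c))
      hop c< = via (o→ι y _ y< c< refl refl) (o∈ (ℕ.<⇒≤ c<)) (ι∈ c<)

      from-X : ∀ {c} → c < C → Reach c₁ (node X v) (node (ι false) (y * C + c))
      from-X {zero}  c< = via (X→ι (not (σ v)) v< (ℕ.+-identityʳ _)) (X∈ (ℕ.<⇒≤ v<)) (ι∈ c<)
      from-X {suc c} c< = from-X (ℕ.<⇒≤ c<) ◅◅ line (ℕ.<⇒≤ c<) ◅◅ hop c<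

      to-X : ∀ d {c} → suc c + d ≡ C → Reach c₁ (node (o false) (y * C + c)) (node X (suc v))
      to-X zero {c} e = via (o→X (not (σ v)) v< (trans (sym (ℕ.+-suc (y * C) c)) (cong (y * C +_) (trans (sym (ℕ.+-identityʳ (suc c))) e))))
                            (o∈ (ℕ.m+n≤o⇒m≤o (suc c) (ℕ.≤-reflexive e))) (X∈ v<)
      to-X (suc d) {c} e = hop c< ◅◅ line c< ◅◅ to-X d e′
        where
        e′ : suc (suc c) + d ≡ C
        e′ = trans (sym (ℕ.+-suc (suc c) d)) e
        c< : suc c < C
        c< = ℕ.m+n≤o⇒m≤o (suc (suc c)) (ℕ.≤-reflexive e′)

      onward : ∀ {c} → c < C → Reach c₁ (node (o false) (y * C + c)) (node X (suc v))
      onward {c} c< = to-X (C ∸ suc c) (ℕ.m+[n∸m]≡n c<)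

      pass : Reach c₁ (node X v) (node X (suc v))
      pass = from-X C≥1 ◅◅ line C≥1 ◅◅ onward C≥1

    module Visit {c} (c< : c < C) where
      v = w c
      v< = proj₁ (satisfied c c<)
      y = lit v (σ v)

      in-range : y * C + c < J
      in-range = pairing-< (lit-< (σ v) v<) c<

      on-track : track true (y * C + c) ≡ just c₁
      on-track = when⁺ (chosen? (y * C + c)) (c , c< , refl)

      ι∈ : In c₁ (node (ι true) (y * C + c))
      ι∈ = ι-track in-range (free-true v< c<) on-track

      o∈ : In c₁ (node (o true) (y * C + c))
      o∈ = o-track in-range (free-true v< c<) on-track

      enter : Reach c₁ (node Y c) (node (ι true) (y * C + c))
      enter = via (Y→ι y c (lit-< (σ v) v<) c< (proj₂ (satisfied c c<)) refl) (Y∈ (ℕ.<⇒≤ c<)) ι∈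

      line : Reach c₁ (node (ι true) (y * C + c)) (node (o true) (y * C + c))
      line = via (ι→o true in-range) ι∈ o∈

      exit : Reach c₁ (node (o true) (y * C + c)) (node Y (suc c))
      exit = via (o→Y y c (lit-< (σ v) v<) c< refl) o∈ (Y∈ c<)

    X-from : ∀ {v} → v ≤ V → Reach c₁ (hub c₁) (node X v)
    X-from {zero}  _  = via (core→X refl refl) (hub∈ c₁) (X∈ z≤n)
    X-from {suc v} v< = X-from (ℕ.<⇒≤ v<) ◅◅ Route.pass v<

    Y-from : ∀ {c} → c ≤ C → Reach c₁ (hub c₁) (node Y c)
    Y-from {zero}  _  = X-from ℕ.≤-refl ◅◅ via (X→Y refl refl) (X∈ ℕ.≤-refl) (Y∈ z≤n)
    Y-from {suc c} c< = Y-from (ℕ.<⇒≤ c<) ◅◅ Visit.enter c< ◅◅ Visit.line c< ◅◅ Visit.exit c<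

    hub₁→t₀ : Reach c₁ (hub c₁) (term 0)
    hub₁→t₀ = Y-from ℕ.≤-refl ◅◅ via (Y→term refl refl) (Y∈ ℕ.≤-refl) (s≤s z≤n)

    t₀→hub : ∀ i → Reach i (term 0) (hub i)
    t₀→hub i = via (term→core (s≤s z≤n) (Fin.toℕ<n i) λ ()) (s≤s z≤n) (hub∈ i)

    Y-to : ∀ d {c} → c + d ≡ C → Reach c₁ (node Y c) (hub c₁)
    Y-to zero {c} e = via (Y→term (trans (sym (ℕ.+-identityʳ c)) e) refl) (Y∈ (ℕ.≤-reflexive (trans (sym (ℕ.+-identityʳ c)) e))) (s≤s z≤n) ◅◅ t₀→hub c₁
    Y-to (suc d) {c} e = Visit.enter c< ◅◅ Visit.line c< ◅◅ Visit.exit c< ◅◅ Y-to d e′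
      where
      e′ : suc c + d ≡ C
      e′ = trans (sym (ℕ.+-suc c d)) e
      c< : c < C
      c< = ℕ.m+n≤o⇒m≤o (suc c) (ℕ.≤-reflexive e′)

    Y-linked : ∀ {c} → c ≤ C → Linked c₁ (node Y c)
    Y-linked {c} c≤ = Y-from c≤ , Y-to (C ∸ c) (ℕ.m+[n∸m]≡n c≤)

    X-to : ∀ d {v} → v + d ≡ V → Reach c₁ (node X v) (hub c₁)
    X-to zero {v} e = via (X→Y (trans (sym (ℕ.+-identityʳ v)) e) refl) (X∈ (ℕ.≤-reflexive (trans (sym (ℕ.+-identityʳ v)) e))) (Y∈ z≤n) ◅◅ Y-to C refl
    X-to (suc d) {v} e = Route.pass (ℕ.m+n≤o⇒m≤o (suc v) (ℕ.≤-reflexive e′)) ◅◅ X-to d e′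
      where
      e′ : suc v + d ≡ V
      e′ = trans (sym (ℕ.+-suc v d)) e

    X-linked : ∀ {v} → v ≤ V → Linked c₁ (node X v)
    X-linked {v} v≤ = X-from v≤ , X-to (V ∸ v) (ℕ.m+[n∸m]≡n v≤)

    ι-linked : ∀ {j} h → j < J → h ≡ free j → track h j ≡ just c₁ → Linked c₁ (node (ι h) j) × Linked c₁ (node (o h) j)
    ι-linked false j< e _ with switch-of j<
    ... | v , c , v< , c< , inj₁ (f , _) = contradiction (trans e f) λ ()
    ... | v , c , v< , c< , inj₂ (_ , refl) =
      (start , Route.line v< c< ◅◅ finish) , (start ◅◅ Route.line v< c< , finish)
      where
      start = proj₁ (X-linked (ℕ.<⇒≤ v<)) ◅◅ Route.from-X v< c<
      finish = Route.onward v< c< ◅◅ proj₂ (X-linked v<)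
    ι-linked {j} true j< e t with when⁻ (chosen? j) t
    ... | (c , c< , refl) , _ =
      (start , Visit.line c< ◅◅ finish) , (start ◅◅ Visit.line c< , finish)
      where
      start = proj₁ (Y-linked (ℕ.<⇒≤ c<)) ◅◅ Visit.enter c<
      finish = Visit.exit c< ◅◅ proj₂ (Y-linked c<)

    just-injective : ∀ {A : Set} {x y : A} → just x ≡ just y → x ≡ y
    just-injective refl = refl

    node-linked : ∀ κ {j i} → colour κ j ≡ just i → Linked i (node κ j)
    node-linked core {j} {i} e = subst (λ c → Linked i (node core c)) (sym (core-colour⁻ e)) (ε , ε)
    node-linked P {j} e with when⁻ (j ℕ.≤? J) e
    ... | j≤ , refl = P-linked j≤
    node-linked Q {j} e with when⁻ (j ℕ.≤? J) e
    ... | j≤ , refl = Q-linked j≤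
    node-linked X {j} e with when⁻ (j ℕ.≤? V) e
    ... | j≤ , refl = X-linked j≤
    node-linked Y {j} e with when⁻ (j ℕ.≤? C) e
    ... | j≤ , refl = Y-linked j≤
    node-linked (α h) {j} e with when⁻ (j ℕ.<? J) e | same⊎not h (free j)
    ... | j< , e′ | inj₁ refl with just-injective (trans (sym (choose-same (free j))) e′)
    ...   | refl = αB-linked j<
    node-linked (α h) {j} e | j< , e′ | inj₂ refl with just-injective (trans (sym (choose-not (free j))) e′)
    ...   | refl = αA-linked j<
    node-linked (ι h) {j} e with when⁻ (j ℕ.<? J) e | same⊎not h (free j)
    ... | j< , e′ | inj₁ refl with trackColour {j} (free j) (trans (sym (choose-same (free j))) e′)
    ...   | refl = proj₁ (ι-linked (free j) j< refl (trans (sym (choose-same (free j))) e′))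
    node-linked (ι h) {j} e | j< , e′ | inj₂ refl with just-injective (trans (sym (choose-not (free j))) e′)
    ...   | refl = ιB-linked j<
    node-linked (o h) {j} e with when⁻ (j ℕ.<? J) e | same⊎not h (free j)
    ... | j< , e′ | inj₁ refl with trackColour {j} (free j) (trans (sym (choose-same (free j))) e′)
    ...   | refl = proj₂ (ι-linked (free j) j< refl (trans (sym (choose-same (free j))) e′))
    node-linked (o h) {j} e | j< , e′ | inj₂ refl with just-injective (trans (sym (choose-not (free j))) e′)
    ...   | refl = oA-linked j<

    -- Only the three withheld arcs require a detour: A reaches terminal 1 down the chain `P`, B
    -- reaches terminal 0 at the end of the track, and B returns from terminal 1 up the chain `Q`.
    term-linked : ∀ i {t} → t < k → Linked i (term t)
    term-linked i {t} t< = from i t t< , to i t t<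
      where
      direct→ : ∀ i {t} → t < k → ¬ (t ≡ 0 × toℕ i ≡ 1) → ¬ (t ≡ 1 × toℕ i ≡ 0) → Reach i (hub i) (term t)
      direct→ i t< p q = via (core→term t< (Fin.toℕ<n i) p q) (hub∈ i) t<
      from : ∀ i t → t < k → Reach i (hub i) (term t)
      from zero          (suc zero)    t< = proj₁ (P-linked z≤n) ◅◅ via (P→term refl refl) (P∈ z≤n) t<
      from zero          zero          t< = direct→ zero t< (λ ()) λ ()
      from zero          (suc (suc t)) t< = direct→ zero t< (λ ()) λ ()
      from (suc zero)    zero          t< = hub₁→t₀
      from (suc zero)    (suc t)       t< = direct→ c₁ t< (λ ()) λ ()
      from (suc (suc i)) t             t< = direct→ (suc (suc i)) t< (λ ()) λ ()
      to : ∀ i t → t < k → Reach i (term t) (hub i)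
      to (suc zero) (suc zero) t< = t₁→Q ◅◅ proj₂ (Q-linked z≤n)
      to zero          t t< = via (term→core t< (s≤s z≤n) λ ()) t< (hub∈ zero)
      to (suc zero) zero t< = t₀→hub c₁
      to (suc zero) (suc (suc t)) t< = via (term→core t< (s≤s (s≤s z≤n)) λ ()) t< (hub∈ c₁)
      to (suc (suc i)) t t< = via (term→core t< (Fin.toℕ<n (suc (suc i))) λ ()) t< (hub∈ (suc (suc i)))

    linked : ∀ i a → In i a → Linked i a
    linked i (term t)   t< = term-linked i t<
    linked i (node κ j) e  = node-linked κ e

  module ToPacking (arc : Fin N → Fin N → Bool) (loopless : ∀ v → arc v v ≡ false) (R : Realises arc)
                   {S : Subset N} (terminals-S : ∀ u → u ∈ₛ S → toℕ u < k) where
    open Realises R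

    D : Digraph
    D = record { order = N ; arc = arc ; loopless = loopless }

    private
      Inside : Fin ℓ → Vtx → Set
      Inside i (terminal t) = t < k
      Inside i (port _ κ j) = colour κ j ≡ just i

      inside? : ∀ i x → Dec (Inside i x)
      inside? i (terminal t) = t ℕ.<? k
      inside? i (port _ κ j) = Maybe.≡-dec Fin._≟_ (colour κ j) (just i)

      inside-node : ∀ i a → In i a → Inside i (tail a) × Inside i (head a)
      inside-node i (term t)   p = p , p
      inside-node i (node κ j) p = p , p

      valid : ∀ i {x} → Inside i x → Valid x
      valid i {terminal t} t< = terminal t<
      valid i {port _ κ j} e  = port (colour-range κ e)

      member? : ∀ i (u : Fin N) → Dec (Inside i (decode u))
      member? i u = inside? i (decode u)

      arcIn? : ∀ i u v → Dec (T (arc u v) × Inside i (decode u) × Inside i (decode v))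
      arcIn? i u v = T? (arc u v) ×-dec member? i u ×-dec member? i v

      classVertices : Fin ℓ → Subset N
      classVertices i = Vec.tabulate (λ u → ⌊ member? i u ⌋)

      ∈-class⁺ : ∀ i {u} → Inside i (decode u) → u ∈ₛ classVertices i
      ∈-class⁺ i {u} p = ∈-tabulate⁺ {f = λ u → ⌊ member? i u ⌋} (T⇒true (fromWitness {a? = member? i u} p))

      ∈-class⁻ : ∀ i {u} → u ∈ₛ classVertices i → Inside i (decode u)
      ∈-class⁻ i {u} u∈ = toWitness {a? = member? i u} (true⇒T (∈-tabulate⁻ {f = λ u → ⌊ member? i u ⌋} u∈))

    colourClass : Fin ℓ → Subgraph D
    colourClass i = record
      { vertices = classVertices i
      ; arcs     = λ u v → ⌊ arcIn? i u v ⌋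
      ; arcs⊆    = λ {u} {v} t → proj₁ (toWitness {a? = arcIn? i u v} t)
      ; tail∈    = λ {u} {v} t → ∈-class⁺ i (proj₁ (proj₂ (toWitness {a? = arcIn? i u v} t)))
      ; head∈    = λ {u} {v} t → ∈-class⁺ i (proj₂ (proj₂ (toWitness {a? = arcIn? i u v} t)))
      }

    private
      module _ (i : Fin ℓ) where
        open Subgraph (colourClass i) using (Reaches)

        position′ : ∀ {x} → Inside i x → Fin N
        position′ p = place (valid i p)

        arcStep : ∀ {x y} → Arc x y → (p : Inside i x) (q : Inside i y) → Reaches (position′ p) (position′ q)
        arcStep {x} {y} A p q with position′ p Fin.≟ position′ q
        -- `Realises` provides arcs between distinct vertices only; if the ends coincide there is
        -- nothing to traverse.
        ... | yes e = subst (Reaches (position′ p)) e ε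
        ... | no ne = fromWitness {a? = arcIn? i (position′ p) (position′ q)}
            ( encoded-arc ne (subst₂ Arc (sym (decode-place (valid i p))) (sym (decode-place (valid i q))) A)
            , subst (Inside i) (sym (decode-place (valid i p))) p , subst (Inside i) (sym (decode-place (valid i q))) q ) ◅ ε

        into : ∀ a → In i a → Fin N
        into a p = position′ (proj₂ (inside-node i a p))

        outOf : ∀ a → In i a → Fin N
        outOf a p = position′ (proj₁ (inside-node i a p))

        cross : ∀ a (p : In i a) → Reaches (into a p) (outOf a p)
        cross (term t)   p = ε
        cross (node κ j) p = arcStep (through κ j (colour-range κ p) refl refl) p p

        edge-step : ∀ {a b} → Edge a b → (p : In i a) (q : In i b) → Reaches (outOf a p) (into b q)
        edge-step {a} {b} e p q = arcStep (along e refl refl) (proj₁ (inside-node i a p)) (proj₂ (inside-node i b q))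

        same-out : ∀ a (p q : In i a) → outOf a p ≡ outOf a q
        same-out a p q = Fin.toℕ-injective (trans (toℕ-place (valid i (proj₁ (inside-node i a p)))) (sym (toℕ-place (valid i (proj₁ (inside-node i a q))))))

        walk : ∀ {a b} → Reach i a b → (p : In i a) (q : In i b) → Reaches (outOf a p) (outOf b q)
        walk {a} ε p q = subst (Reaches (outOf a p)) (same-out a p q) ε
        walk ((e , _ , r) ◅ s) p q = edge-step e p r ◅◅ cross _ r ◅◅ walk s r q

        hubPoint : Fin N
        hubPoint = outOf (hub i) (hub∈ i)

        Strongly : Fin N → Set
        Strongly u = Reaches hubPoint u × Reaches u hubPoint

        strongly : ∀ x (p : Inside i x) → Strongly (position′ p)
        strongly (terminal t) p = walk (proj₁ L) (hub∈ i) p , walk (proj₂ L) p (hub∈ i)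
          where L = linked i (term t) p
        strongly (port true κ j) p = walk (proj₁ L) (hub∈ i) p , walk (proj₂ L) p (hub∈ i)
          where L = linked i (node κ j) p
        strongly (port false κ j) p = toInto , cross (node κ j) p ◅◅ walk (proj₂ L) p (hub∈ i)
          where
          L = linked i (node κ j) p
          -- A path from the hub may be empty when the node is the hub itself, and would then miss
          -- its entry port. The detour over terminal 0 guarantees that the last step is an edge
          -- into the node.
          through-t₀ : Reach i (hub i) (term 0) × Reach i (term 0) (node κ j)
          through-t₀ = proj₁ (linked i (term 0) (s≤s z≤n)) , proj₂ (linked i (term 0) (s≤s z≤n)) ◅◅ proj₁ L
          lastStep : ∀ {a b c} → Step i a b → Reach i b c → (p : In i a) (q : In i c) → Reaches (outOf a p) (into c q)
          lastStep (e , _ , _) ε        p q = edge-step e p q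
          lastStep (e , _ , r) (s ◅ ss) p q = edge-step e p r ◅◅ cross _ r ◅◅ lastStep s ss r q
          fromTerm : Reach i (term 0) (node κ j) → Reaches (outOf (term 0) (s≤s z≤n)) (into (node κ j) p)
          fromTerm (s ◅ ss) = lastStep s ss (s≤s z≤n) p
          toInto : Reaches hubPoint (into (node κ j) p)
          toInto = walk (proj₁ through-t₀) (hub∈ i) (s≤s z≤n) ◅◅ fromTerm (proj₂ through-t₀)

        strong′ : ∀ {u} → u ∈ₛ Subgraph.vertices (colourClass i) → Strongly u
        strong′ {u} u∈ = subst Strongly (decode-injective (decode-place (valid i p))) (strongly (decode u) p)
          where
          p : Inside i (decode u)
          p = ∈-class⁻ i u∈

    packing : Packing D S ℓ
    packing = record
      { member   = colourClass
      ; strong   = λ i u∈ v∈ → proj₂ (strong′ i u∈) ◅◅ proj₁ (strong′ i v∈)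
      ; contains = λ i {u} u∈ → ∈-class⁺ i (subst (Inside i) (sym (decode-terminal u (terminals-S u u∈))) (terminals-S u u∈))
      ; disjoint = λ i≢j u v (s , t) → disjoint′ i≢j (toWitness {a? = arcIn? _ u v} s) (toWitness {a? = arcIn? _ u v} t)
      }
      where
      decode-terminal : ∀ u → toℕ u < k → decode u ≡ terminal (toℕ u)
      decode-terminal u u< = decode-code u (λ { refl → u< }) refl
      -- Ports carry at most one colour, so different classes share terminals only; and no arc of
      -- the graph joins two terminals.
      shared : ∀ {i j} → i ≢ j → ∀ x → Inside i x → Inside j x → ∃[ t ] (x ≡ terminal t)
      shared i≢j (terminal t) _ _ = t , refl
      shared i≢j (port _ κ n) p q = contradiction (just-injective (trans (sym p) q)) i≢j
      ¬arc : ∀ {s t} → ¬ Arc (terminal s) (terminal t)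
      ¬arc (along {term _} {term _} () refl refl)
      disjoint′ : ∀ {i j} → i ≢ j → ∀ {u v} → T (arc u v) × Inside i (decode u) × Inside i (decode v) →
                  T (arc u v) × Inside j (decode u) × Inside j (decode v) → ⊥
      disjoint′ i≢j {u} {v} (t , p , q) (_ , p′ , q′) with shared i≢j (decode u) p p′ | shared i≢j (decode v) q q′
      ... | s , e | s′ , e′ = ¬arc (subst₂ Arc e e′ (decoded-arc t))

-- Computations as satisfying assignments

module _ {g : ℕ} where

  -- The cell at absolute position e when the head is at position h.
  cellAt : Tape g → ℕ → ℕ → Symbol g
  cellAt t zero    e       = nth □ (scanned t ∷ after t) e
  cellAt t (suc h) zero    = nth □ (before t) h
  cellAt t (suc h) (suc e) = cellAt t h e

  cellAt-head : ∀ t h → cellAt t h h ≡ scanned t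
  cellAt-head t zero    = refl
  cellAt-head t (suc h) = cellAt-head t h

  -- The head stays at `h` and the tape slides under it, so a move to the right shifts the contents
  -- to the left.
  cellAt-right : ∀ t h e → cellAt (move right t) h e ≡ cellAt t h (suc e)
  cellAt-right (tape b s [])      zero zero    = refl
  cellAt-right (tape b s [])      zero (suc e) = refl
  cellAt-right (tape b s (x ∷ a)) zero e       = refl
  cellAt-right (tape b s [])      (suc zero)    zero = refl
  cellAt-right (tape b s (x ∷ a)) (suc zero)    zero = refl
  cellAt-right (tape b s [])      (suc (suc h)) zero = refl
  cellAt-right (tape b s (x ∷ a)) (suc (suc h)) zero = refl
  cellAt-right t (suc h) (suc e) = cellAt-right t h e

  cellAt-left : ∀ t h e → cellAt (move left t) h (suc e) ≡ cellAt t h e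
  cellAt-left (tape []      s a) zero    e = refl
  cellAt-left (tape (x ∷ b) s a) zero    e = refl
  cellAt-left (tape []      s a) (suc zero)    zero = refl
  cellAt-left (tape (x ∷ b) s a) (suc zero)    zero = refl
  cellAt-left (tape []      s a) (suc (suc h)) zero = refl
  cellAt-left (tape (x ∷ b) s a) (suc (suc h)) zero = refl
  cellAt-left t (suc h) (suc e) = cellAt-left t h e

  cellAt-write-head : ∀ s t h → cellAt (write s t) h h ≡ s
  cellAt-write-head s t h = cellAt-head (write s t) h

  cellAt-write : ∀ s t h e → e ≢ h → cellAt (write s t) h e ≡ cellAt t h e
  cellAt-write s t zero    zero    ne = contradiction refl ne
  cellAt-write s t zero    (suc e) ne = refl
  cellAt-write s t (suc h) zero    ne = refl
  cellAt-write s t (suc h) (suc e) ne = cellAt-write s t h e (ne ∘ cong suc)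

  cellAt-word : ∀ w h d → cellAt (wordTape w) h (h + d) ≡ nth □ (List.map bit w) d
  cellAt-word []      zero    zero    = refl
  cellAt-word []      zero    (suc d) = refl
  cellAt-word (b ∷ w) zero    d       = refl
  cellAt-word w       (suc h) d       = cellAt-word w h d

  cellAt-word-left : ∀ w h e → e < h → cellAt (wordTape w) h e ≡ □
  cellAt-word-left []      (suc h) zero    _        = refl
  cellAt-word-left (b ∷ w) (suc h) zero    _        = refl
  cellAt-word-left w       (suc h) (suc e) (s≤s e<) = cellAt-word-left w h e e<

  cellAt-blank : ∀ h e → cellAt (wordTape []) h e ≡ □
  cellAt-blank zero    zero    = refl
  cellAt-blank zero    (suc e) = refl
  cellAt-blank (suc h) zero    = refl
  cellAt-blank (suc h) (suc e) = cellAt-blank h e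

  symbolCode : Symbol g → Fin (3 + g)
  symbolCode □           = zero
  symbolCode (bit false) = suc zero
  symbolCode (bit true)  = suc (suc zero)
  symbolCode (aux i)     = suc (suc (suc i))

  symbolOf : Fin (3 + g) → Symbol g
  symbolOf zero                = □
  symbolOf (suc zero)          = bit false
  symbolOf (suc (suc zero))    = bit true
  symbolOf (suc (suc (suc i))) = aux i

  symbolOf-code : ∀ s → symbolOf (symbolCode s) ≡ s
  symbolOf-code □           = refl
  symbolOf-code (bit false) = refl
  symbolOf-code (bit true)  = refl
  symbolOf-code (aux i)     = refl

  allSymbols : List (Symbol g)
  allSymbols = List.map symbolOf (List.allFin (3 + g))

  ∈-allSymbols : ∀ s → s ∈ allSymbols
  ∈-allSymbols s = subst (_∈ allSymbols) (symbolOf-code s) (∈-map⁺ symbolOf (∈-allFin (symbolCode s)))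

  _≟ₛ_ : (s t : Symbol g) → Dec (s ≡ t)
  s ≟ₛ t = map′ (λ e → trans (sym (symbolOf-code s)) (trans (cong symbolOf e) (symbolOf-code t))) (cong symbolCode)
                (symbolCode s Fin.≟ symbolCode t)

allVecs : ∀ {A : Set} → List A → ∀ n → List (Vec A n)
allVecs xs zero    = [] ∷ []
allVecs xs (suc n) = List.concatMap (λ x → List.map (x ∷_) (allVecs xs n)) xs

∈-allVecs : ∀ {A : Set} {xs : List A} → (∀ x → x ∈ xs) → ∀ {n} (v : Vec A n) → v ∈ allVecs xs n
∈-allVecs h []      = here refl
∈-allVecs {xs = xs} h {suc n} (x ∷ v) =
  ∈-concatMap⁺ (λ x → List.map (x ∷_) (allVecs xs n)) (Any.map (λ { refl → ∈-map⁺ (x ∷_) (∈-allVecs h v) }) (h x))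

-- Clause templates for the runs of a machine

data Place : Set where
  cur nxt mid : Place

data Guard : Set where
  never always                              : Guard
  initially leftOf xBeyond yInside yBeyond  : Guard
  xBit                                      : Bool → Guard
  headAt headNotAt                          : Place → Guard

module Tableau (M : TM 2) where
  open TM M

  data Fact : Set where
    inState : Fin states → Fact
    holds   : Fin tapes → Symbol auxs → Fact

  facts : ℕ
  facts = states + tapes * (3 + auxs)

  factCode : Fact → Fin facts
  factCode (inState q) = q ↑ˡ (tapes * (3 + auxs))
  factCode (holds i s) = states ↑ʳ Fin.combine i (symbolCode s)

  factOf : Fin facts → Fact
  factOf f = Sum.[ inState , (λ q → cell (Fin.remQuot {tapes} (3 + auxs) q)) ]′ (splitAt states f)
    where
    cell : Fin tapes × Fin (3 + auxs) → Fact
    cell (i , s) = holds i (symbolOf s)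

  factOf-code : ∀ f → factOf (factCode f) ≡ f
  factOf-code (inState q) = cong Sum.[ inState , _ ]′ (Fin.splitAt-↑ˡ states q (tapes * (3 + auxs)))
  factOf-code (holds i s) = trans (cong Sum.[ inState , _ ]′ (Fin.splitAt-↑ʳ states (tapes * (3 + auxs)) (Fin.combine i (symbolCode s))))
    (trans (cong (λ (i , s) → holds i (symbolOf s)) (Fin.remQuot-combine {tapes} {3 + auxs} i (symbolCode s)))
           (cong (holds i) (symbolOf-code s)))

  record Literal : Set where
    constructor literal
    field
      sign  : Bool
      fact  : Fact
      later : Bool
      place : Place

  Pattern : Set
  Pattern = Fin states × Vec (Symbol auxs) tapes

  -- `yCell`, `yEnd` and `yStep` leave the certificate open but make it a word: each cell is a bit
  -- or blank, cells from the bound on are blank, and behind a blank there are only blanks. `enter`,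
  -- `shift` and `print` carry the state, an unscanned cell and a scanned cell to the next time, and
  -- `stop` forbids halting without success. These four are implications from a pattern of state and
  -- scanned symbols, whose negated conjuncts are listed by `mismatches`.
  data Template : Set where
    begin                        : Template
    blank                        : Fin tapes → Template
    xCell                        : Bool → Template
    xEnd yCell yEnd yStep        : Template
    enter stop                   : Pattern → Template
    shift                        : Pattern → Fin tapes → Symbol auxs → Template
    print                        : Pattern → Fin tapes → Template

  xTape yTape : Fin tapes
  xTape = suc zero
  yTape = suc (suc zero)

  mismatches : Pattern → List Literal
  mismatches (q , ss) =
    literal false (inState q) false mid ∷ List.map (λ i → literal false (holds i (Vec.lookup ss i)) false mid) (List.allFin tapes)

  ifMoves : ∀ {A : Set} → Pattern → A → (Fin states → (Fin tapes → Symbol auxs × Move) → A) → A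
  ifMoves (q , ss) a f with δ q ss
  ... | nothing       = a
  ... | just (q′ , as) = f q′ (Vec.lookup as)

  -- Sliding the tape carries a symbol between the positions `e` and `suc e`. Both lie at or after
  -- the position of the clause, so literals are addressed without subtraction.
  source target : Move → Place
  source left  = cur
  source stay  = cur
  source right = nxt
  target left  = nxt
  target stay  = cur
  target right = cur

  guard : Template → Guard
  guard begin = initially
  guard (blank (suc zero))       = leftOf
  guard (blank (suc (suc zero))) = leftOf
  guard (blank _)                = initially
  guard (xCell b) = xBit b
  guard xEnd      = xBeyond
  guard yCell     = yInside
  guard yEnd      = yBeyond
  guard yStep     = yInside
  guard (enter p) = ifMoves p never (λ _ _ → always)
  -- The verifier prints exactly one bit, so the symbol scanned on tape 0 at the end decides.
  -- Halting on a one is permitted, any other halting pattern must not occur.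
  guard (stop p@(_ , s ∷ _)) = ifMoves p (if ⌊ s ≟ₛ bit true ⌋ then never else always) (λ _ _ → never)
  guard (shift p i s) = ifMoves p never (λ _ as → headNotAt (source (proj₂ (as i))))
  guard (print p i)   = ifMoves p never (λ _ as → headAt (source (proj₂ (as i))))

  literals : Template → List Literal
  literals begin     = literal true (inState start) false mid ∷ []
  literals (blank i) = literal true (holds i □) false cur ∷ []
  literals (xCell b) = literal true (holds xTape (bit b)) false cur ∷ []
  literals xEnd      = literal true (holds xTape □) false cur ∷ []
  literals yCell     = literal true (holds yTape (bit true)) false cur ∷ literal true (holds yTape (bit false)) false cur ∷
                       literal true (holds yTape □) false cur ∷ []
  literals yEnd      = literal true (holds yTape □) false cur ∷ []
  literals yStep     = literal false (holds yTape □) false cur ∷ literal true (holds yTape □) false nxt ∷ []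
  literals (enter p) = ifMoves p [] (λ q′ _ → literal true (inState q′) true mid ∷ mismatches p)
  literals (stop p)  = mismatches p
  literals (shift p i s) = ifMoves p [] (λ _ as →
    literal false (holds i s) false (source (proj₂ (as i))) ∷ literal true (holds i s) true (target (proj₂ (as i))) ∷ mismatches p)
  literals (print p i) = ifMoves p [] (λ _ as → literal true (holds i (proj₁ (as i))) true (target (proj₂ (as i))) ∷ mismatches p)

  allPatterns : List Pattern
  allPatterns = List.concatMap (λ q → List.map (q ,_) (allVecs allSymbols tapes)) (List.allFin states)

  ∈-allPatterns : ∀ p → p ∈ allPatterns
  ∈-allPatterns (q , ss) = ∈-concatMap⁺ (λ q → List.map (q ,_) (allVecs allSymbols tapes))
    (Any.map (λ { refl → ∈-map⁺ (q ,_) (∈-allVecs ∈-allSymbols ss) }) (∈-allFin q))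

  private
    fixed blanks enters stops shifts prints : List Template
    fixed  = begin ∷ xCell true ∷ xCell false ∷ xEnd ∷ yCell ∷ yEnd ∷ yStep ∷ []
    blanks = List.map blank (List.allFin tapes)
    enters = List.map enter allPatterns
    stops  = List.map stop allPatterns
    shifts = List.concatMap (λ p → List.concatMap (λ i → List.map (shift p i) allSymbols) (List.allFin tapes)) allPatterns
    prints = List.concatMap (λ p → List.map (print p) (List.allFin tapes)) allPatterns

  abstract
    templates : List Template
    templates = List.concat (fixed ∷ blanks ∷ enters ∷ stops ∷ shifts ∷ prints ∷ [])

    ∈-templates : ∀ τ → τ ∈ templates
    ∈-templates τ = ∈-concat⁺′ (proj₁ (proj₂ (group τ))) (proj₂ (proj₂ (group τ)))
      where
      group : ∀ τ → ∃[ ts ] (τ ∈ ts × ts ∈ fixed ∷ blanks ∷ enters ∷ stops ∷ shifts ∷ prints ∷ [])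
      group begin         = fixed , here refl , here refl
      group (xCell true)  = fixed , there (here refl) , here refl
      group (xCell false) = fixed , there (there (here refl)) , here refl
      group xEnd          = fixed , there (there (there (here refl))) , here refl
      group yCell         = fixed , there (there (there (there (here refl)))) , here refl
      group yEnd          = fixed , there (there (there (there (there (here refl))))) , here refl
      group yStep         = fixed , there (there (there (there (there (there (here refl)))))) , here refl
      group (blank i)     = blanks , ∈-map⁺ blank (∈-allFin i) , there (here refl)
      group (enter p)     = enters , ∈-map⁺ enter (∈-allPatterns p) , there (there (here refl))
      group (stop p)      = stops , ∈-map⁺ stop (∈-allPatterns p) , there (there (there (here refl)))
      group (shift p i s) = shifts ,
        ∈-concatMap⁺ (λ p → List.concatMap (λ i → List.map (shift p i) allSymbols) (List.allFin tapes))
          (Any.map (λ { refl → ∈-concatMap⁺ (λ i → List.map (shift p i) allSymbols)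
            (Any.map (λ { refl → ∈-map⁺ (shift p i) (∈-allSymbols s) }) (∈-allFin i)) }) (∈-allPatterns p)) ,
        there (there (there (there (here refl))))
      group (print p i)   = prints ,
        ∈-concatMap⁺ (λ p → List.map (print p) (List.allFin tapes))
          (Any.map (λ { refl → ∈-map⁺ (print p) (∈-allFin i) }) (∈-allPatterns p)) ,
        there (there (there (there (there (here refl)))))

  -- h is both the time bound and the initial position of all heads; l bounds the length of the certificate.
  module Formula (x : Word) (h l : ℕ) where

    position-of : Place → ℕ → ℕ
    position-of cur e = e
    position-of nxt e = suc e
    position-of mid e = h

    time-of : Bool → ℕ → ℕ
    time-of later t = boolVal later + t

    Meaning : Guard → ℕ → ℕ → Set
    Meaning never         t e = ⊥
    Meaning always        t e = ⊤
    Meaning initially     t e = t ≡ 0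
    Meaning leftOf        t e = t ≡ 0 × e < h
    Meaning xBeyond       t e = t ≡ 0 × ¬ e < h + length x
    Meaning yInside       t e = t ≡ 0 × ¬ e < h
    Meaning yBeyond       t e = t ≡ 0 × ¬ e < h + l
    Meaning (xBit true)   t e = t ≡ 0 × ∃[ d ] (d < length x × e ≡ h + d × bitAt x d ≡ true)
    Meaning (xBit false)  t e = t ≡ 0 × ∃[ d ] (d < length x × e ≡ h + d × ¬ bitAt x d ≡ true)
    Meaning (headAt p)    t e = position-of p e ≡ h
    Meaning (headNotAt p) t e = position-of p e ≢ h

    -- Clauses are indexed by times below T′ and positions below E, variables by times up to T′ and positions up to E.
    T′ E : ℕ
    T′ = suc h
    E = suc (h + h)

    Model : Set
    Model = Fact → ℕ → ℕ → Bool

    Satisfies : Model → ℕ → ℕ → Literal → Set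
    Satisfies A t e (literal b f later p) = A f (time-of later t) (position-of p e) ≡ b

    IsModel : Model → Set
    IsModel A = ∀ τ {t e} → t < T′ → e < E → Meaning (guard τ) t e → Any (Satisfies A t e) (literals τ)

    variableCode : Fact → ℕ → ℕ → ℕ
    variableCode f t e = (t * suc E + e) * facts + toℕ (factCode f)

    variables clauses : ℕ
    variables = suc T′ * suc E * facts
    clauses = T′ * E * length templates

    literalCode : ℕ → ℕ → Literal → ℕ
    literalCode t e (literal b f later p) = lit (variableCode f (time-of later t) (position-of p e)) b

    clauseCode : Fin (length templates) → ℕ → ℕ → ℕ
    clauseCode κ t e = (t * E + e) * length templates + toℕ κ

    -- Every literal occurs in a clause whose guard fails.
    Occurs : ℕ → ℕ → Set
    Occurs y c = ∃[ κ ] ∃[ t ] ∃[ e ] (t < T′ × e < E × c ≡ clauseCode κ t e ×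
      (Meaning (guard (List.lookup templates κ)) t e → Any (λ m → y ≡ literalCode t e m) (literals (List.lookup templates κ))))

    in-range : ∀ {t e} → t < T′ → e < E → ∀ m → variableCode (Literal.fact m) (time-of (Literal.later m) t) (position-of (Literal.place m) e) < variables
    in-range {t} {e} t< e< (literal b f later p) = pairing-< (pairing-< (time< later) (position< p)) (Fin.toℕ<n (factCode f))
      where
      time< : ∀ later → time-of later t < suc T′
      time< false = ℕ.m<n⇒m<1+n t<
      time< true  = s≤s t<
      position< : ∀ p → position-of p e < suc E
      position< cur = ℕ.m<n⇒m<1+n e<
      position< nxt = s≤s e<
      position< mid = s≤s (ℕ.≤-trans (ℕ.m≤m+n h h) (ℕ.n≤1+n (h + h)))

    lit-injective : ∀ {v v′ b b′} → lit v b ≡ lit v′ b′ → v ≡ v′ × b ≡ b′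
    lit-injective {v} {v′} {b} {b′} e with pairing-injective v v′ (s≤s (boolVal-≤ b)) (s≤s (boolVal-≤ b′)) e
    ... | e₁ , e₂ = e₁ , boolVal-injective b b′ e₂
      where
      boolVal-injective : ∀ b b′ → boolVal b ≡ boolVal b′ → b ≡ b′
      boolVal-injective false false _ = refl
      boolVal-injective true  true  _ = refl

    satisfiable⇒model : Satisfiable variables clauses Occurs → ∃[ A ] IsModel A
    satisfiable⇒model (σ , sat) = A , model
      where
      A : Model
      A f t e = σ (variableCode f t e)
      model : IsModel A
      model τ {t} {e} t< e< m with sat (clauseCode κ t e) (pairing-< (pairing-< t< e<) (Fin.toℕ<n κ))
        where κ = Any.index (∈-templates τ)
      ... | v , _ , κ′ , t′ , e′ , t′< , e′< , eq , occ
        with pairing-injective (t * E + e) (t′ * E + e′) (Fin.toℕ<n _) (Fin.toℕ<n κ′) eq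
      ...   | eq₁ , eq₂ with pairing-injective t t′ e< e′< eq₁ | Fin.toℕ-injective eq₂
      ...     | refl , refl | refl = subst (λ τ → Any (Satisfies A t e) (literals τ)) τ≡
                (Any.map (λ {m} → matches m) (occ (subst (λ τ → Meaning (guard τ) t e) (sym τ≡) m)))
        where
        τ≡ : List.lookup templates (Any.index (∈-templates τ)) ≡ τ
        τ≡ = sym (lookup-index (∈-templates τ))
        matches : ∀ m → lit v (σ v) ≡ literalCode t e m → Satisfies A t e m
        matches (literal b f later p) eq with lit-injective {v} {variableCode f (time-of later t) (position-of p e)} {σ v} {b} eq
        ... | refl , eq′ = eq′

    module _ (1≤facts : 1 ≤ facts) where

      model⇒satisfiable : ∃[ A ] IsModel A → Satisfiable variables clauses Occurs
      model⇒satisfiable (A , model) = σ , sat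
        where
        value : ∀ {v} → Dec (v < variables) → Bool
        value (no _)   = false
        value (yes v<) with pairing-surjective (suc T′ * suc E) {facts} v<
        ... | te , f , te< , f< , _ with pairing-surjective (suc T′) {suc E} te<
        ...   | t , e , _ , _ , _ = A (factOf (fromℕ< f<)) t e
        σ : ℕ → Bool
        σ v = value (v ℕ.<? variables)
        value-code : ∀ {f t e} (d : Dec (variableCode f t e < variables)) → variableCode f t e < variables → e < suc E → value d ≡ A f t e
        value-code (no ¬p) p _ = contradiction p ¬p
        value-code {f} {t} {e} (yes v<) _ e< with pairing-surjective (suc T′ * suc E) {facts} v<
        ... | te , f′ , te< , f′< , eq with pairing-surjective (suc T′) {suc E} te<
        ...   | t′ , e′ , _ , e′< , refl with pairing-injective (t * suc E + e) (t′ * suc E + e′) (Fin.toℕ<n (factCode f)) f′< eq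
        ...     | eq₁ , eq₂ with pairing-injective t t′ e< e′< eq₁
        ...       | refl , refl = cong (λ f → A f t e) (trans (cong factOf (Fin.toℕ-injective (trans (Fin.toℕ-fromℕ< f′<) (sym eq₂)))) (factOf-code f))
        position< : ∀ {e} p → e < E → position-of p e < suc E
        position< cur e< = ℕ.m<n⇒m<1+n e<
        position< nxt e< = s≤s e<
        position< mid e< = s≤s (ℕ.≤-trans (ℕ.m≤m+n h h) (ℕ.n≤1+n (h + h)))
        someVariable : 0 < variables
        someVariable = ℕ.*-mono-≤ {1} {suc T′ * suc E} {1} {facts} (s≤s z≤n) 1≤facts
        sat : ∀ c → c < clauses → ∃[ v ] (v < variables × Occurs (lit v (σ v)) c)
        sat c c< with pairing-surjective (T′ * E) {length templates} c<
        ... | te , κ , te< , κ< , refl with pairing-surjective T′ {E} te<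
        ...   | t , e , t< , e< , refl with meaning? (guard (List.lookup templates (fromℕ< κ<))) t e
          where
          meaning? : ∀ g t e → Dec (Meaning g t e)
          meaning? never         t e = no id
          meaning? always        t e = yes tt
          meaning? initially     t e = t ℕ.≟ 0
          meaning? leftOf        t e = t ℕ.≟ 0 ×-dec e ℕ.<? h
          meaning? xBeyond       t e = t ℕ.≟ 0 ×-dec ¬? (e ℕ.<? h + length x)
          meaning? yInside       t e = t ℕ.≟ 0 ×-dec ¬? (e ℕ.<? h)
          meaning? yBeyond       t e = t ℕ.≟ 0 ×-dec ¬? (e ℕ.<? h + l)
          meaning? (xBit true)   t e = t ℕ.≟ 0 ×-dec ℕ.anyUpTo? (λ d → e ℕ.≟ h + d ×-dec bitAt x d ≟ᵇ true) (length x)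
          meaning? (xBit false)  t e = t ℕ.≟ 0 ×-dec ℕ.anyUpTo? (λ d → e ℕ.≟ h + d ×-dec ¬? (bitAt x d ≟ᵇ true)) (length x)
          meaning? (headAt p)    t e = position-of p e ℕ.≟ h
          meaning? (headNotAt p) t e = ¬? (position-of p e ℕ.≟ h)
        -- With a failing guard every literal belongs to the clause, so variable 0 will do; it
        -- exists since there is at least one fact.
        ...     | no ¬m = 0 , someVariable , fromℕ< κ< , t , e , t< , e< , cong ((t * E + e) * length templates +_) (sym (Fin.toℕ-fromℕ< κ<)) ,
                  λ m → contradiction m ¬m
        ...     | yes m with satisfiedLiteral (model (List.lookup templates (fromℕ< κ<)) t< e< m)
          where
          satisfiedLiteral : ∀ {ms} → Any (Satisfies A t e) ms → ∃[ m ] (m ∈ ms × Satisfies A t e m)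
          satisfiedLiteral (here s)  = _ , here refl , s
          satisfiedLiteral (there a) with satisfiedLiteral a
          ... | m , m∈ , s = m , there m∈ , s
        ...       | literal b f later p , m∈ , s =
          variableCode f (time-of later t) (position-of p e) , in-range t< e< (literal b f later p) ,
          fromℕ< κ< , t , e , t< , e< , cong ((t * E + e) * length templates +_) (sym (Fin.toℕ-fromℕ< κ<)) ,
          λ _ → Any.map (λ { refl → cong (lit (variableCode f (time-of later t) (position-of p e)))
                  (trans (value-code (_ ℕ.<? variables) (in-range t< e< (literal b f later p)) (position< p e<)) s) }) m∈

nth-map-bit-< : ∀ {g} x d → d < length x → nth (□ {g}) (List.map bit x) d ≡ bit (bitAt x d)
nth-map-bit-< (b ∷ x) zero    _        = refl
nth-map-bit-< (b ∷ x) (suc d) (s≤s d<) = nth-map-bit-< x d d<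

nth-map-bit-≥ : ∀ {g} x d → length x ≤ d → nth (□ {g}) (List.map bit x) d ≡ □
nth-map-bit-≥ []      d       _        = refl
nth-map-bit-≥ (b ∷ x) (suc d) (s≤s le) = nth-map-bit-≥ x d le

lookup-extensional : ∀ {A : Set} {n} (xs ys : Vec A n) → (∀ i → Vec.lookup xs i ≡ Vec.lookup ys i) → xs ≡ ys
lookup-extensional []       []       h = refl
lookup-extensional (x ∷ xs) (y ∷ ys) h = cong₂ _∷_ (h zero) (lookup-extensional xs ys (h ∘ suc))

¬Any-map : ∀ {A B : Set} {P : B → Set} {f : A → B} → (∀ a → ¬ P (f a)) → ∀ as → ¬ Any P (List.map f as)
¬Any-map h (a ∷ as) (here p)  = h a p
¬Any-map h (a ∷ as) (there q) = ¬Any-map h as q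

readWord-scanned : ∀ {g} (t : Tape g) {b} → readWord t ≡ b ∷ [] → scanned t ≡ bit b
readWord-scanned (tape _ (bit b) _) e = cong bit (List.∷-injectiveˡ e)

-- Models and accepting runs

module Simulation (M : TM 2) (x : Word) (h l : ℕ) where
  open TM M
  open Tableau M
  open Tableau.Formula M x h l
  open Configuration

  ifMoves-just : ∀ {A : Set} {a : A} {f} {q ss q′ as} → δ q ss ≡ just (q′ , as) → ifMoves (q , ss) a f ≡ f q′ (Vec.lookup as)
  ifMoves-just {q = q} {ss} e with δ q ss
  ifMoves-just refl | just _ = refl

  ifMoves-nothing : ∀ {A : Set} {a : A} {f} {q ss} → δ q ss ≡ nothing → ifMoves (q , ss) a f ≡ a
  ifMoves-nothing {q = q} {ss} e with δ q ss
  ifMoves-nothing refl | nothing = refl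

  -- One equation for the three moves, which allows a single template each for `shift` and `print`.
  moved : ∀ m s (t : Tape auxs) e → cellAt (move m (write s t)) h (position-of (target m) e) ≡ cellAt (write s t) h (position-of (source m) e)
  moved left  s t e = cellAt-left (write s t) h e
  moved stay  s t e = refl
  moved right s t e = cellAt-right (write s t) h e

  ≮⇒gap : ∀ {a e} → ¬ e < a → ∃[ d ] (e ≡ a + d)
  ≮⇒gap e≮ with ℕ.m≤n⇒∃[o]m+o≡n (ℕ.≮⇒≥ e≮)
  ... | d , eq = d , sym eq

  module FromModel (A : Model) (model : IsModel A) where

    private
      single : ∀ {P : Literal → Set} {m} → Any P (m ∷ []) → P m
      single (here p) = p

      e<E : ∀ {e} → e ≤ h + h → e < E
      e<E = s≤s

      -- The certificate is read off the model, which may allow several symbols in a cell: reading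
      -- stops at the first cell declared blank, and otherwise a one is preferred. The second
      -- argument limits the length.
      guess : ℕ → ℕ → Word
      guess d zero    = []
      guess d (suc r) =
        if A (holds yTape □) 0 (h + d) then [] else A (holds yTape (bit true)) 0 (h + d) ∷ guess (suc d) r

      guess-length : ∀ d r → length (guess d r) ≤ r
      guess-length d zero = z≤n
      guess-length d (suc r) with A (holds yTape □) 0 (h + d)
      ... | true  = z≤n
      ... | false = s≤s (guess-length (suc d) r)

      before< : ∀ d i → h + (d + i) < h + (d + suc i)
      before< d i = ℕ.+-monoʳ-< h (ℕ.+-monoʳ-< d ℕ.≤-refl)

      blanksFrom : ∀ d i → A (holds yTape □) 0 (h + d) ≡ true → h + (d + i) < E → A (holds yTape □) 0 (h + (d + i)) ≡ true
      blanksFrom d zero    p _ = subst (λ d → A (holds yTape □) 0 (h + d) ≡ true) (sym (ℕ.+-identityʳ d)) p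
      blanksFrom d (suc i) p e< with model yStep {0} {h + (d + i)} (s≤s z≤n) (ℕ.<-trans (before< d i) e<)
                                       (refl , λ lt → ℕ.<-irrefl refl (ℕ.≤-trans lt (ℕ.m≤m+n h _)))
      ... | here q         = contradiction (trans (sym (blanksFrom d i p (ℕ.<-trans (before< d i) e<))) q) λ ()
      ... | there (here q) = subst (λ e → A (holds yTape □) 0 e ≡ true) (trans (sym (ℕ.+-suc h (d + i))) (cong (h +_) (sym (ℕ.+-suc d i)))) q

      guess-cell : ∀ r d i → d + r ≡ l → h + (d + i) < E →
        A (holds yTape (nth □ (List.map bit (guess d r)) i)) 0 (h + (d + i)) ≡ true
      guess-cell zero d i e e< = single (model yEnd (s≤s z≤n) e<
        (refl , λ lt → ℕ.<-irrefl refl (ℕ.≤-trans lt (ℕ.+-monoʳ-≤ h (ℕ.≤-trans (ℕ.≤-reflexive (trans (sym e) (ℕ.+-identityʳ d))) (ℕ.m≤m+n d i))))))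
      guess-cell (suc r) d i e e< with A (holds yTape □) 0 (h + d) in b
      ... | true  = blanksFrom d i b e<
      guess-cell (suc r) d zero e e< | false
        with A (holds yTape (bit true)) 0 (h + d) in b₁ | model yCell {0} {h + d} (s≤s z≤n) (subst (λ d → h + d < E) (ℕ.+-identityʳ d) e<)
               (refl , λ lt → ℕ.<-irrefl refl (ℕ.≤-trans lt (ℕ.m≤m+n h d)))
      ... | true  | _ = subst (λ d → A (holds yTape (bit true)) 0 (h + d) ≡ true) (sym (ℕ.+-identityʳ d)) b₁
      ... | false | here q = contradiction (trans (sym b₁) q) λ ()
      ... | false | there (here q) = subst (λ d → A (holds yTape (bit false)) 0 (h + d) ≡ true) (sym (ℕ.+-identityʳ d)) q
      ... | false | there (there (here q)) = contradiction (trans (sym b) q) λ ()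
      guess-cell (suc r) d (suc i) e e< | false =
        subst (λ n → A (holds yTape (nth □ (List.map bit (guess (suc d) r)) i)) 0 (h + n) ≡ true) (sym (ℕ.+-suc d i))
          (guess-cell r (suc d) i (trans (sym (ℕ.+-suc d r)) e) (subst (λ n → h + n < E) (ℕ.+-suc d i) e<))

      -- Only one direction is claimed: what holds in the run holds in the model. In each step an
      -- unknown cell may slide in at either end of the window from `0` to `h + h`, so the known
      -- part shrinks by one cell on both sides. Up to time `h` it still contains the scanned cell.
      record Facts (c : Config) (t : ℕ) : Set where
        field
          inside : A (inState (state c)) t h ≡ true
          cells  : ∀ i e → t ≤ e → e + t ≤ h + h → A (holds i (cellAt (Vec.lookup (content c) i) h e)) t e ≡ true

      module _ {q : Fin states} {ts : Vec (Tape auxs) tapes} {t : ℕ} (F : Facts (config q ts) t) (t≤h : t ≤ h) where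
        open Facts F

        here-pattern : Pattern
        here-pattern = q , Vec.map scanned ts

        ¬mismatch : ∀ {e} → ¬ Any (Satisfies A t e) (mismatches here-pattern)
        ¬mismatch (here p)  = contradiction (trans (sym inside) p) λ ()
        ¬mismatch {e} (there p) = ¬Any-map (λ i p → contradiction (trans (sym (scanned-cell i)) p) λ ()) (List.allFin tapes) p
          where
          scanned-cell : ∀ i → A (holds i (Vec.lookup (Vec.map scanned ts) i)) t h ≡ true
          scanned-cell i = subst (λ s → A (holds i s) t h ≡ true)
            (trans (cellAt-head (Vec.lookup ts i) h) (sym (Vec.lookup-map i scanned ts)))
            (cells i h t≤h (ℕ.+-monoʳ-≤ h t≤h))

        facts-step : ∀ {q′ as} → δ q (Vec.map scanned ts) ≡ just (q′ , as) → suc t ≤ h → Facts (perform ts (q′ , as)) (suc t)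
        facts-step {q′} {as} eq t<h = record { inside = inside′ ; cells = cells′ }
          where
          inside′ : A (inState q′) (suc t) h ≡ true
          inside′ with subst (Any (Satisfies A t h)) (ifMoves-just eq)
                         (model (enter here-pattern) {t} {h} (s≤s t≤h) (e<E (ℕ.m≤m+n h h)) (subst (λ g → Meaning g t h) (sym (ifMoves-just eq)) tt))
          ... | here p  = p
          ... | there p = contradiction p (¬mismatch {h})
          changes : ∀ i e → e < E → t ≤ position-of (source (proj₂ (Vec.lookup as i))) e →
                    position-of (source (proj₂ (Vec.lookup as i))) e + t ≤ h + h →
                    A (holds i (cellAt (act (Vec.lookup as i) (Vec.lookup ts i)) h (position-of (target (proj₂ (Vec.lookup as i))) e)))
                      (suc t) (position-of (target (proj₂ (Vec.lookup as i))) e) ≡ true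
          changes i e e< t≤ ≤hh with position-of (source m) e ℕ.≟ h
            where m = proj₂ (Vec.lookup as i)
          ... | yes at with subst (Any (Satisfies A t e)) (ifMoves-just eq)
                              (model (print here-pattern i) {t} {e} (s≤s t≤h) e< (subst (λ g → Meaning g t e) (sym (ifMoves-just eq)) at))
          ...   | there p = contradiction p (¬mismatch {e})
          ...   | here p = subst (λ s → A (holds i s) (suc t) (position-of (target (proj₂ (Vec.lookup as i))) e) ≡ true)
                    (sym (trans (moved (proj₂ (Vec.lookup as i)) (proj₁ (Vec.lookup as i)) (Vec.lookup ts i) e)
                      (trans (cong (cellAt (write (proj₁ (Vec.lookup as i)) (Vec.lookup ts i)) h) at)
                             (cellAt-write-head (proj₁ (Vec.lookup as i)) (Vec.lookup ts i) h)))) p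
          changes i e e< t≤ ≤hh | no away
            with subst (Any (Satisfies A t e)) (ifMoves-just eq)
                   (model (shift here-pattern i s) {t} {e} (s≤s t≤h) e< (subst (λ g → Meaning g t e) (sym (ifMoves-just eq)) away))
            where s = cellAt (Vec.lookup ts i) h (position-of (source (proj₂ (Vec.lookup as i))) e)
          ... | here p          = contradiction (trans (sym (cells i _ t≤ ≤hh)) p) λ ()
          ... | there (there p) = contradiction p (¬mismatch {e})
          ... | there (here p)  = subst (λ s → A (holds i s) (suc t) (position-of (target (proj₂ (Vec.lookup as i))) e) ≡ true)
                    (sym (trans (moved (proj₂ (Vec.lookup as i)) (proj₁ (Vec.lookup as i)) (Vec.lookup ts i) e)
                      (cellAt-write (proj₁ (Vec.lookup as i)) (Vec.lookup ts i) h _ away))) p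
          byMove : ∀ i a → Vec.lookup as i ≡ a → ∀ e → suc t ≤ e → e + suc t ≤ h + h →
                   A (holds i (cellAt (act a (Vec.lookup ts i)) h e)) (suc t) e ≡ true
          byMove i (s , right) eq e t< ≤hh with changes i e
          ... | C rewrite eq = C (e<E (ℕ.≤-trans (ℕ.m≤m+n e (suc t)) ≤hh)) (ℕ.≤-trans (ℕ.<⇒≤ t<) (ℕ.n≤1+n e))
                                 (ℕ.≤-trans (ℕ.≤-reflexive (sym (ℕ.+-suc e t))) ≤hh)
          byMove i (s , stay) eq e t< ≤hh with changes i e
          ... | C rewrite eq = C (e<E (ℕ.≤-trans (ℕ.m≤m+n e (suc t)) ≤hh)) (ℕ.<⇒≤ t<) (ℕ.≤-trans (ℕ.+-monoʳ-≤ e (ℕ.n≤1+n t)) ≤hh)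
          -- A move to the left brings the symbol from `e` to `suc e`; position 0 lies outside the
          -- known part at time `suc t`.
          byMove i (s , left) eq (suc e) (s≤s t≤) ≤hh with changes i e
          ... | C rewrite eq = C (e<E (ℕ.≤-trans (ℕ.m≤m+n e (suc t)) (ℕ.≤-trans (ℕ.n≤1+n _) ≤hh))) t≤
                                 (ℕ.≤-trans (ℕ.+-mono-≤ (ℕ.n≤1+n e) (ℕ.n≤1+n t)) ≤hh)
          cells′ : ∀ i e → suc t ≤ e → e + suc t ≤ h + h → A (holds i (cellAt (Vec.lookup (Vec.zipWith act as ts) i) h e)) (suc t) e ≡ true
          cells′ i e t< ≤hh = subst (λ tp → A (holds i (cellAt tp h e)) (suc t) e ≡ true) (sym (Vec.lookup-zipWith act i as ts))
            (byMove i (Vec.lookup as i) refl e t< ≤hh)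

      ¬stops : ∀ {q tp ts t} → Facts (config q (tp ∷ ts)) t → t ≤ h → δ q (Vec.map scanned (tp ∷ ts)) ≡ nothing → scanned tp ≡ bit true
      ¬stops {q} {tp} {ts} {t} F t≤h eq with scanned tp ≟ₛ bit true in d
      ... | yes e = e
      ... | no ne = contradiction
        (model (stop (q , Vec.map scanned (tp ∷ ts))) {t} {h} (s≤s t≤h) (e<E (ℕ.m≤m+n h h))
          (subst (λ g → Meaning g t h) (sym (trans (ifMoves-nothing eq) (cong (λ d → if ⌊ d ⌋ then never else always) d))) tt))
        (¬mismatch F t≤h {h})

      accepts : ∀ {c n d b t} → c ⇓[ n ] d → Facts c t → t + n ≤ h → output d ≡ b ∷ [] → b ≡ true
      accepts {config q (tp ∷ ts)} {t = t} (halt eq) F le out with δ q (Vec.map scanned (tp ∷ ts)) in e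
      ... | nothing = bit-injective (trans (sym (readWord-scanned tp out)) (¬stops F (ℕ.m+n≤o⇒m≤o t le) e))
        where
        bit-injective : ∀ {b b′} → bit {auxs} b ≡ bit b′ → b ≡ b′
        bit-injective refl = refl
      accepts {config q ts} {t = t} (next {t = n} eq r) F le out with δ q (Vec.map scanned ts) in e
      accepts {config q ts} {t = t} (next {t = n} refl r) F le out | just (q′ , as) =
        accepts r (facts-step F (ℕ.m+n≤o⇒m≤o t le) e (ℕ.m+n≤o⇒m≤o (suc t) le′)) le′ out
        where
        le′ : suc t + n ≤ h
        le′ = ℕ.≤-trans (ℕ.≤-reflexive (sym (ℕ.+-suc t n))) le

      initially-true : ∀ y → (∀ d → h + d < E → A (holds yTape (nth □ (List.map bit y) d)) 0 (h + d) ≡ true) →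
                       Facts (initial (x ∷ y ∷ [])) 0
      initially-true y ys = record
        { inside = single (model begin {0} {h} (s≤s z≤n) (e<E (ℕ.m≤m+n h h)) refl)
        ; cells  = λ i e _ ≤hh → cells′ i e (e<E (ℕ.≤-trans (ℕ.m≤m+n e 0) ≤hh)) }
        where
        cells′ : ∀ i e → e < E → A (holds i (cellAt (Vec.lookup (content (initial (x ∷ y ∷ []))) i) h e)) 0 e ≡ true
        cells′ zero e e< = subst (λ s → A (holds zero s) 0 e ≡ true) (sym (cellAt-blank h e)) (single (model (blank zero) (s≤s z≤n) e< refl))
        cells′ (suc zero) e e< with e ℕ.<? h
        ... | yes e<h = subst (λ s → A (holds xTape s) 0 e ≡ true) (sym (cellAt-word-left x h e e<h))
                          (single (model (blank xTape) (s≤s z≤n) e< (refl , e<h)))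
        ... | no e≮h with ≮⇒gap e≮h
        ...   | d , refl with d ℕ.<? length x
        ...     | no d≮ = subst (λ s → A (holds xTape s) 0 (h + d) ≡ true)
                    (sym (trans (cellAt-word x h d) (nth-map-bit-≥ x d (ℕ.≮⇒≥ d≮))))
                    (single (model xEnd (s≤s z≤n) e< (refl , λ lt → d≮ (ℕ.+-cancelˡ-< h _ _ lt))))
        ...     | yes d< = subst (λ s → A (holds xTape s) 0 (h + d) ≡ true)
                    (sym (trans (cellAt-word x h d) (nth-map-bit-< x d d<))) (known (bitAt x d) refl)
          where
          known : ∀ b → bitAt x d ≡ b → A (holds xTape (bit b)) 0 (h + d) ≡ true
          known true  p = single (model (xCell true) (s≤s z≤n) e< (refl , d , d< , refl , p))
          known false p = single (model (xCell false) (s≤s z≤n) e< (refl , d , d< , refl , λ q → contradiction (trans (sym p) q) λ ()))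
        cells′ (suc (suc zero)) e e< with e ℕ.<? h
        ... | yes e<h = subst (λ s → A (holds yTape s) 0 e ≡ true) (sym (cellAt-word-left y h e e<h))
                          (single (model (blank yTape) (s≤s z≤n) e< (refl , e<h)))
        ... | no e≮h with ≮⇒gap e≮h
        ...   | d , refl = subst (λ s → A (holds yTape s) 0 (h + d) ≡ true) (sym (cellAt-word y h d)) (ys d e<)
        cells′ (suc (suc (suc i))) e e< = subst (λ s → A (holds (suc (suc (suc i))) s) 0 e ≡ true)
          (sym (trans (cong (λ tp → cellAt tp h e) (Vec.lookup-replicate i (wordTape []))) (cellAt-blank h e)))
          (single (model (blank (suc (suc (suc i)))) (s≤s z≤n) e< refl))

    -- The conclusion is conditional on a run that halts in time, since no clause forces the machine
    -- to halt; `stop` only excludes a wrong answer.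
    model-accepts : ∃[ y ] (length y ≤ l × (∀ {n d b} → initial (x ∷ y ∷ []) ⇓[ n ] d → n ≤ h → output d ≡ b ∷ [] → b ≡ true))
    model-accepts = guess 0 l , guess-length 0 l ,
      λ r n≤ out → accepts r (initially-true _ λ d e< → guess-cell l 0 d refl e<) n≤ out

  module FromRun (y : Word) (y≤l : length y ≤ l) {n d} (halts : initial (x ∷ y ∷ []) ⇓[ n ] d) (out : output d ≡ true ∷ []) where

    private
      runs : Config → ℕ → Maybe Config
      runs c zero    = just c
      runs c (suc t) = step c Maybe.>>= λ c′ → runs c′ t

      runs-suc : ∀ c t → runs c (suc t) ≡ (runs c t Maybe.>>= step)
      runs-suc c zero with step c
      ... | nothing = refl
      ... | just _  = refl
      runs-suc c (suc t) with step c
      ... | nothing = refl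
      ... | just c′ = runs-suc c′ t

      halts-in : ∀ {c n d t c′} → c ⇓[ n ] d → runs c t ≡ just c′ → step c′ ≡ nothing → c′ ≡ d
      halts-in {t = zero} (halt _) refl _ = refl
      halts-in {t = zero} (next e _) refl s = contradiction (trans (sym s) e) λ ()
      halts-in {t = suc t} (halt e) r s rewrite e = contradiction r λ ()
      halts-in {t = suc t} (next e q) r s rewrite e = halts-in {t = t} q r s

      conf : ℕ → Maybe Config
      conf = runs (initial (x ∷ y ∷ []))

      TrueIn : Fact → ℕ → Config → Set
      TrueIn (inState q) e c = state c ≡ q
      TrueIn (holds i s) e c = cellAt (Vec.lookup (content c) i) h e ≡ s

      trueIn? : ∀ f e c → Dec (TrueIn f e c)
      trueIn? (inState q) e c = state c Fin.≟ q
      trueIn? (holds i s) e c = cellAt (Vec.lookup (content c) i) h e ≟ₛ s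

      decideIn : Fact → ℕ → Maybe Config → Bool
      decideIn f e nothing  = false
      decideIn f e (just c) = ⌊ trueIn? f e c ⌋

    -- After the machine has halted no fact is true. Clauses about later times then hold because
    -- their patterns are mismatched.
    A : Model
    A f t e = decideIn f e (conf t)

    private
      A-true : ∀ {f t e c} → conf t ≡ just c → TrueIn f e c → A f t e ≡ true
      A-true {f} {t} {e} {c} r p rewrite r = T⇒true (fromWitness {a? = trueIn? f e c} p)

      A-false : ∀ {f t e c} → conf t ≡ just c → ¬ TrueIn f e c → A f t e ≡ false
      A-false {f} {t} {e} {c} r ¬p rewrite r with trueIn? f e c
      ... | yes p = contradiction p ¬p
      ... | no _  = refl

      A-nothing : ∀ {f t e} → conf t ≡ nothing → A f t e ≡ false
      A-nothing r rewrite r = refl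

      Actual : ℕ → Pattern → Set
      Actual t p = ∃[ c ] (conf t ≡ just c × p ≡ (state c , Vec.map scanned (content c)))

      -- Clauses of the last four kinds end with the mismatches of their pattern, so they need a
      -- proof only for the pattern that the run really shows at time `t`.
      actual⊎mismatch : ∀ t e p → Actual t p ⊎ Any (Satisfies A t e) (mismatches p)
      actual⊎mismatch t e (q , ss) = byConf (conf t) refl
        where
        byConf : ∀ m → conf t ≡ m → Actual t (q , ss) ⊎ Any (Satisfies A t e) (mismatches (q , ss))
        byConf nothing  r = inj₂ (here (A-nothing {inState q} {t} {h} r))
        byConf (just c) r with state c Fin.≟ q
        ... | no ne = inj₂ (here (A-false {inState q} {t} {h} r ne))
        ... | yes refl with Fin.all? (λ i → Vec.lookup ss i ≟ₛ scanned (Vec.lookup (content c) i))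
        ...   | yes all = inj₁ (c , r , cong (state c ,_) (lookup-extensional ss _ λ i → trans (all i) (sym (Vec.lookup-map i scanned (content c)))))
        ...   | no ¬all with Fin.¬∀⟶∃¬ tapes _ (λ i → Vec.lookup ss i ≟ₛ scanned (Vec.lookup (content c) i)) ¬all
        ...     | i , ne = inj₂ (there (lose′ (∈-allFin i) (A-false {holds i (Vec.lookup ss i)} {t} {h} r
                    λ p → ne (trans (sym p) (cellAt-head (Vec.lookup (content c) i) h)))))
          where
          lose′ : ∀ {is} → i ∈ is → A (holds i (Vec.lookup ss i)) t h ≡ false →
                  Any (Satisfies A t e) (List.map (λ i → literal false (holds i (Vec.lookup ss i)) false mid) is)
          lose′ (here refl) p = here p
          lose′ (there i∈)  p = there (lose′ i∈ p)

      conf-suc : ∀ {t q ts q′ as} → conf t ≡ just (config q ts) → δ q (Vec.map scanned ts) ≡ just (q′ , as) →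
                 conf (suc t) ≡ just (perform ts (q′ , as))
      conf-suc {t} {q} {ts} r e = trans (runs-suc _ t) (trans (cong (Maybe._>>= step) r) (cong (Maybe.map (perform ts)) e))

      cell₀ : Fin tapes → ℕ → Symbol auxs
      cell₀ i e = cellAt (Vec.lookup (content (initial (x ∷ y ∷ []))) i) h e

      known₀ : ∀ {i s e} → cell₀ i e ≡ s → A (holds i s) 0 e ≡ true
      known₀ {i} {s} {e} p = A-true {holds i s} {0} {e} refl p

      y-cell : ∀ d → cell₀ yTape (h + d) ≡ nth □ (List.map bit y) d
      y-cell d = cellAt-word y h d

      clause-of : ∀ {t e} τ → Meaning (guard τ) t e → Any (Satisfies A t e) (literals τ)
      clause-of begin refl = here (A-true {inState start} {0} {h} refl refl)
      clause-of {e = e} (blank zero) refl = here (known₀ {zero} (cellAt-blank h e))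
      clause-of {e = e} (blank (suc zero)) (refl , e<h) = here (known₀ {xTape} (cellAt-word-left x h e e<h))
      clause-of {e = e} (blank (suc (suc zero))) (refl , e<h) = here (known₀ {yTape} (cellAt-word-left y h e e<h))
      clause-of {e = e} (blank (suc (suc (suc i)))) refl = here (known₀ {suc (suc (suc i))}
        (trans (cong (λ tp → cellAt tp h e) (Vec.lookup-replicate i (wordTape []))) (cellAt-blank h e)))
      clause-of (xCell true) (refl , d , d< , refl , p) =
        here (known₀ {xTape} (trans (cellAt-word x h d) (trans (nth-map-bit-< x d d<) (cong bit p))))
      clause-of (xCell false) (refl , d , d< , refl , ¬p) =
        here (known₀ {xTape} (trans (cellAt-word x h d) (trans (nth-map-bit-< x d d<) (cong bit (notTrue ¬p)))))
      clause-of xEnd (refl , e≮) with ≮⇒gap e≮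
      ... | d , refl = here (known₀ {xTape} (trans (cong (cell₀ xTape) (ℕ.+-assoc h (length x) d))
        (trans (cellAt-word x h (length x + d)) (nth-map-bit-≥ x (length x + d) (ℕ.m≤m+n _ d)))))
      clause-of yCell (refl , e≮) with ≮⇒gap e≮
      ... | d , refl with nth □ (List.map bit y) d in eq
      ...   | bit true  = here (known₀ {yTape} (trans (y-cell d) eq))
      ...   | bit false = there (here (known₀ {yTape} (trans (y-cell d) eq)))
      ...   | □         = there (there (here (known₀ {yTape} (trans (y-cell d) eq))))
      ...   | aux i with d ℕ.<? length y
      ...     | yes d< = contradiction (trans (sym (nth-map-bit-< y d d<)) eq) λ ()
      ...     | no d≮  = contradiction (trans (sym (nth-map-bit-≥ y d (ℕ.≮⇒≥ d≮))) eq) λ ()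
      clause-of yEnd (refl , e≮) with ≮⇒gap e≮
      ... | d , refl = here (known₀ {yTape} (trans (cong (cell₀ yTape) (ℕ.+-assoc h l d))
        (trans (y-cell (l + d)) (nth-map-bit-≥ y (l + d) (ℕ.≤-trans y≤l (ℕ.m≤m+n l d))))))
      clause-of yStep (refl , e≮) with ≮⇒gap e≮
      ... | d , refl with d ℕ.<? length y
      ...   | yes d< = here (A-false {holds yTape □} {0} {h + d} refl λ p → contradiction (trans (sym p) (trans (y-cell d) (nth-map-bit-< y d d<))) λ ())
      ...   | no d≮  = there (here (known₀ {yTape} (trans (cong (cell₀ yTape) (sym (ℕ.+-suc h d)))
        (trans (y-cell (suc d)) (nth-map-bit-≥ y (suc d) (ℕ.≤-trans (ℕ.≮⇒≥ d≮) (ℕ.n≤1+n d)))))))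
      clause-of {t} {e} (enter p@(q , ss)) m with δ q ss in eq
      ... | just (q′ , as) with actual⊎mismatch t e p
      ...   | inj₂ miss = there miss
      ...   | inj₁ (c , r , refl) = here (A-true {inState q′} {suc t} {h} (conf-suc {t} r eq) refl)
      clause-of {t} {e} (stop p@(q , s ∷ ss)) m with δ q (s ∷ ss) in eq
      ... | nothing with s ≟ₛ bit true | actual⊎mismatch t e p
      ...   | no ne | inj₂ miss = miss
      ...   | no ne | inj₁ (config _ (tp ∷ tps) , r , refl)
        -- A halting pattern met by the run belongs to its final configuration, whose output is
        -- known to be true.
        with halts-in {t = t} halts r (cong (Maybe.map _) eq)
      ...     | refl = contradiction (readWord-scanned tp out) ne
      clause-of {t} {e} (shift p@(q , ss) i s) m with δ q ss in eq
      ... | just (q′ , as) with actual⊎mismatch t e p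
      ...   | inj₂ miss = there (there miss)
      ...   | inj₁ (c , r , refl) with cellAt (Vec.lookup (content c) i) h (position-of (source (proj₂ (Vec.lookup as i))) e) ≟ₛ s
      ...     | no ne = here (A-false {holds i s} {t} r ne)
      ...     | yes same = there (here (A-true {holds i s} {suc t} (conf-suc {t} r eq)
                  (trans (cong (λ tp → cellAt tp h (position-of (target (proj₂ (Vec.lookup as i))) e)) (Vec.lookup-zipWith act i as (content c)))
                  (trans (moved (proj₂ (Vec.lookup as i)) (proj₁ (Vec.lookup as i)) (Vec.lookup (content c) i) e)
                  (trans (cellAt-write (proj₁ (Vec.lookup as i)) (Vec.lookup (content c) i) h _ m) same)))))
      clause-of {t} {e} (print p@(q , ss) i) m with δ q ss in eq
      ... | just (q′ , as) with actual⊎mismatch t e p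
      ...   | inj₂ miss = there miss
      ...   | inj₁ (c , r , refl) = here (A-true {holds i (proj₁ (Vec.lookup as i))} {suc t} (conf-suc {t} r eq)
                  (trans (cong (λ tp → cellAt tp h (position-of (target (proj₂ (Vec.lookup as i))) e)) (Vec.lookup-zipWith act i as (content c)))
                  (trans (moved (proj₂ (Vec.lookup as i)) (proj₁ (Vec.lookup as i)) (Vec.lookup (content c) i) e)
                  (trans (cong (cellAt (write (proj₁ (Vec.lookup as i)) (Vec.lookup (content c) i)) h) m)
                         (cellAt-write-head (proj₁ (Vec.lookup as i)) (Vec.lookup (content c) i) h)))))

    run-model : IsModel A
    run-model τ _ _ m = clause-of τ m

-- The graph as a bounded formula

bools : List Bool
bools = false ∷ true ∷ []

∈-bools : ∀ b → b ∈ bools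
∈-bools false = here refl
∈-bools true  = there (here refl)

∈-allKinds : ∀ κ → κ ∈ Vec.toList allKinds
∈-allKinds κ = subst (_∈ Vec.toList allKinds) (lookup-kindCode κ) (∈-toList (kindCode κ) allKinds)
  where
  ∈-toList : ∀ {n} i (xs : Vec Kind n) → Vec.lookup xs i ∈ Vec.toList xs
  ∈-toList zero    (x ∷ xs) = here refl
  ∈-toList (suc i) (x ∷ xs) = there (∈-toList i xs)

-- The last seven variables are C, V, l, h, v, u and the length of the input.
module Drawing (k′ ℓ′ : ℕ) (occursF : Form 1 9) where
  private
    k ℓ : ℕ
    k = 2 + k′
    ℓ = 2 + ℓ′

  module _ (s : ℕ) where
    CE VE lE hE vE uE nE : Expr 1 (s + 7)
    CE = var (s ↑ʳ # 0)
    VE = var (s ↑ʳ # 1)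
    lE = var (s ↑ʳ # 2)
    hE = var (s ↑ʳ # 3)
    vE = var (s ↑ʳ # 4)
    uE = var (s ↑ʳ # 5)
    nE = var (s ↑ʳ # 6)

    JE : Expr 1 (s + 7)
    JE = VE ⊠ num 2 ⊠ CE

    joins : Expr 1 (s + 7) → Expr 1 (s + 7) → Form 1 (s + 7)
    joins a b = uE ≐ a ∧ᶠ vE ≐ b

  portE : ∀ {n} → Bool → Kind → Expr 1 n → Expr 1 n
  portE d κ j = num k ∔ (j ⊠ num 22 ∔ num (11 * toℕ (fromBool d) + toℕ (kindCode κ)))

  private
    z : ∀ {n} → Expr 1 (suc n)
    z = var zero

    y : ∀ {n} → Expr 1 (suc (suc n))
    y = var (suc zero)

  throughKindF : Kind → Form 1 8
  throughKindF κ = joins 1 (portE false κ z) (portE true κ z)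

  switchSideF : Bool → Form 1 8
  switchSideF h =
    joins 1 (portE true Q z) (portE false (α h) z) ∨ᶠ
    joins 1 (portE true (α h) z) (portE false P z) ∨ᶠ
    joins 1 (portE true (α (not h)) z) (portE false (ι h) z) ∨ᶠ
    joins 1 (portE true (ι h) z) (portE false (o h) z) ∨ᶠ
    joins 1 (portE true (ι h) z) (portE false Q (num 1 ∔ z)) ∨ᶠ
    joins 1 (portE true P (num 1 ∔ z)) (portE false (o h) z) ∨ᶠ
    joins 1 (portE true (o h) z) (portE false (α h) z)

  X→ιSignF : Bool → Form 1 8
  X→ιSignF b = joins 1 (portE true X z) (portE false (ι false) ((z ⊠ num 2 ∔ num (boolVal b)) ⊠ CE 1))

  o→XSignF : Bool → Form 1 9
  o→XSignF b = num 1 ∔ z ≐ (y ⊠ num 2 ∔ num (boolVal b)) ⊠ CE 2 ∔ CE 2 ∧ᶠ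
    joins 2 (portE true (o false) z) (portE false X (num 1 ∔ y))

  throughF switchF term→coreF core→termF core→PF P→termF term→QF Q→coreF core→XF : Form 1 7
  throughF = ∃ᶠ (num 1 ∔ (JE 0 ∔ (VE 0 ∔ (CE 0 ∔ num ℓ))))
    (anyOf (Vec.toList allKinds) throughKindF)
  switchF = ∃ᶠ (JE 0) (anyOf bools switchSideF)
  term→coreF = ∃ᶠ (num k) (∃ᶠ (num ℓ) (¬ᶠ (y ≐ num 1 ∧ᶠ z ≐ num 1) ∧ᶠ joins 2 y (portE false core z)))
  core→termF = ∃ᶠ (num k) (∃ᶠ (num ℓ)
    (¬ᶠ (y ≐ num 0 ∧ᶠ z ≐ num 1) ∧ᶠ ¬ᶠ (y ≐ num 1 ∧ᶠ z ≐ num 0) ∧ᶠ joins 2 (portE true core z) y))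
  core→PF = joins 0 (portE true core (num 0)) (portE false P (JE 0))
  P→termF = joins 0 (portE true P (num 0)) (num 1)
  term→QF = joins 0 (num 1) (portE false Q (num 0))
  Q→coreF = joins 0 (portE true Q (JE 0)) (portE false core (num 1))
  core→XF = joins 0 (portE true core (num 1)) (portE false X (num 0))

  X→ιF o→ιF o→XF X→YF Y→ιF o→YF Y→termF : Form 1 7
  X→ιF = ∃ᶠ (VE 0) (anyOf bools X→ιSignF)
  o→ιF = ∃ᶠ (VE 0 ⊠ num 2) (∃ᶠ (CE 1) (num 1 ∔ z ⋖ CE 2 ∧ᶠ
    joins 2 (portE true (o false) (y ⊠ CE 2 ∔ z)) (portE false (ι false) (y ⊠ CE 2 ∔ (num 1 ∔ z)))))
  o→XF = ∃ᶠ (VE 0) (∃ᶠ (JE 1) (anyOf bools o→XSignF))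
  X→YF = joins 0 (portE true X (VE 0)) (portE false Y (num 0))
  Y→ιF = ∃ᶠ (VE 0 ⊠ num 2) (∃ᶠ (CE 1) (occursF ∧ᶠ joins 2 (portE true Y z) (portE false (ι true) (y ⊠ CE 2 ∔ z))))
  o→YF = ∃ᶠ (VE 0 ⊠ num 2) (∃ᶠ (CE 1) (joins 2 (portE true (o true) (y ⊠ CE 2 ∔ z)) (portE false Y (num 1 ∔ z))))
  Y→termF = joins 0 (portE true Y (CE 0)) (num 0)

  rules : List (Form 1 7)
  rules = throughF ∷ switchF ∷ term→coreF ∷ core→termF ∷ core→PF ∷ P→termF ∷ term→QF ∷ Q→coreF ∷ core→XF ∷
          X→ιF ∷ o→ιF ∷ o→XF ∷ X→YF ∷ Y→ιF ∷ o→YF ∷ Y→termF ∷ []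

  bodyF : Form 1 7
  bodyF = ¬ᶠ (uE 0 ≐ vE 0) ∧ᶠ anyOf rules id

  module Drawn (x : Word) (V C l h n : ℕ) (Occ : ℕ → ℕ → Set)
    (occ⁺ : ∀ {u v y c} → Occ y c → Holds occursF (x ∷ []) (c ∷ y ∷ C ∷ V ∷ l ∷ h ∷ v ∷ u ∷ n ∷ []))
    (occ⁻ : ∀ {u v y c} → Holds occursF (x ∷ []) (c ∷ y ∷ C ∷ V ∷ l ∷ h ∷ v ∷ u ∷ n ∷ []) → Occ y c) where

    -- Larger than every index in use: up to `J` for `P`, `Q` and the switches, up to `V` for `X`,
    -- up to `C` for `Y`, and below ℓ for `core`.
    I : ℕ
    I = suc (V * 2 * C + (V + (C + ℓ)))

    open Realisation k′ ℓ′ V C I Occ hiding (k; ℓ)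

    private
      ws : Vec Word 1
      ws = x ∷ []

      Γ : ℕ → ℕ → Vec ℕ 7
      Γ u v = C ∷ V ∷ l ∷ h ∷ v ∷ u ∷ n ∷ []

    ArcBetween : ℕ → ℕ → Set
    ArcBetween u v = ∃[ a ] ∃[ b ] (Arc a b × code a ≡ u × code b ≡ v)

    private
      edge : ∀ {u v a b} → Edge a b → u ≡ code (tail a) → v ≡ code (head b) → ArcBetween u v
      edge e p q = _ , _ , along e refl refl , sym p , sym q

      Sound : Form 1 7 → Set
      Sound φ = ∀ {u v} → Holds φ ws (Γ u v) → ArcBetween u v

      through-sound : Sound throughF
      through-sound {u} {v} (j , j< , H) with anyOf⁻ {f = throughKindF} {ws} {j ∷ Γ u v} (Vec.toList allKinds) H
      ... | κ , _ , p , q = _ , _ , through κ j j< refl refl , sym p , sym q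

      switch-sound : Sound switchF
      switch-sound {u} {v} (j , j< , H) with anyOf⁻ {f = switchSideF} {ws} {j ∷ Γ u v} bools H
      ... | h , _ , inj₁ (p , q) = edge (Q→α h j<) p q
      ... | h , _ , inj₂ (inj₁ (p , q)) = edge (α→P h j<) p q
      ... | h , _ , inj₂ (inj₂ (inj₁ (p , q))) = edge (α→ι h refl j<) p q
      ... | h , _ , inj₂ (inj₂ (inj₂ (inj₁ (p , q)))) = edge (ι→o h j<) p q
      ... | h , _ , inj₂ (inj₂ (inj₂ (inj₂ (inj₁ (p , q))))) = edge (ι→Q h j<) p q
      ... | h , _ , inj₂ (inj₂ (inj₂ (inj₂ (inj₂ (inj₁ (p , q)))))) = edge (P→o h j<) p q
      ... | h , _ , inj₂ (inj₂ (inj₂ (inj₂ (inj₂ (inj₂ (p , q)))))) = edge (o→α h j<) p q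

      X→ι-sound : Sound X→ιF
      X→ι-sound {u} {w} (v , v< , H) with anyOf⁻ {f = X→ιSignF} {ws} {v ∷ Γ u w} bools H
      ... | b , _ , p , q = edge (X→ι b v< refl) p q

      o→X-sound : Sound o→XF
      o→X-sound {u} {w} (v , v< , j , _ , H) with anyOf⁻ {f = o→XSignF} {ws} {j ∷ v ∷ Γ u w} bools H
      ... | b , _ , e , p , q = edge (o→X b v< e) p q

      rules-sound : All Sound rules
      rules-sound =
        through-sound ∷
        switch-sound ∷
        (λ (i , i< , c , c< , ne , p , q) → edge (term→core i< c< ne) p q) ∷
        (λ (i , i< , c , c< , ne , ne′ , p , q) → edge (core→term i< c< ne ne′) p q) ∷
        (λ (p , q) → edge (core→P refl refl) p q) ∷
        (λ (p , q) → edge (P→term refl refl) p q) ∷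
        (λ (p , q) → edge (term→Q refl refl) p q) ∷
        (λ (p , q) → edge (Q→core refl refl) p q) ∷
        (λ (p , q) → edge (core→X refl refl) p q) ∷
        X→ι-sound ∷
        (λ (y , y< , c , _ , c< , p , q) → edge (o→ι y c y< c< refl refl) p q) ∷
        o→X-sound ∷
        (λ (p , q) → edge (X→Y refl refl) p q) ∷
        (λ {u} {v} (y , y< , c , c< , occ , p , q) → edge (Y→ι y c y< c< (occ⁻ {u} {v} occ) refl) p q) ∷
        (λ (y , y< , c , c< , p , q) → edge (o→Y y c y< c< refl) p q) ∷
        (λ (p , q) → edge (Y→term refl refl) p q) ∷ []

    body⁻ : ∀ {u v} → Holds bodyF ws (Γ u v) → u ≢ v × ArcBetween u v
    body⁻ {u} {v} (ne , H) with anyOf⁻ {f = id} {ws} {Γ u v} rules H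
    ... | φ , φ∈ , Hφ = ne , All.lookup rules-sound φ∈ Hφ

    private
      Drawable : ℕ → ℕ → Set
      Drawable u v = ∃[ φ ] (φ ∈ rules × Holds φ ws (Γ u v))

      switch-drawn : ∀ {u v j} b → j < J → Holds (switchSideF b) ws (j ∷ Γ u v) → Drawable u v
      switch-drawn {u} {v} {j} b j< H = switchF , there (here refl) , (j , j< , anyOf⁺ {f = switchSideF} {ws} {j ∷ Γ u v} (∈-bools b) H)

      edge-drawn : ∀ {a b} → Edge a b → Drawable (code (tail a)) (code (head b))
      edge-drawn (term→core i< c< ne) = term→coreF , there (there (here refl)) , (_ , i< , _ , c< , ne , refl , refl)
      edge-drawn (core→term i< c< ne ne′) = core→termF , there (there (there (here refl))) , (_ , i< , _ , c< , ne , ne′ , refl , refl)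
      edge-drawn (core→P refl refl) = core→PF , there (there (there (there (here refl)))) , (refl , refl)
      edge-drawn (P→term refl refl) = P→termF , there (there (there (there (there (here refl))))) , (refl , refl)
      edge-drawn (term→Q refl refl) = term→QF , there (there (there (there (there (there (here refl)))))) , (refl , refl)
      edge-drawn (Q→core refl refl) = Q→coreF , there (there (there (there (there (there (there (here refl))))))) , (refl , refl)
      edge-drawn (core→X refl refl) = core→XF , there (there (there (there (there (there (there (there (here refl)))))))) , (refl , refl)
      edge-drawn (Q→α b j<) = switch-drawn b j< (inj₁ (refl , refl))
      edge-drawn (α→P b j<) = switch-drawn b j< (inj₂ (inj₁ (refl , refl)))
      edge-drawn (α→ι b refl j<) = switch-drawn b j< (inj₂ (inj₂ (inj₁ (refl , refl))))
      edge-drawn (ι→o b j<) = switch-drawn b j< (inj₂ (inj₂ (inj₂ (inj₁ (refl , refl)))))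
      edge-drawn (ι→Q b j<) = switch-drawn b j< (inj₂ (inj₂ (inj₂ (inj₂ (inj₁ (refl , refl))))))
      edge-drawn (P→o b j<) = switch-drawn b j< (inj₂ (inj₂ (inj₂ (inj₂ (inj₂ (inj₁ (refl , refl)))))))
      edge-drawn (o→α b j<) = switch-drawn b j< (inj₂ (inj₂ (inj₂ (inj₂ (inj₂ (inj₂ (refl , refl)))))))
      edge-drawn (X→ι {v} b v< refl) = X→ιF , there (there (there (there (there (there (there (there (there (here refl))))))))) ,
        (v , v< , anyOf⁺ {f = X→ιSignF} {ws} {v ∷ Γ (code (port true X v)) (code (port false (ι false) (lit v b * C)))} (∈-bools b) (refl , refl))
      edge-drawn (o→ι y c y< c< refl refl) = o→ιF , there (there (there (there (there (there (there (there (there (there (here refl)))))))))) ,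
        (y , y< , c , ℕ.<⇒≤ c< , c< , refl , refl)
      edge-drawn (o→X {v} {j} b v< e) = o→XF , there (there (there (there (there (there (there (there (there (there (there (here refl))))))))))) ,
        (v , v< , j , ℕ.≤-trans (ℕ.≤-reflexive (trans e (ℕ.+-comm (lit v b * C) C))) (ℕ.*-monoˡ-≤ C (lit-< b v<)) ,
         anyOf⁺ {f = o→XSignF} {ws} {j ∷ v ∷ Γ (code (port true (o false) j)) (code (port false X (suc v)))} (∈-bools b) (e , refl , refl))
      edge-drawn (X→Y refl refl) = X→YF , there (there (there (there (there (there (there (there (there (there (there (there (here refl)))))))))))) , (refl , refl)
      edge-drawn (Y→ι {j} y c y< c< occ refl) = Y→ιF , there (there (there (there (there (there (there (there (there (there (there (there (there (here refl))))))))))))) ,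
        (y , y< , c , c< , occ⁺ {code (port true Y c)} {code (port false (ι true) j)} occ , refl , refl)
      edge-drawn (o→Y y c y< c< refl) = o→YF , there (there (there (there (there (there (there (there (there (there (there (there (there (there (here refl)))))))))))))) ,
        (y , y< , c , c< , refl , refl)
      edge-drawn (Y→term refl refl) = Y→termF , there (there (there (there (there (there (there (there (there (there (there (there (there (there (there (here refl))))))))))))))) , (refl , refl)

      arc-drawn : ∀ {a b} → Arc a b → Drawable (code a) (code b)
      arc-drawn (through κ j j< refl refl) = throughF , here refl , (j , j< , anyOf⁺ {f = throughKindF} {ws} {j ∷ Γ (code (port false κ j)) (code (port true κ j))} (∈-allKinds κ) (refl , refl))
      arc-drawn (along e refl refl) = edge-drawn e

    body⁺ : ∀ {u v a b} → u ≢ v → Arc a b → code a ≡ u → code b ≡ v → Holds bodyF ws (Γ u v)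
    body⁺ {a = a} {b} ne A refl refl with arc-drawn A
    ... | φ , φ∈ , Hφ = ne , anyOf⁺ {f = id} {ws} {Γ (code a) (code b)} φ∈ Hφ

-- The reduction

concatTo-front : ∀ n g → concatTo (suc n) g ≡ g 0 ++ concatTo n (g ∘ suc)
concatTo-front zero    g = sym (List.++-identityʳ (g 0))
concatTo-front (suc n) g = trans (cong (_++ g (suc n)) (concatTo-front n g)) (List.++-assoc (g 0) _ _)

concatTo-rows : ∀ n g → concatTo n g ≡ List.concat (List.tabulate {n = n} (g ∘ toℕ))
concatTo-rows zero    g = refl
concatTo-rows (suc n) g = trans (concatTo-front n g) (cong (g 0 ++_) (concatTo-rows n (g ∘ suc)))

concatTo-row : ∀ n g → concatTo n (λ i → g i ∷ []) ≡ List.tabulate {n = n} (g ∘ toℕ)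
concatTo-row zero    g = refl
concatTo-row (suc n) g = trans (concatTo-front n _) (cong (g 0 ∷_) (concatTo-row n (g ∘ suc)))

tabulate-const : ∀ n → List.tabulate {n = n} (λ _ → true) ≡ List.replicate n true
tabulate-const zero    = refl
tabulate-const (suc n) = cong (true ∷_) (tabulate-const n)

toList-tabulate : ∀ {n} (f : Fin n → Bool) → Vec.toList (Vec.tabulate f) ≡ List.tabulate f
toList-tabulate {zero}  f = refl
toList-tabulate {suc n} f = cong (f zero ∷_) (toList-tabulate (f ∘ suc))

concatTo-cong : ∀ n {g g′} → (∀ i → g i ≡ g′ i) → concatTo n g ≡ concatTo n g′
concatTo-cong zero    e = refl
concatTo-cong (suc n) e = cong₂ _++_ (concatTo-cong n e) (e n)

outWord-for : ∀ {r n} (a : Expr r n) (p : Out r (suc n)) ws ρ {m g} → ⟦ a ⟧ ws ρ ≡ m → (∀ i → outWord p ws (i ∷ ρ) ≡ g i) →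
              outWord (forOf a p) ws ρ ≡ concatTo m g
outWord-for a p ws ρ {g = g} e h = trans (concatTo-cong (⟦ a ⟧ ws ρ) h) (cong (λ m → concatTo m g) e)

abstract
  -- `a` and `a′` stand for the order in two scopes; `a′` is evaluated inside the loop over the
  -- rows, where the row number is an additional variable.
  encoder : Expr 1 1 → Expr 1 2 → Form 1 3 → Form 1 2 → Out 1 1
  encoder a a′ φ ψ =
    forOf a (emit (num 1)) ▹ emit (num 0) ▹ forOf a (forOf a′ (emit (toExpr φ))) ▹ forOf a (emit (toExpr ψ))

  outWord-encoder : ∀ {k} (G : TerminalDigraph k) a a′ φ ψ ws ρ → let open TerminalDigraph G in
      ⟦ a ⟧ ws ρ ≡ order → (∀ u → ⟦ a′ ⟧ ws (u ∷ ρ) ≡ order) →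
      (∀ u v → check φ ws (toℕ v ∷ toℕ u ∷ ρ) ≡ arc u v) → (∀ u → check ψ ws (toℕ u ∷ ρ) ≡ Vec.lookup terminals u) →
      outWord (encoder a a′ φ ψ) ws ρ ≡ encodeTerminalDigraph G
  outWord-encoder G a a′ φ ψ ws ρ e e′ arcs marks = cong₂ _++_ header (cong (false ∷_) (cong₂ _++_ matrix vector))
      where
      open TerminalDigraph G
      header : outWord (forOf a (emit (num 1))) ws ρ ≡ List.replicate order true
      header = trans (outWord-for a (emit (num 1)) ws ρ e (λ _ → refl)) (trans (concatTo-row order (λ _ → true)) (tabulate-const order))
      matrix : outWord (forOf a (forOf a′ (emit (toExpr φ)))) ws ρ ≡ List.concat (List.tabulate (λ u → List.tabulate (arc u)))
      matrix = trans (outWord-for a (forOf a′ (emit (toExpr φ))) ws ρ e λ u → trans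
          (outWord-for a′ (emit (toExpr φ)) ws (u ∷ ρ) (e′ u) λ v → cong (_∷ []) (check-value φ ws (v ∷ u ∷ ρ)))
          (concatTo-row order (λ v → check φ ws (v ∷ u ∷ ρ))))
        (trans (concatTo-rows order (λ u → List.tabulate {n = order} (λ v → check φ ws (toℕ v ∷ u ∷ ρ))))
          (cong List.concat (List.tabulate-cong λ u → List.tabulate-cong (arcs u))))
      vector : outWord (forOf a (emit (toExpr ψ))) ws ρ ≡ Vec.toList terminals
      vector = trans (outWord-for a (emit (toExpr ψ)) ws ρ e λ u → cong (_∷ []) (check-value ψ ws (u ∷ ρ)))
        (trans (concatTo-row order (λ u → check ψ ws (u ∷ ρ)))
          (trans (List.tabulate-cong marks) (trans (sym (toList-tabulate (Vec.lookup terminals))) (cong Vec.toList (Vec.tabulate∘lookup terminals)))))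

module Reduction (k′ ℓ′ : ℕ) (M : TM 2) (hP lP : Poly) where
  open Tableau M hiding (module Formula)

  private
    k ℓ : ℕ
    k = 2 + k′
    ℓ = 2 + ℓ′

  timesE positionsE variablesE clausesE orderE : ∀ {n} → Expr 1 n → Expr 1 n
  timesE h     = num 1 ∔ h
  positionsE h = num 1 ∔ (h ∔ h)
  variablesE h = (num 1 ∔ timesE h) ⊠ (num 1 ∔ positionsE h) ⊠ num facts
  clausesE h   = timesE h ⊠ positionsE h ⊠ num (length templates)
  orderE h     = num k ∔ (num 1 ∔ (variablesE h ⊠ num 2 ⊠ clausesE h ∔ (variablesE h ∔ (clausesE h ∔ num ℓ)))) ⊠ num 22

  -- In the scope of e, t, c, y, C, V, l, h, v, u and the length of the input.
  private
    eE tE cE yE lE hE nE : Expr 1 11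
    eE = var (# 0)
    tE = var (# 1)
    cE = var (# 2)
    yE = var (# 3)
    lE = var (# 6)
    hE = var (# 7)
    nE = var (# 10)

  placeE : Place → Expr 1 11
  placeE cur = eE
  placeE nxt = num 1 ∔ eE
  placeE mid = hE

  guardF : Guard → Form 1 11
  guardF never         = num 1 ≐ num 0
  guardF always        = num 0 ≐ num 0
  guardF initially     = tE ≐ num 0
  guardF leftOf        = tE ≐ num 0 ∧ᶠ eE ⋖ hE
  guardF xBeyond       = tE ≐ num 0 ∧ᶠ ¬ᶠ (eE ⋖ hE ∔ nE)
  guardF yInside       = tE ≐ num 0 ∧ᶠ ¬ᶠ (eE ⋖ hE)
  guardF yBeyond       = tE ≐ num 0 ∧ᶠ ¬ᶠ (eE ⋖ hE ∔ lE)
  guardF (xBit true)   = tE ≐ num 0 ∧ᶠ ∃ᶠ nE (var (# 1) ≐ var (# 8) ∔ var (# 0) ∧ᶠ bitF zero (var (# 0)))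
  guardF (xBit false)  = tE ≐ num 0 ∧ᶠ ∃ᶠ nE (var (# 1) ≐ var (# 8) ∔ var (# 0) ∧ᶠ ¬ᶠ (bitF zero (var (# 0))))
  guardF (headAt p)    = placeE p ≐ hE
  guardF (headNotAt p) = ¬ᶠ (placeE p ≐ hE)

  literalE : Literal → Expr 1 11
  literalE (literal b f later p) =
    (((num (boolVal later) ∔ tE) ⊠ (num 1 ∔ positionsE hE) ∔ placeE p) ⊠ num facts ∔ num (toℕ (factCode f))) ⊠ num 2 ∔ num (boolVal b)

  clauseF : Fin (length templates) → Form 1 11
  clauseF κ =
    cE ≐ (tE ⊠ positionsE hE ∔ eE) ⊠ num (length templates) ∔ num (toℕ κ) ∧ᶠ
    (guardF (guard (List.lookup templates κ)) ⇒ᶠ anyOf (literals (List.lookup templates κ)) (λ m → yE ≐ literalE m))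

  clausesF : Fin (length templates) → Form 1 9
  clausesF κ = ∃ᶠ (timesE (var (# 5))) (∃ᶠ (positionsE (var (# 6))) (clauseF κ))

  occursF : Form 1 9
  occursF = anyOf (List.allFin (length templates)) clausesF

  open Drawing k′ ℓ′ occursF using (bodyF; module Drawn)

  -- The quantifiers only name the values of h, l, V and C.
  arcF : Form 1 3
  arcF =
    ∃ᶠ (num 1 ∔ polyE hP (# 2)) (var (# 0) ≐ polyE hP (# 3) ∧ᶠ
    ∃ᶠ (num 1 ∔ polyE lP (# 3)) (var (# 0) ≐ polyE lP (# 4) ∧ᶠ
    ∃ᶠ (num 1 ∔ variablesE (var (# 1))) (var (# 0) ≐ variablesE (var (# 2)) ∧ᶠ
    ∃ᶠ (num 1 ∔ clausesE (var (# 2))) (var (# 0) ≐ clausesE (var (# 3)) ∧ᶠ bodyF))))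

  terminalF : Form 1 2
  terminalF = var (# 0) ⋖ num k

  printer : Out 1 1
  printer = encoder (orderE (polyE hP (# 0))) (orderE (polyE hP (# 1))) arcF terminalF

  module Correct (x : Word) where
    n h l : ℕ
    n = length x
    h = eval hP n
    l = eval lP n

    open Tableau.Formula M x h l

    private
      ws : Vec Word 1
      ws = x ∷ []

      Γ : ℕ → ℕ → Vec ℕ 7
      Γ u v = clauses ∷ variables ∷ l ∷ h ∷ v ∷ u ∷ n ∷ []

    module _ {u v : ℕ} where

      place-value : ∀ p {e t c y} → ⟦ placeE p ⟧ ws (e ∷ t ∷ c ∷ y ∷ Γ u v) ≡ position-of p e
      place-value cur = refl
      place-value nxt = refl
      place-value mid = refl

      -- `Meaning` has been phrased so that nearly every case agrees with its formula by definition;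
      -- only places have to be evaluated.
      guard⁺ : ∀ g {e t c y} → Meaning g t e → Holds (guardF g) ws (e ∷ t ∷ c ∷ y ∷ Γ u v)
      guard⁺ always        _ = refl
      guard⁺ initially     m = m
      guard⁺ leftOf        m = m
      guard⁺ xBeyond       m = m
      guard⁺ yInside       m = m
      guard⁺ yBeyond       m = m
      guard⁺ (xBit true)   m = m
      guard⁺ (xBit false)  m = m
      guard⁺ (headAt p)    m = trans (place-value p) m
      guard⁺ (headNotAt p) m = λ q → m (trans (sym (place-value p)) q)

      guard⁻ : ∀ g {e t c y} → Holds (guardF g) ws (e ∷ t ∷ c ∷ y ∷ Γ u v) → Meaning g t e
      guard⁻ never         ()
      guard⁻ always        _ = tt
      guard⁻ initially     m = m
      guard⁻ leftOf        m = m
      guard⁻ xBeyond       m = m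
      guard⁻ yInside       m = m
      guard⁻ yBeyond       m = m
      guard⁻ (xBit true)   m = m
      guard⁻ (xBit false)  m = m
      guard⁻ (headAt p)    m = trans (sym (place-value p)) m
      guard⁻ (headNotAt p) m = λ q → m (trans (place-value p) q)

      literal-value : ∀ m {e t c y} → ⟦ literalE m ⟧ ws (e ∷ t ∷ c ∷ y ∷ Γ u v) ≡ literalCode t e m
      literal-value (literal b f later p) {e} {t} =
        cong (λ q → ((time-of later t * suc E + q) * facts + toℕ (factCode f)) * 2 + boolVal b) (place-value p)

      occurs⁺ : ∀ {y c} → Occurs y c → Holds occursF ws (c ∷ y ∷ Γ u v)
      occurs⁺ {y} {c} (κ , t , e , t< , e< , eq , occ) = anyOf⁺ {f = clausesF} (∈-allFin κ)
        (t , t< , e , e< , eq , λ g → fromAny _ (occ (guard⁻ (guard (List.lookup templates κ)) g)))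
        where
        fromAny : ∀ ms → Any (λ m → y ≡ literalCode t e m) ms → Holds (anyOf ms (λ m → yE ≐ literalE m)) ws (e ∷ t ∷ c ∷ y ∷ Γ u v)
        fromAny (m ∷ ms) (here p)  = inj₁ (trans p (sym (literal-value m)))
        fromAny (m ∷ ms) (there q) = inj₂ (fromAny ms q)

      occurs⁻ : ∀ {y c} → Holds occursF ws (c ∷ y ∷ Γ u v) → Occurs y c
      occurs⁻ {y} {c} H with anyOf⁻ {f = clausesF} (List.allFin (length templates)) H
      ... | κ , _ , t , t< , e , e< , eq , occ =
        κ , t , e , t< , e< , eq , λ g → toAny _ (occ (guard⁺ (guard (List.lookup templates κ)) g))
        where
        toAny : ∀ ms → Holds (anyOf ms (λ m → yE ≐ literalE m)) ws (e ∷ t ∷ c ∷ y ∷ Γ u v) → Any (λ m → y ≡ literalCode t e m) ms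
        toAny (m ∷ ms) (inj₁ p) = here (trans p (literal-value m))
        toAny (m ∷ ms) (inj₂ q) = there (toAny ms q)

    open Drawn x variables clauses l h n Occurs (λ {u} {v} → occurs⁺ {u} {v}) (λ {u} {v} → occurs⁻ {u} {v})
    open Realisation k′ ℓ′ variables clauses I Occurs hiding (k; ℓ)

    arc⁻ : ∀ {u v} → Holds arcF ws (v ∷ u ∷ n ∷ []) → Holds bodyF ws (Γ u v)
    arc⁻ {u} {v} (h′ , _ , eh , l′ , _ , el , V′ , _ , eV , C′ , _ , eC , H) =
      bind (trans eh (⟦polyE⟧ hP (# 3) ws (h′ ∷ v ∷ u ∷ n ∷ []))) (trans el (⟦polyE⟧ lP (# 4) ws (l′ ∷ h′ ∷ v ∷ u ∷ n ∷ []))) eV eC H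
      where
      bind : ∀ {h′ l′ V′ C′} → h′ ≡ h → l′ ≡ l → V′ ≡ Tableau.Formula.variables M x h′ l′ → C′ ≡ Tableau.Formula.clauses M x h′ l′ →
             Holds bodyF ws (C′ ∷ V′ ∷ l′ ∷ h′ ∷ v ∷ u ∷ n ∷ []) → Holds bodyF ws (Γ u v)
      bind refl refl refl refl H = H

    arc⁺ : ∀ {u v} → Holds bodyF ws (Γ u v) → Holds arcF ws (v ∷ u ∷ n ∷ [])
    arc⁺ {u} {v} H =
      h , s≤s (ℕ.≤-reflexive (sym (⟦polyE⟧ hP (# 2) ws (v ∷ u ∷ n ∷ [])))) , sym (⟦polyE⟧ hP (# 3) ws (h ∷ v ∷ u ∷ n ∷ [])) ,
      l , s≤s (ℕ.≤-reflexive (sym (⟦polyE⟧ lP (# 3) ws (h ∷ v ∷ u ∷ n ∷ [])))) , sym (⟦polyE⟧ lP (# 4) ws (l ∷ h ∷ v ∷ u ∷ n ∷ [])) ,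
      variables , ℕ.≤-refl , refl , clauses , ℕ.≤-refl , refl , H

    arc : Fin N → Fin N → Bool
    arc u v = check arcF ws (toℕ v ∷ toℕ u ∷ n ∷ [])

    arc-sound : ∀ u v → arc u v ≡ true → Holds bodyF ws (Γ (toℕ u) (toℕ v))
    arc-sound u v t = arc⁻ (check⁻ arcF {ws} {toℕ v ∷ toℕ u ∷ n ∷ []} t)

    arc-realises : Realises arc
    arc-realises = record
      { sound    = λ {u} {v} t → proj₂ (body⁻ (arc-sound u v (T⇒true t)))
      ; complete = λ {u} {v} ne A eu ev → true⇒T (check⁺ arcF {ws} {toℕ v ∷ toℕ u ∷ n ∷ []} (arc⁺ (body⁺ (ne ∘ Fin.toℕ-injective) A eu ev)))
      }

    arc-loopless : ∀ v → arc v v ≡ false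
    arc-loopless v with arc v v in e
    ... | false = refl
    ... | true  = contradiction refl (proj₁ (arc-sound v v e))

    isTerminal : ℕ → Bool
    isTerminal u = check terminalF ws (u ∷ n ∷ [])

    isTerminal-<ᵇ : ∀ u → isTerminal u ≡ (u <ᵇ k)
    isTerminal-<ᵇ u with u <ᵇ k in e
    ... | true  = check⁺ terminalF {ws} {u ∷ n ∷ []} (ℕ.<ᵇ⇒< u k (true⇒T e))
    ... | false with isTerminal u in e′
    ...   | false = refl
    ...   | true  = contradiction (trans (sym (T⇒true (ℕ.<⇒<ᵇ (check⁻ terminalF {ws} {u ∷ n ∷ []} e′)))) e) λ ()

    terminals : Subset N
    terminals = Vec.tabulate (isTerminal ∘ toℕ)

    terminals⁺ : ∀ u → toℕ u < k → u ∈ₛ terminals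
    terminals⁺ u u< = ∈-tabulate⁺ {f = isTerminal ∘ toℕ} (check⁺ terminalF {ws} {toℕ u ∷ n ∷ []} u<)

    terminals⁻ : ∀ u → u ∈ₛ terminals → toℕ u < k
    terminals⁻ u u∈ = check⁻ terminalF {ws} {toℕ u ∷ n ∷ []} (∈-tabulate⁻ {f = isTerminal ∘ toℕ} u∈)

    graph : TerminalDigraph k
    graph = record
      { digraph     = record { order = N ; arc = arc ; loopless = arc-loopless }
      ; terminals   = terminals
      ; ∣terminals∣ = trans (count-tabulate N _ isTerminal (λ _ → refl))
          (trans (sumTo-cong N (λ {u} _ → cong boolVal (isTerminal-<ᵇ u))) (sumTo-below (ℕ.m≤m+n k _)))
      }

    private
      order₀ : ⟦ orderE (polyE hP (# 0)) ⟧ ws (n ∷ []) ≡ N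
      order₀ = cong (λ h → ⟦ orderE {1} (var zero) ⟧ ws (h ∷ [])) (⟦polyE⟧ hP (# 0) ws (n ∷ []))

      order₁ : ∀ u → ⟦ orderE (polyE hP (# 1)) ⟧ ws (u ∷ n ∷ []) ≡ N
      order₁ u = cong (λ h → ⟦ orderE {1} (var zero) ⟧ ws (h ∷ [])) (⟦polyE⟧ hP (# 1) ws (u ∷ n ∷ []))

    encode-graph : outWord printer ws (n ∷ []) ≡ encodeTerminalDigraph graph
    encode-graph = outWord-encoder graph (orderE (polyE hP (# 0))) (orderE (polyE hP (# 1))) arcF terminalF ws (n ∷ []) order₀ order₁
      (λ _ _ → refl) (λ u → sym (Vec.lookup∘tabulate (isTerminal ∘ toℕ) u))

    -- The template `begin` gives clauses for every input. The graph relies on this, because a route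
    -- must contain a switch.
    clauses≥1 : 1 ≤ clauses
    clauses≥1 = ℕ.*-mono-≤ {1} {T′ * E} {1} {length templates} (s≤s z≤n) (nonempty (∈-templates begin))
      where
      nonempty : ∀ {A : Set} {a : A} {as} → a ∈ as → 1 ≤ length as
      nonempty (here _)  = s≤s z≤n
      nonempty (there _) = s≤s z≤n

    packing⇒satisfiable : Packing (TerminalDigraph.digraph graph) terminals ℓ → Satisfiable variables clauses Occurs
    packing⇒satisfiable 𝓟 = FromPacking.satisfiable k′ ℓ′ variables clauses Occurs
      (ToNodes.nodePacking arc arc-loopless arc-realises {terminals} terminals⁺ {ℓ} 𝓟) clauses≥1

    satisfiable⇒packing : Satisfiable variables clauses Occurs → Packing (TerminalDigraph.digraph graph) terminals ℓ
    satisfiable⇒packing (σ , sat) = FromAssignment.ToPacking.packing k′ ℓ′ variables clauses I Occurs clauses≥1 σ witness satisfied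
        (s≤s (ℕ.m≤m+n J _))
        (s≤s (ℕ.≤-trans (ℕ.m≤m+n variables _) (ℕ.m≤n+m _ J)))
        (s≤s (ℕ.≤-trans (ℕ.m≤m+n clauses ℓ) (ℕ.≤-trans (ℕ.m≤n+m _ variables) (ℕ.m≤n+m _ J))))
        (s≤s (ℕ.≤-trans (ℕ.m≤n+m ℓ clauses) (ℕ.≤-trans (ℕ.m≤n+m _ variables) (ℕ.m≤n+m _ J))))
        arc arc-loopless arc-realises {terminals} terminals⁻
      where
      -- `FromAssignment` takes the witnessing variables as a total function; the value 0 outside
      -- the clauses is arbitrary.
      witness : ℕ → ℕ
      witness c with c ℕ.<? clauses
      ... | yes c< = proj₁ (sat c c<)
      ... | no _   = 0
      satisfied : ∀ c → c < clauses → witness c < variables × Occurs (lit (witness c) (σ (witness c))) c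
      satisfied c c< with c ℕ.<? clauses
      ... | yes c<′ = proj₂ (sat c c<′)
      ... | no c≮   = contradiction c< c≮

module _ {k m : ℕ} where

  private
    transfer : ∀ {n n′} {arc : Fin n → Fin n → Bool} {arc′ : Fin n′ → Fin n′ → Bool} {ll ll′} {S : Subset n} {S′ : Subset n′} →
      n ≡ n′ → (∀ u v u′ v′ → toℕ u ≡ toℕ u′ → toℕ v ≡ toℕ v′ → arc u v ≡ arc′ u′ v′) →
      (∀ u u′ → toℕ u ≡ toℕ u′ → Vec.lookup S u ≡ Vec.lookup S′ u′) →
      Packing (record { order = n ; arc = arc ; loopless = ll }) S m → Packing (record { order = n′ ; arc = arc′ ; loopless = ll′ }) S′ m
    transfer refl same marks 𝓟 = record
      { member   = λ i → let open Subgraph (member i) in record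
          { vertices = vertices ; arcs = arcs
          ; arcs⊆ = λ {u} {v} t → subst T (same u v u v refl refl) (arcs⊆ t) ; tail∈ = tail∈ ; head∈ = head∈ }
      ; strong   = strong
      ; contains = λ i {u} u∈ → contains i (Vec.lookup⇒[]= u _ (trans (marks u u refl) (Vec.[]=⇒lookup u∈)))
      ; disjoint = disjoint
      }
      where open Packing 𝓟

  -- The instance found for a printed word need not be the constructed one: adjacency is a function
  -- and looplessness carries proofs, so equal codes yield agreement bit by bit, and the packing has
  -- to be carried over.
  same-encoding : (G G′ : TerminalDigraph k) → let open TerminalDigraph in
    encodeTerminalDigraph G ≡ encodeTerminalDigraph G′ → Packing (digraph G) (terminals G) m → Packing (digraph G′) (terminals G′) m
  same-encoding G G′ e = transfer n≡n′
      (λ u v u′ v′ p q → trans (sym (encode-arc G u v)) (trans (same (λ w n → arcBit w n (toℕ u) (toℕ v))) (trans (cong₂ (arcBit (encodeTerminalDigraph G′) (TerminalDigraph.order G′)) p q) (encode-arc G′ u′ v′))))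
      (λ u u′ p → trans (sym (encode-terminal G u)) (trans (same (λ w n → terminalBit w n (toℕ u))) (trans (cong (terminalBit (encodeTerminalDigraph G′) (TerminalDigraph.order G′)) p) (encode-terminal G′ u′))))
    where
    n≡n′ : TerminalDigraph.order G ≡ TerminalDigraph.order G′
    n≡n′ = encodes-order (subst (λ w → Encodes k w (TerminalDigraph.order G)) e (encode-encodes G)) (encode-encodes G′)
    same : (f : Word → ℕ → Bool) → f (encodeTerminalDigraph G) (TerminalDigraph.order G) ≡ f (encodeTerminalDigraph G′) (TerminalDigraph.order G′)
    same f = cong₂ f e n≡n′

-- h bounds the running time of M on x and every certificate of length at most l.
module _ (k′ ℓ′ : ℕ) (M : TM 2) (hP lP : Poly) (x : Word) where
  open TM M using (initial; output; _⇓[_]_)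
  open Reduction k′ ℓ′ M hP lP using (printer; module Correct)

  private
    h l : ℕ
    h = eval hP (length x)
    l = eval lP (length x)

    Printed : Set
    Printed = DecisionProblem.language (StrongSubgraphPacking (2 + k′) (2 + ℓ′)) (outWord printer (x ∷ []) (length x ∷ []))

    2≤k : 2 ≤ 2 + k′
    2≤k = s≤s (s≤s z≤n)

    some-fact : 1 ≤ Tableau.facts M
    some-fact = ℕ.≤-trans (ℕ.≤-trans (s≤s z≤n) (Fin.toℕ<n (TM.start M))) (ℕ.m≤m+n _ _)

  accepted⇒printed : ∀ y → length y ≤ l → ∀ {n d} → initial (x ∷ y ∷ []) ⇓[ n ] d → output d ≡ true ∷ [] → Printed
  accepted⇒printed y y≤ r out =
    Correct.graph x , sym (Correct.encode-graph x) , packing⇒lambda≥ 2≤k (Correct.graph x) (Correct.satisfiable⇒packing x satisfiable)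
    where
    satisfiable : Satisfiable (Tableau.Formula.variables M x h l) (Tableau.Formula.clauses M x h l) (Tableau.Formula.Occurs M x h l)
    satisfiable = Tableau.Formula.model⇒satisfiable M x h l some-fact
      (Simulation.FromRun.A M x h l y y≤ r out , Simulation.FromRun.run-model M x h l y y≤ r out)

  printed⇒accepted : Printed →
    ∃[ y ] (length y ≤ l × (∀ {n d b} → initial (x ∷ y ∷ []) ⇓[ n ] d → n ≤ h → output d ≡ b ∷ [] → b ≡ true))
  printed⇒accepted (G , e , Λ) = Simulation.FromModel.model-accepts M x h l (proj₁ model) (proj₂ model)
    where
    satisfiable : Satisfiable (Tableau.Formula.variables M x h l) (Tableau.Formula.clauses M x h l) (Tableau.Formula.Occurs M x h l)
    satisfiable = Correct.packing⇒satisfiable x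
      (same-encoding G (Correct.graph x) (trans e (Correct.encode-graph x)) (lambda≥⇒packing 2≤k G Λ))
    model : ∃[ A ] Tableau.Formula.IsModel M x h l A
    model = Tableau.Formula.satisfiable⇒model M x h l satisfiable

packing-NPHard : ∀ k′ ℓ′ → NPHard (DecisionProblem.language (StrongSubgraphPacking (2 + k′) (2 + ℓ′)))
packing-NPHard k′ ℓ′ L′ (V , q , (M , p , computes) , L′⇔) =
  f ,
  polyTime-outWord printer (unary f) (λ { (x ∷ []) → refl }) ,
  λ x → mk⇔ (λ L′x → yes⇒printed x (Equivalence.to (L′⇔ x) L′x)) (λ m → Equivalence.from (L′⇔ x) (printed⇒yes x m))
  where
  hP : Poly
  -- The input of the verifier consists of `x` and a certificate of length at most `q`, so its total
  -- size is bounded by `X ⊕ q`.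
  hP = p ∘ₚ (X ⊕ q)

  printer : Out 1 1
  printer = Reduction.printer k′ ℓ′ M hP q

  f : Word → Word
  f x = outWord printer (x ∷ []) (length x ∷ [])

  in-time : ∀ x y {t} → length y ≤ eval q (length x) → t ≤ eval p (inputSize (x ∷ y ∷ [])) → t ≤ eval hP (length x)
  in-time x y y≤ t≤ = ℕ.≤-trans t≤ (ℕ.≤-trans
    (eval-mono p (ℕ.+-monoʳ-≤ (length x) (ℕ.≤-trans (ℕ.≤-reflexive (ℕ.+-identityʳ (length y))) y≤)))
    (ℕ.≤-reflexive (sym (eval-∘ₚ p (X ⊕ q) (length x)))))

  yes⇒printed : ∀ x → ∃[ y ] (length y ≤ eval q (length x) × V x y ≡ true) →
                DecisionProblem.language (StrongSubgraphPacking (2 + k′) (2 + ℓ′)) (f x)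
  yes⇒printed x (y , y≤ , yes!) =
    let (t , d , r , out , _) = computes (x ∷ y ∷ []) in
    accepted⇒printed k′ ℓ′ M hP q x y y≤ r (trans out (cong (_∷ []) yes!))

  printed⇒yes : ∀ x → DecisionProblem.language (StrongSubgraphPacking (2 + k′) (2 + ℓ′)) (f x) →
                ∃[ y ] (length y ≤ eval q (length x) × V x y ≡ true)
  printed⇒yes x printed =
    let (y , y≤ , accepts) = printed⇒accepted k′ ℓ′ M hP q x printed
        (t , d , r , out , t≤) = computes (x ∷ y ∷ [])
    -- The model only promises that a run within the bound prints true; that such a run exists for
    -- the certificate found is supplied by `computes`.
    in y , y≤ , accepts r (in-time x y y≤ t≤) out

theorem2p1 : ∀ (k ℓ : ℕ) → 2 ≤ k → 2 ≤ ℓ → NPComplete (DecisionProblem.language (StrongSubgraphPacking k ℓ))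
theorem2p1 (suc (suc k′)) (suc (suc ℓ′)) 2≤k@(s≤s (s≤s _)) (s≤s (s≤s _)) = packing∈NP 2≤k , packing-NPHard k′ ℓ′
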